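{- The sorting algorithm MergeInsertion needs $n\log n - c(n)\cdot n + O(\log n)$ comparisons on average to sort $n$ elements, where $c(n)\ge 1.3999$.
   Context: All logarithms are to base 2; the average is over the uniform distribution on all orderings of $n$ pairwise distinct elements, counting element comparisons. MergeInsertion (Ford–Johnson) on $n$ elements: (1) Group the elements into $\lfloor n/2\rfloor$ pairs and compare within each pair (one comparison per pair), calling the larger element of the $i$-th pair $a_i$ and the smaller $b_i$; if $n$ is odd, one element $b$ remains unpaired. (2) Sort the elements $a_i$ recursively with MergeInsertion; relabel so that $a_1<a_2<\dots<a_{\lfloor n/2\rfloor}$ and $b_i$ is the partner of $a_i$ (and the unpaired element, if any, is $b_{\lceil n/2\rceil}$). (3) The main chain is $b_1<a_1<\dots<a_{\lfloor n/2\rfloor}$; insert the remaining $b_i$ into the main chain by binary insertion, where $b_i$ ($i\le\lfloor n/2\rfloor$) is inserted among the main-chain elements smaller than $a_i$ (the unpaired element among all), in the order $b_3,b_2;\ b_5,b_4;\ b_{11},\dots,b_6;\ \dots;\ b_{t_k},b_{t_k-1},\dots,b_{t_{k-1}+1};\dots$, where $t_k=(2^{k+1}+(-1)^k)/3$ (indices exceeding the number of $b$'s are skipped, the last group being inserted starting from the largest existing index). In the analyzed (basic) variant, each element of the $k$-th group $b_{t_k},\dots,b_{t_{k-1}+1}$ is inserted by binary search over a range of at most $2^k-1$ main-chain elements, so using at most $k$ comparisons. -}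

module Defs where

open import Data.Bool using (Bool; if_then_else_)
open import Data.Integer as ℤ using (+_; -1ℤ)
import Data.Integer.Properties as ℤ
open import Data.List using (List; []; _∷_; [_]; _++_; map; concatMap; length; take; drop; head; reverse; zip; splitAt; break; mapMaybe; fromMaybe; upTo; applyUpTo)
open import Data.Maybe as Maybe using (Maybe; just; nothing)
open import Data.Maybe.Properties using (≡-dec)
open import Data.Nat as ℕ using (ℕ; zero; suc; s≤s; _^_; _!; _<ᵇ_; ⌊_/2⌋)
open import Data.Nat.ListAction using (sum)
open import Data.Nat.Logarithm using (⌊log₂_⌋; ⌊log₂⌋-mono-≤; ⌊log₂[2^n]⌋≡n; ⌊log₂⌊n/2⌋⌋≡⌊log₂n⌋∸1)
import Data.Nat.Properties as ℕ
open import Data.Nat.Solver using (module +-*-Solver)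
open import Data.Product using (_×_; _,_; proj₁; proj₂; ∃-syntax)
open import Data.Rational.Unnormalised as ℚ using (ℚᵘ; _/_; *≤*; *≡*)
import Data.Rational.Unnormalised.Properties as ℚ
open import Data.Sum using (inj₁; inj₂)
open import Function using (_on_)
open import Relation.Binary.PropositionalEquality using (_≡_; refl; sym; trans; cong; cong₂; subst; subst₂)

private
  variable
    A B : Set

------------------------------------------------------------------------
-- Counting comparisons

-- A result together with the number of comparisons spent on it.
Counted : Set → Set
Counted A = ℕ × A

return : A → Counted A
return x = 0 , x

infixl 1 _>>=_

_>>=_ : Counted A → (A → Counted B) → Counted B
(m , x) >>= f = m ℕ.+ proj₁ (f x) , proj₂ (f x)

-- The sorting algorithm is polymorphic in the element type and accesses
-- elements only through such a test.
Compare : Set → Set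
Compare A = A → A → Counted Bool

compareℕ : Compare ℕ
compareℕ x y = 1 , (x <ᵇ y)

------------------------------------------------------------------------
-- MergeInsertion

-- The pairs have the form (larger , smaller).
pairUp : Compare A → List A → Counted (List (A × A) × Maybe A)
pairUp _≺_ []           = return ([] , nothing)
pairUp _≺_ (x ∷ [])     = return ([] , just x)
pairUp _≺_ (x ∷ y ∷ zs) = do
  x≺y       ← x ≺ y
  ps , rest ← pairUp _≺_ zs
  return ((if x≺y then (y , x) else (x , y)) ∷ ps , rest)

-- Binary insertion into an ascending list: compare with the middle element
-- (that at position ⌊ length / 2 ⌋) and continue in the corresponding half.
-- The first argument bounds the recursion depth; the length of the list
-- suffices, in which case the clause for zero is reached only with xs = [].
binaryInsert : ℕ → Compare A → A → List A → Counted (List A)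
binaryInsert zero       _≺_ y xs = return (y ∷ xs)
binaryInsert (suc fuel) _≺_ y xs with splitAt ⌊ length xs /2⌋ xs
... | ls , []     = return (ls ++ [ y ])
... | ls , m ∷ rs = do
  y≺m ← y ≺ m
  if y≺m
    then (do ls′ ← binaryInsert fuel _≺_ y ls
             return (ls′ ++ m ∷ rs))
    else (do rs′ ← binaryInsert fuel _≺_ y rs
             return (ls ++ m ∷ rs′))

-- A main-chain element; the element aᵢ carries the label just i, and every
-- bᵢ the label nothing.
Entry : Set → Set
Entry A = A × Maybe ℕ

-- If no element has label i, break returns the whole chain as first part:
-- this is the case of the unpaired element.
insertBelow : Compare A → ℕ → A → List (Entry A) → Counted (List (Entry A))
insertBelow _≺_ i b chain = do
  let below , above = break (λ e → ≡-dec ℕ._≟_ (proj₂ e) (just i)) chain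
  below′ ← binaryInsert (length below) (_≺_ on proj₁) (b , nothing) below
  return (below′ ++ above)

insertAll : Compare A → List (ℕ × A) → List (Entry A) → Counted (List (Entry A))
insertAll _≺_ []             chain = return chain
insertAll _≺_ ((i , b) ∷ bs) chain = do
  chain′ ← insertBelow _≺_ i b chain
  insertAll _≺_ bs chain′

t : ℕ → ℕ
t k = ℤ.∣ (+ (2 ^ suc k) ℤ.+ -1ℤ ℤ.^ k) ℤ./ (+ 3) ∣

-- The indices t k, t k - 1, …, t (k - 1) + 1.
group : ℕ → List ℕ
group k = reverse (applyUpTo (λ j → suc (t (k ℕ.∸ 1) ℕ.+ j)) (t k ℕ.∸ t (k ℕ.∸ 1)))

-- The groups k = 2, …, m + 1 contain all of the indices 2, …, m.
-- Indices for which there is no element are skipped.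
insertionSequence : List A → List (ℕ × A)
insertionSequence bs =
  mapMaybe (λ i → Maybe.map (i ,_) (head (drop (i ℕ.∸ 1) bs)))
           (concatMap (λ j → group (2 ℕ.+ j)) (upTo (length bs)))

-- As in binaryInsert, the length of the list is a sufficient first argument.
mergeInsertion : ℕ → Compare A → List A → Counted (List A)
mergeInsertion zero       _≺_ xs = return xs
mergeInsertion (suc fuel) _≺_ xs = do
  pairs , rest ← pairUp _≺_ xs
  sorted       ← mergeInsertion fuel (_≺_ on proj₁) pairs
  let as    = map proj₁ sorted
      bs    = map proj₂ sorted ++ fromMaybe rest
      chain = map (_, nothing) (take 1 bs) ++
              zip as (map just (applyUpTo suc (length as)))
  chain′       ← insertAll _≺_ (insertionSequence bs) chain
  return (map proj₁ chain′)

comparisons : List ℕ → ℕ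
comparisons xs = proj₁ (mergeInsertion (length xs) compareℕ xs)

------------------------------------------------------------------------
-- The average over all orderings of 0, …, n - 1

insertions : A → List A → List (List A)
insertions x []       = [ [ x ] ]
insertions x (y ∷ ys) = (x ∷ y ∷ ys) ∷ map (y ∷_) (insertions x ys)

permutations : List A → List (List A)
permutations []       = [ [] ]
permutations (x ∷ xs) = concatMap (insertions x) (permutations xs)

averageComparisons : ℕ → ℚᵘ
averageComparisons n =
  _/_ (+ sum (map comparisons (permutations (upTo n)))) (n !) {{n ℕ.!≢0}}

------------------------------------------------------------------------
-- Real numbers, as regular sequences of rational numbers

ε : ℕ → ℚᵘ
ε k = + 1 / suc k

Regular : (ℕ → ℚᵘ) → Set
Regular x = ∀ j k → ℚ.∣ x j ℚ.- x k ∣ ℚ.≤ ε j ℚ.+ ε k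

record ℝ : Set where
  constructor mkℝ
  field
    seq     : ℕ → ℚᵘ
    regular : Regular seq

open ℝ public

infix 4 _≤ʳ_

-- The approximation seq x k differs from the number represented by x by at most ε k.
_≤ʳ_ : ℝ → ℝ → Set
x ≤ʳ y = ∀ k → seq x k ℚ.≤ seq y k ℚ.+ (ε k ℚ.+ ε k)

∣∣-lub : ∀ {p q} → p ℚ.≤ q → ℚ.- p ℚ.≤ q → ℚ.∣ p ∣ ℚ.≤ q
∣∣-lub {p} {q} p≤q -p≤q with ℚ.∣p∣≡p∨∣p∣≡-p p
... | inj₁ eq = subst (ℚ._≤ q) (sym eq) p≤q
... | inj₂ eq = subst (ℚ._≤ q) (sym eq) -p≤q

p≤∣p∣ : ∀ p → p ℚ.≤ ℚ.∣ p ∣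
p≤∣p∣ (ℚ.mkℚᵘ (+ n) d)       = ℚ.≤-refl
p≤∣p∣ (ℚ.mkℚᵘ ℤ.-[1+ n ] d) = *≤* (ℤ.*-monoʳ-≤-nonNeg (+ suc d) {ℤ.-[1+ n ]} {+ suc n} ℤ.-≤+)

p≃q+[p-q] : ∀ p q → p ℚ.≃ q ℚ.+ (p ℚ.- q)
p≃q+[p-q] p q = ℚ.≃-sym (begin
  q ℚ.+ (p ℚ.+ ℚ.- q)  ≈⟨ ℚ.+-congʳ q (ℚ.+-comm p (ℚ.- q)) ⟩
  q ℚ.+ (ℚ.- q ℚ.+ p)  ≈⟨ ℚ.+-assoc q (ℚ.- q) p ⟨
  (q ℚ.+ ℚ.- q) ℚ.+ p  ≈⟨ ℚ.+-congˡ p (ℚ.+-inverseʳ q) ⟩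
  ℚ.0ℚᵘ ℚ.+ p          ≈⟨ ℚ.+-identityˡ p ⟩
  p                    ∎)
  where open import Relation.Binary.Reasoning.Setoid ℚ.≃-setoid

regular-from-≤ : ∀ {x : ℕ → ℚᵘ} →
                 (∀ j k → x j ℚ.≤ x k ℚ.+ (ε j ℚ.+ ε k)) → Regular x
regular-from-≤ {x} h j k = ∣∣-lub (diff j k (h j k)) (begin
  ℚ.- (x j ℚ.- x k)  ≃⟨ neg-diff (x j) (x k) ⟩
  x k ℚ.- x j        ≤⟨ diff k j (h k j) ⟩
  ε k ℚ.+ ε j        ≃⟨ ℚ.+-comm (ε k) (ε j) ⟩
  ε j ℚ.+ ε k        ∎)
  where
  open ℚ.≤-Reasoning
  neg-diff : ∀ p q → ℚ.- (p ℚ.- q) ℚ.≃ q ℚ.- p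
  neg-diff p q = ℚ.≃-trans (ℚ.≃-reflexive (ℚ.neg-distrib-+ p (ℚ.- q)))
                 (ℚ.≃-trans (ℚ.+-congʳ (ℚ.- p) (ℚ.neg-involutive q))
                            (ℚ.+-comm (ℚ.- p) q))
  diff : ∀ j k → x j ℚ.≤ x k ℚ.+ (ε j ℚ.+ ε k) → x j ℚ.- x k ℚ.≤ ε j ℚ.+ ε k
  diff j k le = begin
    x j ℚ.- x k                            ≤⟨ ℚ.+-monoˡ-≤ (ℚ.- x k) le ⟩
    (x k ℚ.+ (ε j ℚ.+ ε k)) ℚ.- x k        ≃⟨ ℚ.+-assoc (x k) (ε j ℚ.+ ε k) (ℚ.- x k) ⟩
    x k ℚ.+ ((ε j ℚ.+ ε k) ℚ.- x k)        ≃⟨ p≃q+[p-q] (ε j ℚ.+ ε k) (x k) ⟨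
    ε j ℚ.+ ε k                            ∎

≤-from-regular : ∀ (x : ℝ) j k → seq x j ℚ.≤ seq x k ℚ.+ (ε j ℚ.+ ε k)
≤-from-regular x j k = begin
  seq x j                              ≃⟨ p≃q+[p-q] (seq x j) (seq x k) ⟩
  seq x k ℚ.+ (seq x j ℚ.- seq x k)    ≤⟨ ℚ.+-monoʳ-≤ (seq x k) (ℚ.≤-trans (p≤∣p∣ _) (regular x j k)) ⟩
  seq x k ℚ.+ (ε j ℚ.+ ε k)            ∎
  where open ℚ.≤-Reasoning

+-interchange : ∀ p q r s → (p ℚ.+ q) ℚ.+ (r ℚ.+ s) ℚ.≃ (p ℚ.+ r) ℚ.+ (q ℚ.+ s)
+-interchange p q r s = begin
  (p ℚ.+ q) ℚ.+ (r ℚ.+ s)  ≈⟨ ℚ.+-assoc p q (r ℚ.+ s) ⟩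
  p ℚ.+ (q ℚ.+ (r ℚ.+ s))  ≈⟨ ℚ.+-congʳ p (ℚ.+-assoc q r s) ⟨
  p ℚ.+ ((q ℚ.+ r) ℚ.+ s)  ≈⟨ ℚ.+-congʳ p (ℚ.+-congˡ s (ℚ.+-comm q r)) ⟩
  p ℚ.+ ((r ℚ.+ q) ℚ.+ s)  ≈⟨ ℚ.+-congʳ p (ℚ.+-assoc r q s) ⟩
  p ℚ.+ (r ℚ.+ (q ℚ.+ s))  ≈⟨ ℚ.+-assoc p r (q ℚ.+ s) ⟨
  (p ℚ.+ r) ℚ.+ (q ℚ.+ s)  ∎
  where open import Relation.Binary.Reasoning.Setoid ℚ.≃-setoid

fromℚ : ℚᵘ → ℝ
fromℚ q = mkℝ (λ _ → q) (regular-from-≤ {λ _ → q} λ j k → begin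
  q                          ≃⟨ ℚ.+-identityʳ q ⟨
  q ℚ.+ ℚ.0ℚᵘ                ≤⟨ ℚ.+-monoʳ-≤ q (ℚ.nonNegative⁻¹ (ε j ℚ.+ ε k)) ⟩
  q ℚ.+ (ε j ℚ.+ ε k)        ∎)
  where open ℚ.≤-Reasoning

infixl 6 _+ʳ_ _-ʳ_
infix  8 -ʳ_
infixl 7 _·_

_+ʳ_ : ℝ → ℝ → ℝ
x +ʳ y = mkℝ z (regular-from-≤ {z} λ j k → begin
  seq x (i j) ℚ.+ seq y (i j)
    ≤⟨ ℚ.+-mono-≤ (≤-from-regular x (i j) (i k)) (≤-from-regular y (i j) (i k)) ⟩
  (seq x (i k) ℚ.+ (ε (i j) ℚ.+ ε (i k))) ℚ.+ (seq y (i k) ℚ.+ (ε (i j) ℚ.+ ε (i k)))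
    ≃⟨ +-interchange (seq x (i k)) _ (seq y (i k)) _ ⟩
  (seq x (i k) ℚ.+ seq y (i k)) ℚ.+ ((ε (i j) ℚ.+ ε (i k)) ℚ.+ (ε (i j) ℚ.+ ε (i k)))
    ≃⟨ ℚ.+-congʳ (z k) (ℚ.≃-trans (+-interchange (ε (i j)) (ε (i k)) (ε (i j)) (ε (i k))) (ℚ.+-cong (halves j) (halves k))) ⟩
  (seq x (i k) ℚ.+ seq y (i k)) ℚ.+ (ε j ℚ.+ ε k)
    ∎)
  where
  open ℚ.≤-Reasoning
  i : ℕ → ℕ
  i k = suc (2 ℕ.* k)
  z : ℕ → ℚᵘ
  z k = seq x (i k) ℚ.+ seq y (i k)
  halves : ∀ k → ε (i k) ℚ.+ ε (i k) ℚ.≃ ε k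
  halves k = *≡* (cong +_ (solve 1 (λ k →
      let d = con 2 :+ con 2 :* k in
      (con 1 :* d :+ con 1 :* d) :* (con 1 :+ k) := con 1 :* (d :* d)) refl k))
    where open +-*-Solver

-ʳ_ : ℝ → ℝ
-ʳ x = mkℝ (λ k → ℚ.- seq x k) λ j k →
  subst (ℚ._≤ ε j ℚ.+ ε k)
    (trans (sym (ℚ.∣-p∣≡∣p∣ (seq x j ℚ.- seq x k)))
           (cong ℚ.∣_∣ (ℚ.neg-distrib-+ (seq x j) (ℚ.- seq x k))))
    (regular x j k)

_-ʳ_ : ℝ → ℝ → ℝ
x -ʳ y = x +ʳ (-ʳ y)

∣_∣ʳ : ℝ → ℝ
∣ x ∣ʳ = mkℝ z (regular-from-≤ {z} λ j k → begin
  ℚ.∣ seq x j ∣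
    ≃⟨ ℚ.∣-∣-cong (p≃q+[p-q] (seq x j) (seq x k)) ⟩
  ℚ.∣ seq x k ℚ.+ (seq x j ℚ.- seq x k) ∣
    ≤⟨ ℚ.∣p+q∣≤∣p∣+∣q∣ (seq x k) (seq x j ℚ.- seq x k) ⟩
  ℚ.∣ seq x k ∣ ℚ.+ ℚ.∣ seq x j ℚ.- seq x k ∣
    ≤⟨ ℚ.+-monoʳ-≤ ℚ.∣ seq x k ∣ (regular x j k) ⟩
  ℚ.∣ seq x k ∣ ℚ.+ (ε j ℚ.+ ε k)
    ∎)
  where
  open ℚ.≤-Reasoning
  z : ℕ → ℚᵘ
  z k = ℚ.∣ seq x k ∣

-- Multiplication of a real number by a natural number.
_·_ : ℕ → ℝ → ℝ
n · x = mkℝ z (regular-from-≤ {z} λ j k → begin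
  N ℚ.* seq x (i j)
    ≤⟨ ℚ.*-monoʳ-≤-nonNeg N (≤-from-regular x (i j) (i k)) ⟩
  N ℚ.* (seq x (i k) ℚ.+ (ε (i j) ℚ.+ ε (i k)))
    ≃⟨ ℚ.*-distribˡ-+ N (seq x (i k)) _ ⟩
  z k ℚ.+ N ℚ.* (ε (i j) ℚ.+ ε (i k))
    ≃⟨ ℚ.+-congʳ (z k) (ℚ.*-distribˡ-+ N (ε (i j)) (ε (i k))) ⟩
  z k ℚ.+ (N ℚ.* ε (i j) ℚ.+ N ℚ.* ε (i k))
    ≤⟨ ℚ.+-monoʳ-≤ (z k) (ℚ.+-mono-≤ (small j) (small k)) ⟩
  z k ℚ.+ (ε j ℚ.+ ε k)
    ∎)
  where
  open ℚ.≤-Reasoning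
  N : ℚᵘ
  N = + n / 1
  i : ℕ → ℕ
  i k = n ℕ.* suc k
  z : ℕ → ℚᵘ
  z k = N ℚ.* seq x (i k)
  small : ∀ k → N ℚ.* ε (i k) ℚ.≤ ε k
  small k = *≤* (subst₂ ℤ._≤_ lhs rhs (ℤ.+≤+ (ℕ.n≤1+n (n ℕ.* suc k))))
    where
    lhs : + (n ℕ.* suc k) ≡ (+ n ℤ.* + 1) ℤ.* + suc k
    lhs = trans (ℤ.pos-* n (suc k)) (cong (ℤ._* + suc k) (sym (ℤ.*-identityʳ (+ n))))
    rhs : + suc (n ℕ.* suc k) ≡ + 1 ℤ.* + (1 ℕ.* suc (n ℕ.* suc k))
    rhs = trans (cong +_ (sym (ℕ.*-identityˡ _))) (sym (ℤ.*-identityˡ _))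

------------------------------------------------------------------------
-- The binary logarithm

n≤1+2⌊n/2⌋ : ∀ n → n ℕ.≤ suc (2 ℕ.* ⌊ n /2⌋)
n≤1+2⌊n/2⌋ zero          = ℕ.z≤n
n≤1+2⌊n/2⌋ (suc zero)    = s≤s ℕ.z≤n
n≤1+2⌊n/2⌋ (suc (suc n)) = ℕ.≤-trans (s≤s (s≤s (n≤1+2⌊n/2⌋ n)))
  (ℕ.≤-reflexive (cong suc (sym (ℕ.*-suc 2 ⌊ n /2⌋))))

2⌊n/2⌋≤n : ∀ n → 2 ℕ.* ⌊ n /2⌋ ℕ.≤ n
2⌊n/2⌋≤n zero          = ℕ.z≤n
2⌊n/2⌋≤n (suc zero)    = ℕ.z≤n
2⌊n/2⌋≤n (suc (suc n)) = ℕ.≤-trans (ℕ.≤-reflexive (ℕ.*-suc 2 ⌊ n /2⌋))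
  (s≤s (s≤s (2⌊n/2⌋≤n n)))

log-bounds : ∀ f n → suc n ℕ.≤ f →
             2 ^ ⌊log₂ suc n ⌋ ℕ.≤ suc n × suc (suc n) ℕ.≤ 2 ^ suc ⌊log₂ suc n ⌋
log-bounds (suc f) zero    _         = ℕ.≤-refl , ℕ.≤-refl
log-bounds (suc f) (suc n) (s≤s n<f) =
    subst (λ l → 2 ^ l ℕ.≤ suc (suc n)) eq
      (ℕ.≤-trans (ℕ.*-monoʳ-≤ 2 (proj₁ ih)) (2⌊n/2⌋≤n (suc (suc n))))
  , subst (λ l → suc (suc (suc n)) ℕ.≤ 2 ^ suc l) eq
      (ℕ.≤-trans (s≤s (n≤1+2⌊n/2⌋ (suc (suc n))))
        (ℕ.≤-trans (ℕ.≤-reflexive (sym (ℕ.*-suc 2 (suc ⌊ n /2⌋))))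
                   (ℕ.*-monoʳ-≤ 2 (proj₂ ih))))
  where
  ih = log-bounds f ⌊ n /2⌋ (ℕ.≤-trans (s≤s (ℕ.⌊n/2⌋≤n n)) n<f)
  eq : suc ⌊log₂ suc ⌊ n /2⌋ ⌋ ≡ ⌊log₂ suc (suc n) ⌋
  eq = cong suc (⌊log₂⌊n/2⌋⌋≡⌊log₂n⌋∸1 (suc (suc n)))

m*log≤log^ : ∀ m b → m ℕ.* ⌊log₂ suc b ⌋ ℕ.≤ ⌊log₂ suc b ^ m ⌋
m*log≤log^ m b = begin
  m ℕ.* l                ≡⟨ ⌊log₂[2^n]⌋≡n (m ℕ.* l) ⟨
  ⌊log₂ 2 ^ (m ℕ.* l) ⌋  ≡⟨ cong (λ x → ⌊log₂ 2 ^ x ⌋) (ℕ.*-comm m l) ⟩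
  ⌊log₂ 2 ^ (l ℕ.* m) ⌋  ≡⟨ cong ⌊log₂_⌋ (ℕ.^-*-assoc 2 l m) ⟨
  ⌊log₂ (2 ^ l) ^ m ⌋    ≤⟨ ⌊log₂⌋-mono-≤ (ℕ.^-monoˡ-≤ m (proj₁ (log-bounds _ b ℕ.≤-refl))) ⟩
  ⌊log₂ suc b ^ m ⌋      ∎
  where
  open ℕ.≤-Reasoning
  l = ⌊log₂ suc b ⌋

log^≤m*log+m : ∀ m b → ⌊log₂ suc b ^ m ⌋ ℕ.≤ m ℕ.* ⌊log₂ suc b ⌋ ℕ.+ m
log^≤m*log+m m b = begin
  ⌊log₂ suc b ^ m ⌋          ≤⟨ ⌊log₂⌋-mono-≤ (ℕ.^-monoˡ-≤ m (ℕ.<⇒≤ (proj₂ (log-bounds _ b ℕ.≤-refl)))) ⟩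
  ⌊log₂ (2 ^ suc l) ^ m ⌋    ≡⟨ cong ⌊log₂_⌋ (ℕ.^-*-assoc 2 (suc l) m) ⟩
  ⌊log₂ 2 ^ (suc l ℕ.* m) ⌋  ≡⟨ ⌊log₂[2^n]⌋≡n (suc l ℕ.* m) ⟩
  m ℕ.+ l ℕ.* m              ≡⟨ ℕ.+-comm m (l ℕ.* m) ⟩
  l ℕ.* m ℕ.+ m              ≡⟨ cong (ℕ._+ m) (ℕ.*-comm l m) ⟩
  m ℕ.* l ℕ.+ m              ∎
  where
  open ℕ.≤-Reasoning
  l = ⌊log₂ suc b ⌋

logs-close : ∀ n j k → suc k ℕ.* ⌊log₂ n ^ suc j ⌋ ℕ.≤ suc j ℕ.* ⌊log₂ n ^ suc k ⌋ ℕ.+ suc j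
logs-close zero    j k = ℕ.≤-trans (ℕ.≤-reflexive (ℕ.*-zeroʳ (suc k))) ℕ.z≤n
logs-close (suc b) j k = begin
  suc k ℕ.* ⌊log₂ suc b ^ suc j ⌋            ≤⟨ via (suc k) (suc j) ⟩
  ⌊log₂ suc b ^ (suc j ℕ.* suc k) ⌋          ≡⟨ cong (λ x → ⌊log₂ suc b ^ x ⌋) (ℕ.*-comm (suc j) (suc k)) ⟩
  ⌊log₂ suc b ^ (suc k ℕ.* suc j) ⌋          ≤⟨ via′ (suc j) (suc k) ⟩
  suc j ℕ.* ⌊log₂ suc b ^ suc k ⌋ ℕ.+ suc j  ∎
  where
  open ℕ.≤-Reasoning
  via : ∀ m i → m ℕ.* ⌊log₂ suc b ^ i ⌋ ℕ.≤ ⌊log₂ suc b ^ (i ℕ.* m) ⌋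
  via m i with suc b ^ i in eq | ℕ.m^n≢0 (suc b) i
  ... | suc c | _ = subst (λ x → m ℕ.* ⌊log₂ suc c ⌋ ℕ.≤ ⌊log₂ x ⌋)
                      (trans (cong (_^ m) (sym eq)) (ℕ.^-*-assoc (suc b) i m)) (m*log≤log^ m c)
  via′ : ∀ m i → ⌊log₂ suc b ^ (i ℕ.* m) ⌋ ℕ.≤ m ℕ.* ⌊log₂ suc b ^ i ⌋ ℕ.+ m
  via′ m i with suc b ^ i in eq | ℕ.m^n≢0 (suc b) i
  ... | suc c | _ = subst (λ x → ⌊log₂ x ⌋ ℕ.≤ m ℕ.* ⌊log₂ suc c ⌋ ℕ.+ m)
                      (trans (cong (_^ m) (sym eq)) (ℕ.^-*-assoc (suc b) i m)) (log^≤m*log+m m c)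

-- The k-th rational approximation of log₂ n is ⌊ log₂ (n ^ (k + 1)) ⌋ / (k + 1),
-- which differs from log₂ n by less than 1 / (k + 1).  By convention log₂ 0 = 0.
log₂ : ℕ → ℝ
log₂ n = mkℝ z (regular-from-≤ {z} λ j k → begin
  z j                                ≤⟨ close j k ⟩
  z k ℚ.+ ε k                        ≤⟨ ℚ.+-monoʳ-≤ (z k) (ℚ.p≤q+p (ε k) (ε j)) ⟩
  z k ℚ.+ (ε j ℚ.+ ε k)              ∎)
  where
  open ℚ.≤-Reasoning
  z : ℕ → ℚᵘ
  z k = + ⌊log₂ n ^ suc k ⌋ / suc k
  close : ∀ j k → z j ℚ.≤ z k ℚ.+ ε k
  close j k = *≤* (subst₂ ℤ._≤_ (lhs a k) (rhs b j k)
      (ℤ.+≤+ (ℕ.*-monoʳ-≤ (suc k) (logs-close n j k))))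
    where
    a = ⌊log₂ n ^ suc j ⌋
    b = ⌊log₂ n ^ suc k ⌋
    lhs : ∀ a k → + (suc k ℕ.* (suc k ℕ.* a)) ≡ + a ℤ.* + (suc k ℕ.* suc k)
    lhs a k = trans (cong +_ (trans (sym (ℕ.*-assoc (suc k) (suc k) a)) (ℕ.*-comm (suc k ℕ.* suc k) a)))
                    (ℤ.pos-* a (suc k ℕ.* suc k))
    rhs : ∀ b j k → + (suc k ℕ.* (suc j ℕ.* b ℕ.+ suc j))
                    ≡ (+ b ℤ.* + suc k ℤ.+ + 1 ℤ.* + suc k) ℤ.* + suc j
    rhs b j k = trans (cong +_ (solve 3 (λ b j k →
          k :* (j :* b :+ j) := (b :* k :+ con 1 :* k) :* j) refl b (suc j) (suc k)))
        (trans (ℤ.pos-* (b ℕ.* suc k ℕ.+ 1 ℕ.* suc k) (suc j))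
          (cong (ℤ._* + suc j) (trans (ℤ.pos-+ (b ℕ.* suc k) (1 ℕ.* suc k))
            (cong₂ ℤ._+_ (ℤ.pos-* b (suc k)) (ℤ.pos-* 1 (suc k))))))
      where open +-*-Solver

------------------------------------------------------------------------
-- Asymptotics

infix 4 _∈O_

-- A natural number as constant factor is no restriction.
_∈O_ : (ℕ → ℝ) → (ℕ → ℝ) → Set
f ∈O g = ∃[ C ] ∃[ N ] (∀ n → N ℕ.≤ n → ∣ f n ∣ʳ ≤ʳ C · g n)

-- Sorting the larger elements of the pairs recursively, MergeInsertion with n
-- elements performs m = ⌊ n / 2 ⌋ comparisons plus those for sorting m elements
-- plus those for inserting the elements bᵢ.  Each input is determined by the
-- order of the pairs, their orientations and the positions at which the bᵢ are
-- inserted, and every combination of these occurs; so the average of the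
-- last contribution is an average over all sequences of positions.
--
-- An element of the group with index k needs at most k comparisons.  In the last
-- group, with t = t (k - 1) < u = ⌈ n / 2 ⌉, an element is inserted into at most
-- t + u gaps.  The position of the element is not uniformly distributed, but the
-- earlier gaps are more probable, and as the short branches of the search tree are
-- evenly spread, on average only k + 1 - 2 ^ k / (t + u) comparisons are needed
-- up to an error of O (k / t).
--
-- As t ≈ 2 ^ k / 3, the average number of comparisons for all insertions with
-- u = 2 ^ k z is at most u (log₂ u + 1 - c) if log₂ z + 6 / (1 + 3 z) ≥ c, and
-- then n log₂ n - c n solves the recurrence.  The left-hand side of this
-- inequality has the minimum 1.39998… on the interval from 1 / 3 to 2 / 3.

module Submission where

import Data.Integer as ℤ
import Data.Integer.Properties as ℤ
open import Defs
open import Data.Bool using (Bool; true; false; T; _∧_; if_then_else_)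
open import Data.Bool.Properties using (T-≡; T-∧)
open import Data.Empty using (⊥-elim)
import Data.Integer.DivMod as ℤ
import Data.Integer.Tactic.RingSolver as ℤ
open import Data.Integer using (-1ℤ)
open import Data.List using (List; []; _∷_; _∷ʳ_; _++_; length; map; concatMap; mapMaybe; filter; upTo; applyUpTo; applyDownFrom; take; drop; head; splitAt; break; fromMaybe; zip)
open import Data.List.Membership.Propositional using (_∈_; _∉_; lose)
open import Data.List.Membership.Propositional.Properties using (∈-map⁺; ∈-map⁻; ∈-++⁻; ∈-++⁺ˡ; ∈-++⁺ʳ; ∈-∃++; ∈-concatMap⁺; ∈-upTo⁺)
open import Data.List.Properties hiding (≡-dec; sum-++)
import Data.List.Properties as List
open import Data.List.Relation.Binary.Disjoint.Propositional using (Disjoint)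
open import Data.List.Relation.Binary.Permutation.Propositional using (_↭_; prep; swap; ↭-refl; ↭-sym; ↭-trans; ↭-reflexive; module PermutationReasoning)
import Data.List.Relation.Binary.Permutation.Propositional.Properties as ↭
open import Data.List.Relation.Unary.All as All using (All; []; _∷_)
import Data.List.Relation.Unary.All.Properties as All
open import Data.List.Relation.Unary.AllPairs as AllPairs using (AllPairs; []; _∷_)
import Data.List.Relation.Unary.AllPairs.Properties as AllPairs
open import Data.List.Relation.Unary.Any using (here; there)
open import Data.List.Relation.Unary.Unique.Propositional using (Unique)
import Data.List.Relation.Unary.Unique.Propositional.Properties as Unique
open import Data.Maybe as Maybe using (Maybe; just; nothing)
import Data.Maybe.Properties as Maybe
open import Data.Nat hiding (parity; _/_; _%_)
open import Data.Nat.DivMod using (m*n/n≡m)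
open import Data.Nat.ListAction using (sum)
open import Data.Nat.ListAction.Properties using (sum-++; sum-↭)
open import Data.Nat.Logarithm
open import Data.Nat.Properties
open import Data.Nat.Tactic.RingSolver using (solve-∀)
open import Data.Product using (_×_; _,_; proj₁; proj₂; ∃; ∃₂; ∃-syntax; Σ-syntax; uncurry)
import Data.Product.Properties as ×
open import Data.Sum using (_⊎_; inj₁; inj₂)
open import Data.Unit using (tt)
open import Function using (_∘_; id; _on_; Equivalence)
open import Relation.Binary.Definitions using (DecidableEquality; tri<; tri≈; tri>)
open import Relation.Binary.PropositionalEquality
open import Relation.Nullary using (Dec; does; yes; no; ¬?)
open import Relation.Unary using (Decidable)

-- Only an upper bound for the average is proved. The equation with a two-sided error follows
-- because c(n) may depend on n: it is the larger of 1.3999 and the rational number for which the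
-- equation holds up to approximation of the logarithm. Until the last part all estimates are
-- inequalities between natural numbers: costs are measured in units of 1 / D, and log₂ n is
-- represented by the fractions p / q with n^q ≤ 2^p. The gap between the minimum 1.39998... and
-- 1.3999 is the budget for all losses. The value 1.39995 is certified by finitely many integer
-- inequalities; the remaining 0.00005 absorbs, at every level of the recursion, errors linear in k
-- and the rounding to multiples of 1 / D. What is left is a constant per level, hence the error O
-- (log n). The uneven distribution of positions is handled by summation by parts, for which prefix
-- sums of the depths of leaves must be controlled and not only their total. On the side of the
-- algorithm, inputs are encoded injectively by the choices that determine them; these choices
-- number exactly n !, so that the passage to all choices loses nothing.

private
  variable
    A B : Set

-- A lower bound for the logarithm

2^-cancel-≤ : ∀ {a b} → 2 ^ a ≤ 2 ^ b → a ≤ b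
2^-cancel-≤ h = ≮⇒≥ λ b<a → <⇒≱ (^-monoʳ-< 2 (s≤s (s≤s z≤n)) b<a) h

-- As A + i ≤ M for i < j, the quotient (M + 1) / M is at most (A + i + 1) / (A + i), and the
-- product of the latter over i < j telescopes to (A + j) / A.
pow-ratio : ∀ A j M → A + j ≤ suc M → A * suc M ^ j ≤ (A + j) * M ^ j
pow-ratio A zero    M _ = ≤-reflexive (cong (_* 1) (sym (+-identityʳ A)))
pow-ratio A (suc j) M h = begin
  A * (suc M * suc M ^ j) ≡⟨ lem A (suc M) (suc M ^ j) ⟩
  suc M * (A * suc M ^ j) ≤⟨ *-monoʳ-≤ (suc M) (pow-ratio A j M (m≤n⇒m≤1+n A+j≤M)) ⟩
  suc M * ((A + j) * M ^ j) ≡⟨ *-assoc (suc M) (A + j) (M ^ j) ⟨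
  (suc M * (A + j)) * M ^ j ≤⟨ *-monoˡ-≤ (M ^ j) (+-monoˡ-≤ (M * (A + j)) A+j≤M) ⟩
  (M + M * (A + j)) * M ^ j ≡⟨ lem′ M (A + j) (M ^ j) ⟩
  suc (A + j) * (M * M ^ j) ≡⟨ cong (_* (M * M ^ j)) (+-suc A j) ⟨
  (A + suc j) * (M * M ^ j) ∎
  where
  open ≤-Reasoning
  A+j≤M : A + j ≤ M
  A+j≤M = s≤s⁻¹ (≤-trans (≤-reflexive (sym (+-suc A j))) h)
  lem : ∀ a b c → a * (b * c) ≡ b * (a * c)
  lem = solve-∀
  lem′ : ∀ a b c → (a + a * b) * c ≡ suc b * (a * c)
  lem′ = solve-∀

-- Concavity of the logarithm on the interval from A to A + j + l.
chord : ∀ A j l → A ^ l * (A + j + l) ^ j ≤ (A + j) ^ (l + j)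
chord A j zero    = ≤-reflexive (trans (*-identityˡ _) (cong (_^ j) (+-identityʳ (A + j))))
chord A j (suc l) = begin
  A * A ^ l * (A + j + suc l) ^ j ≡⟨ cong (λ x → A * A ^ l * x ^ j) (+-suc (A + j) l) ⟩
  A * A ^ l * suc (A + j + l) ^ j ≡⟨ lem A (A ^ l) _ ⟩
  A ^ l * (A * suc (A + j + l) ^ j) ≤⟨ *-monoʳ-≤ (A ^ l) (pow-ratio A j (A + j + l) (m≤n⇒m≤1+n (m≤m+n (A + j) l))) ⟩
  A ^ l * ((A + j) * (A + j + l) ^ j) ≡⟨ lem′ (A ^ l) (A + j) _ ⟩
  (A + j) * (A ^ l * (A + j + l) ^ j) ≤⟨ *-monoʳ-≤ (A + j) (chord A j l) ⟩
  (A + j) * (A + j) ^ (l + j) ∎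
  where
  open ≤-Reasoning
  lem : ∀ a b c → a * b * c ≡ b * (a * c)
  lem = solve-∀
  lem′ : ∀ a b c → a * (b * c) ≡ b * (a * c)
  lem′ = solve-∀

^-distribʳ-* : ∀ o m n → (m * n) ^ o ≡ m ^ o * n ^ o
^-distribʳ-* zero    m n = refl
^-distribʳ-* (suc o) m n = trans (cong (m * n *_) (^-distribʳ-* o m n)) (lem m n (m ^ o) (n ^ o))
  where
  lem : ∀ a b c d → a * b * (c * d) ≡ a * c * (b * d)
  lem = solve-∀

^-swap : ∀ x a b → (x ^ a) ^ b ≡ (x ^ b) ^ a
^-swap x a b = trans (^-*-assoc x a b) (trans (cong (x ^_) (*-comm a b)) (sym (^-*-assoc x b a)))

module _ (G Q k m p q s₀ s₁ e₀ e₁ j l : ℕ) .{{_ : NonZero G}}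
  (log₀ : G ^ Q ≤ 2 ^ s₀ * e₀ ^ Q) (log₁ : G ^ Q ≤ 2 ^ s₁ * e₁ ^ Q)
  (left : G * m ≡ e₀ * 2 ^ k + j) (right : e₁ * 2 ^ k ≡ G * m + l)
  (mp : m ^ q ≤ 2 ^ p) where
  private
    P = 2 ^ k
    w = l + j

  end-bound : ∀ s e r → G ^ Q ≤ 2 ^ s * e ^ Q → (G * P) ^ (Q * r) ≤ 2 ^ (s * r) * ((e * P) ^ r) ^ Q
  end-bound s e r h = begin
    (G * P) ^ (Q * r) ≡⟨ ^-*-assoc (G * P) Q r ⟨
    ((G * P) ^ Q) ^ r ≡⟨ cong (_^ r) (^-distribʳ-* Q G P) ⟩
    (G ^ Q * P ^ Q) ^ r ≤⟨ ^-monoˡ-≤ r (*-monoˡ-≤ (P ^ Q) h) ⟩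
    (2 ^ s * e ^ Q * P ^ Q) ^ r ≡⟨ cong (_^ r) (trans (*-assoc (2 ^ s) (e ^ Q) (P ^ Q)) (cong (2 ^ s *_) (sym (^-distribʳ-* Q e P)))) ⟩
    (2 ^ s * (e * P) ^ Q) ^ r ≡⟨ ^-distribʳ-* r (2 ^ s) _ ⟩
    (2 ^ s) ^ r * ((e * P) ^ Q) ^ r ≡⟨ cong₂ _*_ (^-*-assoc 2 s r) (^-swap (e * P) Q r) ⟩
    2 ^ (s * r) * ((e * P) ^ r) ^ Q ∎
    where open ≤-Reasoning

  -- The hypotheses bound log₂ (G / e₀) and log₂ (G / e₁) by s₀ / Q and s₁ / Q, and G m divides the
  -- interval from e₀ 2^k to e₁ 2^k into pieces of lengths j and l. By concavity log₂ (m / 2^k) is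
  -- at least the interpolated value - (s₀ l + s₁ j) / (Q w); raising everything to the power Q w q
  -- clears the denominators.
  chord-log : k * (q * (Q * w)) ≤ p * (Q * w) + q * (s₀ * l + s₁ * j)
  chord-log = 2^-cancel-≤ (begin
    2 ^ (k * (q * (Q * w))) ≡⟨ cong (λ x → 2 ^ (k * x)) (*-comm q (Q * w)) ⟩
    2 ^ (k * (Q * w * q)) ≡⟨ ^-*-assoc 2 k _ ⟨
    P ^ (Q * w * q) ≡⟨ ^-*-assoc P (Q * w) q ⟨
    (P ^ (Q * w)) ^ q ≤⟨ ^-monoˡ-≤ q main ⟩
    (2 ^ S * m ^ (Q * w)) ^ q ≡⟨ ^-distribʳ-* q (2 ^ S) _ ⟩
    (2 ^ S) ^ q * (m ^ (Q * w)) ^ q ≡⟨ cong₂ _*_ (^-*-assoc 2 S q) (^-swap m (Q * w) q) ⟩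
    2 ^ (S * q) * (m ^ q) ^ (Q * w) ≤⟨ *-monoʳ-≤ (2 ^ (S * q)) (^-monoˡ-≤ (Q * w) mp) ⟩
    2 ^ (S * q) * (2 ^ p) ^ (Q * w) ≡⟨ cong (2 ^ (S * q) *_) (^-*-assoc 2 p (Q * w)) ⟩
    2 ^ (S * q) * 2 ^ (p * (Q * w)) ≡⟨ ^-distribˡ-+-* 2 (S * q) _ ⟨
    2 ^ (S * q + p * (Q * w)) ≡⟨ cong (2 ^_) (trans (+-comm (S * q) _) (cong (p * (Q * w) +_) (*-comm S q))) ⟩
    2 ^ (p * (Q * w) + q * S) ∎)
    where
    open ≤-Reasoning
    S = s₀ * l + s₁ * j
    lem : ∀ a b c d → (a * b) * (c * d) ≡ (a * c) * (b * d)
    lem = solve-∀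
    main′ : G ^ (Q * w) * P ^ (Q * w) ≤ G ^ (Q * w) * (2 ^ S * m ^ (Q * w))
    main′ = begin
      G ^ (Q * w) * P ^ (Q * w) ≡⟨ ^-distribʳ-* (Q * w) G P ⟨
      (G * P) ^ (Q * w) ≡⟨ cong ((G * P) ^_) (*-distribˡ-+ Q l j) ⟩
      (G * P) ^ (Q * l + Q * j) ≡⟨ ^-distribˡ-+-* (G * P) (Q * l) (Q * j) ⟩
      (G * P) ^ (Q * l) * (G * P) ^ (Q * j) ≤⟨ *-mono-≤ (end-bound s₀ e₀ l log₀) (end-bound s₁ e₁ j log₁) ⟩
      (2 ^ (s₀ * l) * ((e₀ * P) ^ l) ^ Q) * (2 ^ (s₁ * j) * ((e₁ * P) ^ j) ^ Q)
                                          ≡⟨ lem (2 ^ (s₀ * l)) _ (2 ^ (s₁ * j)) _ ⟩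
      (2 ^ (s₀ * l) * 2 ^ (s₁ * j)) * (((e₀ * P) ^ l) ^ Q * ((e₁ * P) ^ j) ^ Q)
                                          ≡⟨ cong₂ _*_ (sym (^-distribˡ-+-* 2 (s₀ * l) (s₁ * j))) (sym (^-distribʳ-* Q ((e₀ * P) ^ l) _)) ⟩
      2 ^ S * ((e₀ * P) ^ l * (e₁ * P) ^ j) ^ Q
                                          ≡⟨ cong (λ x → 2 ^ S * ((e₀ * P) ^ l * x ^ j) ^ Q) (trans right (cong (_+ l) left)) ⟩
      2 ^ S * ((e₀ * P) ^ l * (e₀ * P + j + l) ^ j) ^ Q
                                          ≤⟨ *-monoʳ-≤ (2 ^ S) (^-monoˡ-≤ Q (chord (e₀ * P) j l)) ⟩
      2 ^ S * ((e₀ * P + j) ^ w) ^ Q ≡⟨ cong (λ x → 2 ^ S * (x ^ w) ^ Q) left ⟨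
      2 ^ S * ((G * m) ^ w) ^ Q ≡⟨ cong (2 ^ S *_) (trans (^-swap (G * m) w Q) (^-*-assoc (G * m) Q w)) ⟩
      2 ^ S * (G * m) ^ (Q * w) ≡⟨ cong (2 ^ S *_) (^-distribʳ-* (Q * w) G m) ⟩
      2 ^ S * (G ^ (Q * w) * m ^ (Q * w)) ≡⟨ lem′ (2 ^ S) (G ^ (Q * w)) _ ⟩
      G ^ (Q * w) * (2 ^ S * m ^ (Q * w)) ∎
      where
      lem′ : ∀ a b c → a * (b * c) ≡ b * (a * c)
      lem′ = solve-∀
    main : P ^ (Q * w) ≤ 2 ^ S * m ^ (Q * w)
    main = *-cancelˡ-≤ (G ^ (Q * w)) {{m^n≢0 G (Q * w)}} main′

-- The three conditions are nonnegativity of the Bernstein coefficients of a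
-- quadratic polynomial on an interval.
bernstein : ∀ K α₀ α₁ β₀ β₁ j l →
            α₀ * β₀ ≤ K → α₁ * β₁ ≤ K → α₁ * β₀ + α₀ * β₁ ≤ 2 * K →
            (α₀ * l + α₁ * j) * (β₀ * l + β₁ * j) ≤ K * ((l + j) * (l + j))
bernstein K α₀ α₁ β₀ β₁ j l h₀ h₁ h₂ = begin
  (α₀ * l + α₁ * j) * (β₀ * l + β₁ * j) ≡⟨ lem α₀ α₁ β₀ β₁ j l ⟩
  (α₀ * β₀) * (l * l) + (α₁ * β₀ + α₀ * β₁) * (l * j) + (α₁ * β₁) * (j * j) ≤⟨ +-mono-≤ (+-mono-≤ (*-monoˡ-≤ (l * l) h₀) (*-monoˡ-≤ (l * j) h₂)) (*-monoˡ-≤ (j * j) h₁) ⟩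
  K * (l * l) + 2 * K * (l * j) + K * (j * j) ≡⟨ lem′ K j l ⟩
  K * ((l + j) * (l + j)) ∎
  where
  open ≤-Reasoning
  lem : ∀ α₀ α₁ β₀ β₁ j l → (α₀ * l + α₁ * j) * (β₀ * l + β₁ * j) ≡ (α₀ * β₀) * (l * l) + (α₁ * β₀ + α₀ * β₁) * (l * j) + (α₁ * β₁) * (j * j)
  lem = solve-∀
  lem′ : ∀ K j l → K * (l * l) + 2 * K * (l * j) + K * (j * j) ≡ K * ((l + j) * (l + j))
  lem′ = solve-∀

-- log₂ z ≥ a / b - 6 / (1 + 3 z) with z = m / 2 ^ k, where log₂ m ≤ p / q.
LogBound : (a b k m p q : ℕ) → Set
LogBound a b k m p q = q * (b * k + a) * (2 ^ k + 3 * m) ≤ b * (p * (2 ^ k + 3 * m) + 6 * 2 ^ k * q)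

-- For z = m / 2^k the claim is (a / b - log₂ z) (1 + 3 z) ≤ 6. On a cell, - log₂ z lies below its
-- chord, so that a quadratic polynomial in z has to be bounded. A number e stands for z = e / (3
-- E): then `α₀`, `α₁` are b Q times the end values of the first factor, and E + e₀, E + e₁ are E
-- times those of the second.
cell-bound : ∀ E Q a b k m p q s₀ s₁ e₀ e₁ .{{_ : NonZero E}} .{{_ : NonZero Q}} →
  e₀ < e₁ →
  (3 * E) ^ Q ≤ 2 ^ s₀ * e₀ ^ Q → (3 * E) ^ Q ≤ 2 ^ s₁ * e₁ ^ Q →
  (a * Q + b * s₀) * (E + e₀) ≤ 6 * E * Q * b →
  (a * Q + b * s₁) * (E + e₁) ≤ 6 * E * Q * b →
  (a * Q + b * s₁) * (E + e₀) + (a * Q + b * s₀) * (E + e₁) ≤ 2 * (6 * E * Q * b) →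
  e₀ * 2 ^ k ≤ 3 * E * m → 3 * E * m ≤ e₁ * 2 ^ k → m ^ q ≤ 2 ^ p → LogBound a b k m p q
cell-bound E Q a b k m p q s₀ s₁ e₀ e₁ e₀<e₁ log₀ log₁ c₀ c₁ c₂ left right mp =
  *-cancelˡ-≤ (E * d * (Q * w)) {{nz}} (begin
    E * d * (Q * w) * (q * (b * k + a) * Y)
      ≡⟨ r₁ E d Q w q b k a Y ⟩
    E * d * b * Y * (k * (q * (Q * w))) + E * d * q * (a * Q * w) * Y
      ≤⟨ +-monoˡ-≤ _ (*-monoʳ-≤ (E * d * b * Y) (chord-log (3 * E) Q k m p q s₀ s₁ e₀ e₁ j l {{nzG}} log₀ log₁ left′ right′ mp)) ⟩
    E * d * b * Y * (p * (Q * w) + q * (s₀ * l + s₁ * j)) + E * d * q * (a * Q * w) * Y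
      ≡⟨ r₂ E d b Y p Q j l q s₀ s₁ a ⟩
    E * d * b * Y * (p * (Q * w)) + q * ((α₀ * l + α₁ * j) * (E * (d * Y)))
      ≡⟨ cong (λ x → E * d * b * Y * (p * (Q * w)) + q * ((α₀ * l + α₁ * j) * x)) eY ⟩
    E * d * b * Y * (p * (Q * w)) + q * ((α₀ * l + α₁ * j) * ((E + e₀) * l + (E + e₁) * j))
      ≤⟨ +-monoʳ-≤ _ (*-monoʳ-≤ q (bernstein _ α₀ α₁ (E + e₀) (E + e₁) j l c₀ c₁ c₂)) ⟩
    E * d * b * Y * (p * (Q * w)) + q * (6 * E * Q * b * (w * w))
      ≡⟨ cong (λ x → E * d * b * Y * (p * (Q * w)) + q * (6 * E * Q * b * (w * x))) (sym dP) ⟩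
    E * d * b * Y * (p * (Q * w)) + q * (6 * E * Q * b * (w * (d * P)))
      ≡⟨ r₃ E d b Y p Q w q P ⟩
    E * d * (Q * w) * (b * (p * Y + 6 * P * q)) ∎)
  where
  open ≤-Reasoning
  P = 2 ^ k
  Y = P + 3 * m
  d = e₁ ∸ e₀
  j = 3 * E * m ∸ e₀ * P
  l = e₁ * P ∸ 3 * E * m
  w = l + j
  α₀ = a * Q + b * s₀
  α₁ = a * Q + b * s₁
  left′ : 3 * E * m ≡ e₀ * P + j
  left′ = sym (m+[n∸m]≡n left)
  right′ : e₁ * P ≡ 3 * E * m + l
  right′ = sym (m+[n∸m]≡n right)
  d+e₀ : e₁ ≡ e₀ + d
  d+e₀ = sym (m+[n∸m]≡n (<⇒≤ e₀<e₁))
  dP : d * P ≡ w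
  dP = +-cancelˡ-≡ (e₀ * P) _ _ (begin-equality
    e₀ * P + d * P ≡⟨ *-distribʳ-+ P e₀ d ⟨
    (e₀ + d) * P ≡⟨ cong (_* P) (sym d+e₀) ⟩
    e₁ * P ≡⟨ right′ ⟩
    3 * E * m + l ≡⟨ cong (_+ l) left′ ⟩
    e₀ * P + j + l ≡⟨ +-assoc (e₀ * P) j l ⟩
    e₀ * P + (j + l) ≡⟨ cong (e₀ * P +_) (+-comm j l) ⟩
    e₀ * P + w ∎)
  -- 1 + 3 z is linear in z and therefore equal to the interpolation of its end values.
  eY : E * (d * Y) ≡ (E + e₀) * l + (E + e₁) * j
  eY = begin-equality
    E * (d * (P + 3 * m)) ≡⟨ s₁′ E d P m ⟩
    E * (d * P) + d * (3 * E * m) ≡⟨ cong₂ (λ x y → E * x + d * y) dP left′ ⟩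
    E * w + d * (e₀ * P + j) ≡⟨ s₂′ E d e₀ P j l ⟩
    E * w + (e₀ * (d * P) + d * j) ≡⟨ cong (λ x → E * w + (e₀ * x + d * j)) dP ⟩
    E * w + (e₀ * w + d * j) ≡⟨ s₃′ E e₀ d j l ⟩
    (E + e₀) * l + (E + (e₀ + d)) * j ≡⟨ cong (λ x → (E + e₀) * l + (E + x) * j) (sym d+e₀) ⟩
    (E + e₀) * l + (E + e₁) * j ∎
    where
    s₁′ : ∀ E d P m → E * (d * (P + 3 * m)) ≡ E * (d * P) + d * (3 * E * m)
    s₁′ = solve-∀
    s₂′ : ∀ E d e₀ P j l → E * (l + j) + d * (e₀ * P + j) ≡ E * (l + j) + (e₀ * (d * P) + d * j)
    s₂′ = solve-∀
    s₃′ : ∀ E e₀ d j l → E * (l + j) + (e₀ * (l + j) + d * j) ≡ (E + e₀) * l + (E + (e₀ + d)) * j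
    s₃′ = solve-∀
  nzG : NonZero (3 * E)
  nzG = m*n≢0 3 E
  nzd : NonZero d
  nzd = >-nonZero (m<n⇒0<n∸m e₀<e₁)
  nz : NonZero (E * d * (Q * w))
  nz = m*n≢0 (E * d) (Q * w) {{m*n≢0 E d {{it}} {{nzd}}}} {{m*n≢0 Q w {{it}} {{subst NonZero dP (m*n≢0 d P {{nzd}} {{m^n≢0 2 k}})}}}}
    where
    it : ∀ {x} .{{_ : NonZero x}} → NonZero x
    it {x} = ≢-nonZero (≢-nonZero⁻¹ x)
  r₁ : ∀ E d Q w q b k a Y → E * d * (Q * w) * (q * (b * k + a) * Y) ≡ E * d * b * Y * (k * (q * (Q * w))) + E * d * q * (a * Q * w) * Y
  r₁ = solve-∀
  r₂ : ∀ E d b Y p Q j l q s₀ s₁ a → E * d * b * Y * (p * (Q * (l + j)) + q * (s₀ * l + s₁ * j)) + E * d * q * (a * Q * (l + j)) * Y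
       ≡ E * d * b * Y * (p * (Q * (l + j))) + q * (((a * Q + b * s₀) * l + (a * Q + b * s₁) * j) * (E * (d * Y)))
  r₂ = solve-∀
  r₃ : ∀ E d b Y p Q w q P → E * d * b * Y * (p * (Q * w)) + q * (6 * E * Q * b * (w * (d * P))) ≡ E * d * (Q * w) * (b * (p * Y + 6 * P * q))
  r₃ = solve-∀

-- Numerical certificate for the bound on the logarithm

∧⁻ : ∀ {x y} → T (x ∧ y) → T x × T y
∧⁻ = Equivalence.to T-∧

-- Evaluating powers as nested powers keeps the recursion of _^_ shallow.
module Chain (E a b H Q₁ Q₂ : ℕ) .{{_ : NonZero E}} .{{_ : NonZero (Q₁ * Q₂)}} where

  Q = Q₁ * Q₂

  -- A breakpoint (e , h , r) claims log₂ (3 E / e) ≤ (H h + r) / Q.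
  Breakpoint : Set
  Breakpoint = ℕ × ℕ × ℕ

  exponent : Breakpoint → ℕ
  exponent (_ , h , r) = H * h + r

  logCheck : Breakpoint → Bool
  logCheck (e , h , r) = ((3 * E) ^ Q₁) ^ Q₂ ≤ᵇ (((2 ^ H) ^ h) * 2 ^ r) * (e ^ Q₁) ^ Q₂

  cellCheck : (e₀ e₁ s₀ s₁ : ℕ) → Bool
  cellCheck e₀ e₁ s₀ s₁ =
    (e₀ <ᵇ e₁) ∧
    ((a * Q + b * s₀) * (E + e₀) ≤ᵇ 6 * E * Q * b) ∧
    ((a * Q + b * s₁) * (E + e₁) ≤ᵇ 6 * E * Q * b) ∧
    ((a * Q + b * s₁) * (E + e₀) + (a * Q + b * s₀) * (E + e₁) ≤ᵇ 2 * (6 * E * Q * b))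

  check : Breakpoint → List Breakpoint → Bool
  check x []       = logCheck x
  check x (y ∷ ys) = logCheck x ∧ cellCheck (proj₁ x) (proj₁ y) (exponent x) (exponent y) ∧ check y ys

  last : Breakpoint → List Breakpoint → ℕ
  last x []       = proj₁ x
  last x (y ∷ ys) = last y ys

  logCheck-sound : ∀ x → T (logCheck x) → (3 * E) ^ Q ≤ 2 ^ exponent x * proj₁ x ^ Q
  logCheck-sound (e , h , r) ok =
    subst₂ _≤_ (^-*-assoc (3 * E) Q₁ Q₂)
      (cong₂ _*_ (trans (cong (_* 2 ^ r) (^-*-assoc 2 H h)) (sym (^-distribˡ-+-* 2 (H * h) r)))
                 (^-*-assoc e Q₁ Q₂))
      (≤ᵇ⇒≤ _ _ ok)

  head-sound : ∀ x ys → T (check x ys) → (3 * E) ^ Q ≤ 2 ^ exponent x * proj₁ x ^ Q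
  head-sound x []       ok = logCheck-sound x ok
  head-sound x (y ∷ ys) ok = logCheck-sound x (proj₁ (∧⁻ {logCheck x} ok))

  cellCheck-sound : ∀ k m p q e₀ e₁ s₀ s₁ → T (cellCheck e₀ e₁ s₀ s₁) →
    (3 * E) ^ Q ≤ 2 ^ s₀ * e₀ ^ Q → (3 * E) ^ Q ≤ 2 ^ s₁ * e₁ ^ Q →
    e₀ * 2 ^ k ≤ 3 * E * m → 3 * E * m ≤ e₁ * 2 ^ k → m ^ q ≤ 2 ^ p → LogBound a b k m p q
  cellCheck-sound k m p q e₀ e₁ s₀ s₁ ok log₀ log₁ =
    cell-bound E Q a b k m p q s₀ s₁ e₀ e₁ (<ᵇ⇒< _ _ (proj₁ c₁)) log₀ log₁
      (≤ᵇ⇒≤ _ _ (proj₁ c₂)) (≤ᵇ⇒≤ _ _ (proj₁ c₃)) (≤ᵇ⇒≤ _ _ (proj₂ c₃))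
    where
    c₁ = ∧⁻ {e₀ <ᵇ e₁} ok
    c₂ = ∧⁻ {(a * Q + b * s₀) * (E + e₀) ≤ᵇ 6 * E * Q * b} (proj₂ c₁)
    c₃ = ∧⁻ {(a * Q + b * s₁) * (E + e₁) ≤ᵇ 6 * E * Q * b} (proj₂ c₂)

  check-sound : ∀ x y ys → T (check x (y ∷ ys)) → ∀ k m p q →
    proj₁ x * 2 ^ k ≤ 3 * E * m → 3 * E * m ≤ last y ys * 2 ^ k → m ^ q ≤ 2 ^ p → LogBound a b k m p q
  check-sound x y ys ok k m p q left right mp with 3 * E * m ≤? proj₁ y * 2 ^ k
  ... | yes below = cellCheck-sound k m p q (proj₁ x) (proj₁ y) (exponent x) (exponent y) (proj₁ c′)
                      (head-sound x (y ∷ ys) ok) (head-sound y ys (proj₂ c′)) left below mp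
    where
    c′ = ∧⁻ {cellCheck (proj₁ x) (proj₁ y) (exponent x) (exponent y)} (proj₂ (∧⁻ {logCheck x} ok))
  ... | no above with ys
  ...   | []     = ⊥-elim (above right)
  ...   | z ∷ zs = check-sound y z zs (proj₂ (∧⁻ {cellCheck (proj₁ x) (proj₁ y) (exponent x) (exponent y)} (proj₂ (∧⁻ {logCheck x} ok)))) k m p q (≰⇒≥ above) right mp

-- The range 1 / 4 ≤ z ≤ 3 / 4 exceeds the limiting interval from 1 / 3 to 2 / 3, because for small
-- groups t k deviates noticeably from its asymptotic value. In units of 1 / 1200 the minimum is
-- attained near 594; around it the breakpoints are dense, as only little room remains between
-- 1.39995 and 1.39998....
log-bound : ∀ k m p q → 2 ^ k ≤ 4 * m → 4 * m ≤ 3 * 2 ^ k → m ^ q ≤ 2 ^ p → LogBound 139995 100000 k m p q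
log-bound k m p q left right = check-sound (300 , 200 , 1) (388 , 162 , 891) breakpoints tt k m p q
  (subst (300 * 2 ^ k ≤_) (sym (*-assoc 300 4 m)) (*-monoʳ-≤ 300 left))
  (subst₂ _≤_ (sym (*-assoc 300 4 m)) (sym (*-assoc 300 3 (2 ^ k))) (*-monoʳ-≤ 300 right))
  where
  -- A breakpoint e stands for z = e / 1200, and Q = 1000 * 100 expresses the logarithms with five
  -- decimals.
  open Chain 400 139995 100000 1000 1000 100
  -- Each breakpoint lies as far from the preceding one as cellCheck permits.
  breakpoints : List Breakpoint
  breakpoints = (463 , 137 , 396) ∷ (516 , 121 , 760) ∷ (549 , 112 , 816) ∷ (569 , 107 , 654) ∷ (581 , 104 , 643) ∷ (588 , 102 , 915) ∷ (593 , 101 , 694) ∷ (598 , 100 , 482) ∷ (605 , 98 , 803) ∷ (616 , 96 , 204) ∷ (636 , 91 , 594) ∷ (676 , 82 , 794) ∷ (761 , 65 , 707) ∷ (900 , 41 , 504) ∷ []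

-- The numbers t k

-- A form of t k without signed powers and division.
jacobsthal : ℕ → ℕ
jacobsthal zero    = 1
jacobsthal (suc k) = 2 ^ suc k ∸ jacobsthal k

2^-suc : ∀ k → 2 ^ suc k ≡ 2 ^ k + 2 ^ k
2^-suc k = cong (2 ^ k +_) (+-identityʳ (2 ^ k))

-- The error 3 `jacobsthal` k - 2^(k + 1) only changes its sign from k to k + 1. The three
-- statements depend on each other: the bounds show that the subtraction in the definition is not
-- truncated, and this gives the sum that the next bounds use.
jacobsthal-bounds : ∀ k → 3 * jacobsthal k ≤ suc (2 ^ suc k) × 2 ^ suc k ≤ suc (3 * jacobsthal k)
jacobsthal-≤ : ∀ k → jacobsthal k ≤ 2 ^ suc k
jacobsthal-sum : ∀ k → jacobsthal k + jacobsthal (suc k) ≡ 2 ^ suc k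

jacobsthal-sum k = m+[n∸m]≡n (jacobsthal-≤ k)

jacobsthal-≤ k = *-cancelˡ-≤ 3 (≤-trans (proj₁ (jacobsthal-bounds k)) (begin
  1 + 2 ^ suc k ≤⟨ +-monoˡ-≤ (2 ^ suc k) (m^n>0 2 (suc k)) ⟩
  2 ^ suc k + 2 ^ suc k ≤⟨ +-monoʳ-≤ (2 ^ suc k) (m≤m+n _ _) ⟩
  3 * 2 ^ suc k ∎))
  where open ≤-Reasoning

jacobsthal-bounds zero    = ≤-refl , s≤s (s≤s z≤n)
jacobsthal-bounds (suc k) =
    +-cancelˡ-≤ (3 * j) _ _ (begin
      3 * j + 3 * j′ ≡⟨ sum3 ⟩
      3 * x ≡⟨ lem x ⟩
      x + 2 * x ≤⟨ +-monoˡ-≤ (2 * x) (proj₂ ih) ⟩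
      suc (3 * j) + 2 * x ≡⟨ +-suc (3 * j) (2 * x) ⟨
      3 * j + suc (2 * x) ∎)
  , +-cancelˡ-≤ (3 * j) _ _ (begin
      3 * j + 2 * x ≤⟨ +-monoˡ-≤ (2 * x) (proj₁ ih) ⟩
      suc x + 2 * x ≡⟨ cong suc (lem x) ⟨
      suc (3 * x) ≡⟨ cong suc sum3 ⟨
      suc (3 * j + 3 * j′) ≡⟨ +-suc (3 * j) (3 * j′) ⟨
      3 * j + suc (3 * j′) ∎)
  where
  open ≤-Reasoning
  j  = jacobsthal k
  j′ = jacobsthal (suc k)
  x  = 2 ^ suc k
  ih = jacobsthal-bounds k
  lem : ∀ x → 3 * x ≡ x + 2 * x
  lem = solve-∀
  sum3 : 3 * j + 3 * j′ ≡ 3 * x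
  sum3 = trans (sym (*-distribˡ-+ 3 j j′)) (cong (3 *_) (jacobsthal-sum k))

jacobsthal-closed : ∀ k → ℤ.+ (2 ^ suc k) ℤ.+ -1ℤ ℤ.^ k ≡ ℤ.+ (jacobsthal k * 3)
jacobsthal-closed zero    = refl
jacobsthal-closed (suc k) = begin
  ℤ.+ (2 ^ suc (suc k)) ℤ.+ -1ℤ ℤ.* y ≡⟨ cong (λ z → ℤ.+ z ℤ.+ -1ℤ ℤ.* y) (2^-suc (suc k)) ⟩
  (ℤ.+ x ℤ.+ ℤ.+ x) ℤ.+ -1ℤ ℤ.* y ≡⟨ lem (ℤ.+ x) y ⟩
  (ℤ.+ 3) ℤ.* ℤ.+ x ℤ.- (ℤ.+ x ℤ.+ y) ≡⟨ cong₂ ℤ._-_ (trans (sym (ℤ.pos-* 3 x)) (cong ℤ.+_ 3x)) (jacobsthal-closed k) ⟩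
  ℤ.+ (j * 3 + j′ * 3) ℤ.- ℤ.+ (j * 3) ≡⟨ cong (ℤ._- ℤ.+ (j * 3)) (ℤ.pos-+ (j * 3) (j′ * 3)) ⟩
  (ℤ.+ (j * 3) ℤ.+ ℤ.+ (j′ * 3)) ℤ.- ℤ.+ (j * 3) ≡⟨ lem′ (ℤ.+ (j * 3)) (ℤ.+ (j′ * 3)) ⟩
  ℤ.+ (j′ * 3) ∎
  where
  open ≡-Reasoning
  j  = jacobsthal k
  j′ = jacobsthal (suc k)
  x  = 2 ^ suc k
  y  = -1ℤ ℤ.^ k
  lem : ∀ x y → (x ℤ.+ x) ℤ.+ -1ℤ ℤ.* y ≡ (ℤ.+ 3) ℤ.* x ℤ.- (x ℤ.+ y)
  lem = ℤ.solve-∀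
  lem′ : ∀ x y → (x ℤ.+ y) ℤ.- x ≡ y
  lem′ = ℤ.solve-∀
  3x : 3 * x ≡ j * 3 + j′ * 3
  3x = trans (*-comm 3 x) (trans (cong (_* 3) (sym (jacobsthal-sum k))) (*-distribʳ-+ 3 j j′))

t≡jacobsthal : ∀ k → t k ≡ jacobsthal k
t≡jacobsthal k = trans (cong (λ z → ℤ.∣ z ℤ./ (ℤ.+ 3) ∣) (jacobsthal-closed k))
  (trans (cong ℤ.∣_∣ (ℤ.div-pos-is-/ℕ (ℤ.+ (jacobsthal k * 3)) 3)) (m*n/n≡m (jacobsthal k) 3))

t-sum : ∀ k → t k + t (suc k) ≡ 2 ^ suc k
t-sum k = trans (cong₂ _+_ (t≡jacobsthal k) (t≡jacobsthal (suc k))) (jacobsthal-sum k)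

3t≤ : ∀ k → 3 * t k ≤ suc (2 ^ suc k)
3t≤ k = subst (λ x → 3 * x ≤ suc (2 ^ suc k)) (sym (t≡jacobsthal k)) (proj₁ (jacobsthal-bounds k))

≤3t : ∀ k → 2 ^ suc k ≤ suc (3 * t k)
≤3t k = subst (λ x → 2 ^ suc k ≤ suc (3 * x)) (sym (t≡jacobsthal k)) (proj₂ (jacobsthal-bounds k))

2≤2^suc : ∀ k → 2 ≤ 2 ^ suc k
2≤2^suc k = *-monoʳ-≤ 2 (m^n>0 2 k)

t≥1 : ∀ k → 1 ≤ t k
t≥1 k with t k | ≤3t k
... | zero  | h with s≤s () ← ≤-trans (2≤2^suc k) h
... | suc _ | _ = s≤s z≤n

t-step≤ : ∀ k → t (suc k) ≤ suc (2 * t k)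
t-step≤ k = +-cancelˡ-≤ (t k) _ _ (≤-trans (≤-reflexive (t-sum k)) (≤-trans (≤3t k) (≤-reflexive (sym (+-suc (t k) _)))))

2t≤ : ∀ k → 2 * t k ≤ 2 ^ suc k
2t≤ k = *-cancelˡ-≤ 3 (begin
  3 * (2 * t k) ≡⟨ lem (t k) ⟩
  2 * (3 * t k) ≤⟨ *-monoʳ-≤ 2 (3t≤ k) ⟩
  2 * suc P ≡⟨ lem′ P ⟩
  2 * P + 2 ≤⟨ +-monoʳ-≤ (2 * P) (2≤2^suc k) ⟩
  2 * P + P ≡⟨ lem″ P ⟩
  3 * P ∎)
  where
  open ≤-Reasoning
  P = 2 ^ suc k
  lem : ∀ x → 3 * (2 * x) ≡ 2 * (3 * x)
  lem = solve-∀
  lem′ : ∀ x → 2 * suc x ≡ 2 * x + 2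
  lem′ = solve-∀
  lem″ : ∀ x → 2 * x + x ≡ 3 * x
  lem″ = solve-∀

t-mono : ∀ k → t k ≤ t (suc k)
t-mono k = +-cancelˡ-≤ (t k) _ _ (begin
  t k + t k ≡⟨ cong (t k +_) (+-identityʳ (t k)) ⟨
  2 * t k ≤⟨ 2t≤ k ⟩
  2 ^ suc k ≡⟨ t-sum k ⟨
  t k + t (suc k) ∎)
  where open ≤-Reasoning

-- The number of comparisons spent on the insertions

-- The elements of the groups up to K, those of group j being charged j each.
fullCost : ℕ → ℕ
fullCost zero    = 0
fullCost (suc K) = fullCost K + suc K * (t (suc K) ∸ t K)

module Budget (D : ℕ) where

  open import Data.Nat.DivMod using (_/_; _%_; m/n*n≤m; m≡m%n+[m/n]*n; m%n≤n)

  -- With k = K + 1 and u = t K + suc r this is D 2^k / (t K + u), rounded down. The denominator is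
  -- the largest number of gaps that occurs in the group, so the saving is underestimated for the
  -- other elements.
  γ : ℕ → ℕ → ℕ
  γ K r = D * 2 ^ suc K / suc (2 * t K + r)

  δ : ℕ → ℕ
  δ K = suc (D * (4 * K) / suc (2 * t K))

  -- D times the average cost charged for each of the first suc r elements of
  -- group suc K: γ reflects the short branches of the search trees, δ the
  -- imbalance of these trees.
  η : ℕ → ℕ → ℕ
  η K r = (D * (2 + K) ∸ γ K r) + δ K

  budget : ℕ → ℕ → ℕ
  budget K r = D * fullCost K + suc r * η K r

  γ-upper : ∀ K r → suc (2 * t K + r) * γ K r ≤ D * 2 ^ suc K
  γ-upper K r = ≤-trans (≤-reflexive (*-comm (suc (2 * t K + r)) (γ K r))) (m/n*n≤m (D * 2 ^ suc K) (suc (2 * t K + r)))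

  δ-lower : ∀ K → D * (4 * K) ≤ suc (2 * t K) * δ K
  δ-lower K = begin
    D * (4 * K) ≡⟨ m≡m%n+[m/n]*n (D * (4 * K)) M ⟩
    D * (4 * K) % M + D * (4 * K) / M * M ≤⟨ +-monoˡ-≤ _ (m%n≤n (D * (4 * K)) M) ⟩
    M + D * (4 * K) / M * M ≡⟨ *-comm (δ K) M ⟩
    M * δ K ∎
    where
    open ≤-Reasoning
    M = suc (2 * t K)

  γ≤ : ∀ K r → γ K r ≤ D * (2 + K)
  γ≤ K r = *-cancelˡ-≤ (suc (2 * t K + r)) (begin
    suc (2 * t K + r) * γ K r ≤⟨ γ-upper K r ⟩
    D * 2 ^ suc K ≤⟨ *-monoʳ-≤ D (≤3t K) ⟩
    D * suc (3 * t K) ≤⟨ *-monoʳ-≤ D (m≤m+n (suc (3 * t K)) (suc (t K))) ⟩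
    D * (suc (3 * t K) + suc (t K)) ≡⟨ lem D (t K) ⟩
    suc (2 * t K) * (D * 2) ≤⟨ *-mono-≤ (m≤m+n (suc (2 * t K)) r) (*-monoʳ-≤ D (m≤m+n 2 K)) ⟩
    suc (2 * t K + r) * (D * (2 + K)) ∎)
    where
    open ≤-Reasoning
    lem : ∀ D x → D * (suc (3 * x) + suc x) ≡ suc (2 * x) * (D * 2)
    lem = solve-∀

  -- Summation by parts turns the cost into K t K minus the sum of all t j with j < K. By `t-step≤`
  -- each increment of t is at most t j + 1, so that this sum is at least t K - (K + 1).
  fullCost-bound : ∀ K → fullCost K + t K ≤ K * t K + suc K
  fullCost-bound zero    = ≤-refl
  fullCost-bound (suc K) = +-cancelʳ-≤ (x + suc K * x) _ _ (begin
    (fullCost K + suc K * (y ∸ x) + y) + (x + suc K * x) ≡⟨ l₁ (fullCost K) (suc K) (y ∸ x) y x ⟩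
    (fullCost K + x) + suc K * (y ∸ x + x) + y ≡⟨ cong (λ z → (fullCost K + x) + suc K * z + y) (m∸n+n≡m (t-mono K)) ⟩
    (fullCost K + x) + suc K * y + y ≤⟨ +-mono-≤ (+-monoˡ-≤ (suc K * y) (fullCost-bound K)) (t-step≤ K) ⟩
    (K * x + suc K) + suc K * y + suc (2 * x) ≡⟨ l₂ K x y ⟩
    (suc K * y + suc (suc K)) + (x + suc K * x) ∎)
    where
    open ≤-Reasoning
    x = t K
    y = t (suc K)
    l₁ : ∀ F k z y x → (F + k * z + y) + (x + k * x) ≡ (F + x) + k * (z + x) + y
    l₁ = solve-∀
    l₂ : ∀ K x y → (K * x + suc K) + suc K * y + suc (2 * x) ≡ (suc K * y + suc (suc K)) + (x + suc K * x)
    l₂ = solve-∀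

  module _ (K r : ℕ) (r≤ : r ≤ 2 * t K) where
    private
      P = 2 ^ suc K
      N = suc (2 * t K + r)
      u = t K + suc r
      x = D * (2 + K) ∸ γ K r
      F = fullCost K

    -- Because of 2 u = N + suc r, the saving 2 P u / N is P plus suc r times P / N. The second part
    -- is the saving `γ` in the last group. The first comes from the full groups: they cost about (K
    -- - 1) t K, which is 3 t K less than a charge of K + 2 each, and P ≤ 3 t K + 1.
    budget-bound′ : N * budget K r + 2 * D * P * u ≤ N * (D * ((2 + K) * u + (5 * K + 2)) + 2 * u)
    budget-bound′ = begin
      N * budget K r + 2 * D * P * u
        ≡⟨ l₁ (t K) r D F x (δ K) P ⟩
      N * (D * F) + suc r * (N * x + D * P) + N * (suc r * δ K) + D * N * P
        ≤⟨ +-mono-≤ (+-mono-≤ (+-monoʳ-≤ (N * (D * F)) (*-monoʳ-≤ (suc r) ineqγ)) (*-monoʳ-≤ N ineqδ)) (*-monoʳ-≤ (D * N) (≤3t K)) ⟩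
      N * (D * F) + suc r * (N * suc (D * (2 + K))) + N * (suc r + D * (4 * K)) + D * N * suc (3 * t K)
        ≡⟨ l₂ (t K) r D F K ⟩
      N * (D * (F + t K) + D * (suc r * (2 + K) + 4 * K + 2 * t K + 1) + 2 * suc r)
        ≤⟨ *-monoʳ-≤ N (+-mono-≤ (+-monoˡ-≤ _ (*-monoʳ-≤ D (fullCost-bound K))) (*-monoʳ-≤ 2 (m≤n+m (suc r) (t K)))) ⟩
      N * (D * (K * t K + suc K) + D * (suc r * (2 + K) + 4 * K + 2 * t K + 1) + 2 * u)
        ≡⟨ l₃ (t K) r D K ⟩
      N * (D * ((2 + K) * u + (5 * K + 2)) + 2 * u) ∎
      where
      open ≤-Reasoning
      ineqγ : N * x + D * P ≤ N * suc (D * (2 + K))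
      ineqγ = begin
        N * x + D * P ≡⟨ cong (N * x +_) (m≡m%n+[m/n]*n (D * P) N) ⟩
        N * x + (D * P % N + γ K r * N) ≤⟨ +-monoʳ-≤ (N * x) (+-monoˡ-≤ _ (m%n≤n (D * P) N)) ⟩
        N * x + (N + γ K r * N) ≡⟨ l N x (γ K r) ⟩
        N * suc (x + γ K r) ≡⟨ cong (λ z → N * suc z) (m∸n+n≡m (γ≤ K r)) ⟩
        N * suc (D * (2 + K)) ∎
        where
        l : ∀ N x g → N * x + (N + g * N) ≡ N * suc (x + g)
        l = solve-∀
      ineqδ : suc r * δ K ≤ suc r + D * (4 * K)
      ineqδ = begin
        suc r * suc (D * (4 * K) / M) ≡⟨ *-suc (suc r) (D * (4 * K) / M) ⟩
        suc r + suc r * (D * (4 * K) / M) ≤⟨ +-monoʳ-≤ (suc r) (*-monoˡ-≤ (D * (4 * K) / M) (s≤s r≤)) ⟩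
        suc r + M * (D * (4 * K) / M) ≡⟨ cong (suc r +_) (*-comm M _) ⟩
        suc r + D * (4 * K) / M * M ≤⟨ +-monoʳ-≤ (suc r) (m/n*n≤m (D * (4 * K)) M) ⟩
        suc r + D * (4 * K) ∎
        where M = suc (2 * t K)
      l₁ : ∀ t r D F x d P → suc (2 * t + r) * (D * F + suc r * (x + d)) + 2 * D * P * (t + suc r)
           ≡ suc (2 * t + r) * (D * F) + suc r * (suc (2 * t + r) * x + D * P) + suc (2 * t + r) * (suc r * d) + D * suc (2 * t + r) * P
      l₁ = solve-∀
      l₂ : ∀ t r D F K → suc (2 * t + r) * (D * F) + suc r * (suc (2 * t + r) * suc (D * (2 + K))) + suc (2 * t + r) * (suc r + D * (4 * K)) + D * suc (2 * t + r) * suc (3 * t)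
           ≡ suc (2 * t + r) * (D * (F + t) + D * (suc r * (2 + K) + 4 * K + 2 * t + 1) + 2 * suc r)
      l₂ = solve-∀
      l₃ : ∀ t r D K → suc (2 * t + r) * (D * (K * t + suc K) + D * (suc r * (2 + K) + 4 * K + 2 * t + 1) + 2 * (t + suc r))
           ≡ suc (2 * t + r) * (D * ((2 + K) * (t + suc r) + (5 * K + 2)) + 2 * (t + suc r))
      l₃ = solve-∀

    -- The recurrence is to involve only m = ⌊n / 2⌋. Replacing 3 N by P + 3 m in the saving, where
    -- both are close to P + 3 u, costs at most one comparison in total, by `shift`.
    budget-bound : ∀ m → m ≤ u → u ≤ suc m →
      (P + 3 * m) * budget K r + 6 * D * P * m ≤ (P + 3 * m) * (D * ((2 + K) * m + (6 * K + 5)) + 2 * suc m)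
    budget-bound m m≤u u≤1+m = *-cancelˡ-≤ N (begin
      N * (Y * h + 6 * D * P * m)
        ≡⟨ l₁ N Y h D P m ⟩
      Y * (N * h) + D * (6 * P * m * N)
        ≤⟨ +-monoʳ-≤ (Y * (N * h)) (*-monoʳ-≤ D shift) ⟩
      Y * (N * h) + D * (2 * P * u * Y + N * Y)
        ≡⟨ l₂ N Y h D P u ⟩
      Y * (N * h + 2 * D * P * u) + D * (N * Y)
        ≤⟨ +-monoˡ-≤ (D * (N * Y)) (*-monoʳ-≤ Y (≤-trans budget-bound′ (*-monoʳ-≤ N (+-mono-≤ (*-monoʳ-≤ D (+-monoˡ-≤ (5 * K + 2) (*-monoʳ-≤ (2 + K) u≤1+m))) (*-monoʳ-≤ 2 u≤1+m))))) ⟩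
      Y * (N * (D * ((2 + K) * suc m + (5 * K + 2)) + 2 * suc m)) + D * (N * Y)
        ≡⟨ l₃ N Y D K m ⟩
      N * (Y * (D * ((2 + K) * m + (6 * K + 5)) + 2 * suc m)) ∎)
      where
      open ≤-Reasoning
      Y = P + 3 * m
      h = budget K r
      shift : 6 * P * m * N ≤ 2 * P * u * Y + N * Y
      shift = begin
        6 * P * m * N ≡⟨ m₁ P m (t K) r ⟩
        2 * P * m * (3 * t K) + 6 * P * m * u ≤⟨ +-monoˡ-≤ _ (*-monoʳ-≤ (2 * P * m) (3t≤ K)) ⟩
        2 * P * m * suc P + 6 * P * m * u ≡⟨ m₂ P m u ⟩
        2 * P * m * P + P * m + m * P + 6 * P * m * u ≤⟨ +-monoˡ-≤ (6 * P * m * u) (+-mono-≤ (+-mono-≤ (*-monoˡ-≤ P (*-monoʳ-≤ (2 * P) m≤u)) (*-monoʳ-≤ P m≤N)) (*-monoʳ-≤ m P≤3N)) ⟩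
        2 * P * u * P + P * N + m * (3 * N) + 6 * P * m * u ≡⟨ m₃ P m u N ⟩
        2 * P * u * Y + N * Y ∎
        where
        m≤N : m ≤ N
        m≤N = ≤-trans m≤u (≤-trans (m≤n+m u (t K)) (≤-reflexive (m₄ (t K) r)))
          where
          m₄ : ∀ t r → t + (t + suc r) ≡ suc (2 * t + r)
          m₄ = solve-∀
        P≤3N : P ≤ 3 * N
        P≤3N = ≤-trans (≤3t K) (≤-trans (m≤m+n (suc (3 * t K)) (2 + 3 * t K + 3 * r)) (≤-reflexive (m₅ (t K) r)))
          where
          m₅ : ∀ t r → suc (3 * t) + (2 + 3 * t + 3 * r) ≡ 3 * suc (2 * t + r)
          m₅ = solve-∀
        m₁ : ∀ P m t r → 6 * P * m * suc (2 * t + r) ≡ 2 * P * m * (3 * t) + 6 * P * m * (t + suc r)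
        m₁ = solve-∀
        m₂ : ∀ P m u → 2 * P * m * suc P + 6 * P * m * u ≡ 2 * P * m * P + P * m + m * P + 6 * P * m * u
        m₂ = solve-∀
        m₃ : ∀ P m u N → 2 * P * u * P + P * N + m * (3 * N) + 6 * P * m * u ≡ 2 * P * u * (P + 3 * m) + N * (P + 3 * m)
        m₃ = solve-∀
      l₁ : ∀ N Y h D P m → N * (Y * h + 6 * D * P * m) ≡ Y * (N * h) + D * (6 * P * m * N)
      l₁ = solve-∀
      l₂ : ∀ N Y h D P u → Y * (N * h) + D * (2 * P * u * Y + N * Y) ≡ Y * (N * h + 2 * D * P * u) + D * (N * Y)
      l₂ = solve-∀
      l₃ : ∀ N Y D K m → Y * (N * (D * ((2 + K) * suc m + (5 * K + 2)) + 2 * suc m)) + D * (N * Y) ≡ N * (Y * (D * ((2 + K) * m + (6 * K + 5)) + 2 * suc m))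
      l₃ = solve-∀

-- Absorption of errors and solution of the recurrence

n≤2^n : ∀ n → n ≤ 2 ^ n
n≤2^n zero    = z≤n
n≤2^n (suc n) = begin
  1 + n ≤⟨ +-mono-≤ (m^n>0 2 n) (n≤2^n n) ⟩
  2 ^ n + 2 ^ n ≡⟨ 2^-suc n ⟨
  2 ^ suc n ∎
  where open ≤-Reasoning

-- Beyond l every further step adds A to the left-hand side, while the right-hand side grows by
-- doubling. This hides errors linear in K behind a small multiple of the group size, at the price
-- of a constant.
linear≤exponential : ∀ A B l K → A ≤ B * 2 ^ l → K * A ≤ B * 2 ^ K + l * A
linear≤exponential A B l K A≤B with K ≤? l
... | yes K≤l = ≤-trans (*-monoˡ-≤ A K≤l) (m≤n+m (l * A) (B * 2 ^ K))
... | no  K≰l = begin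
  K * A ≡⟨ cong (_* A) (m∸n+n≡m (≰⇒≥ K≰l)) ⟨
  (j + l) * A ≡⟨ *-distribʳ-+ A j l ⟩
  j * A + l * A ≤⟨ +-monoˡ-≤ (l * A) (*-mono-≤ (n≤2^n j) A≤B) ⟩
  2 ^ j * (B * 2 ^ l) + l * A ≡⟨ cong (_+ l * A) (lem (2 ^ j) B (2 ^ l)) ⟩
  B * (2 ^ j * 2 ^ l) + l * A ≡⟨ cong (λ x → B * x + l * A) (^-distribˡ-+-* 2 j l) ⟨
  B * 2 ^ (j + l) + l * A ≡⟨ cong (λ x → B * 2 ^ x + l * A) (m∸n+n≡m (≰⇒≥ K≰l)) ⟩
  B * 2 ^ K + l * A ∎
  where
  open ≤-Reasoning
  j = K ∸ l
  lem : ∀ x y z → x * (y * z) ≡ y * (x * z)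
  lem = solve-∀

module _ (D a b K r m p q : ℕ) (r≤ : r ≤ 2 * t K) where

  open Budget D

  private
    P = 2 ^ suc K
    u = t K + suc r

  -- Multiplies the logarithmic estimate by 10 m, which eliminates the fraction in budget-bound.
  combine : 10 * b ≡ D → m ≤ u → u ≤ suc m → LogBound a b (suc K) m p q →
            q * budget K r + q * (10 * a * m) ≤ q * (D * m + (D * (6 * K + 5) + 2 * suc m)) + D * m * p
  combine refl m≤u u≤1+m log = +-cancelʳ-≤ (q * (D * suc K * m)) _ _ (*-cancelˡ-≤ Y {{nz}} (+-cancelʳ-≤ (q * (6 * D * P * m)) _ _ (begin
    Y * (q * h + q * (10 * a * m) + q * (D * suc K * m)) + q * (6 * D * P * m)
      ≡⟨ l₁ Y q h a m b K P ⟩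
    q * (Y * h + 6 * D * P * m) + 10 * m * (q * (b * suc K + a) * Y)
      ≤⟨ +-mono-≤ (*-monoʳ-≤ q (budget-bound K r r≤ m m≤u u≤1+m)) (*-monoʳ-≤ (10 * m) log) ⟩
    q * (Y * (D * ((2 + K) * m + (6 * K + 5)) + 2 * suc m)) + 10 * m * (b * (p * Y + 6 * P * q))
      ≡⟨ l₂ Y q m b K P p ⟩
    Y * (q * (D * m + (D * (6 * K + 5) + 2 * suc m)) + D * m * p + q * (D * suc K * m)) + q * (6 * D * P * m) ∎)))
    where
    open ≤-Reasoning
    Y = P + 3 * m
    h = budget K r
    nz : NonZero Y
    nz = >-nonZero (≤-trans (m^n>0 2 (suc K)) (m≤m+n P (3 * m)))
    l₁ : ∀ Y q h a m b K P → Y * (q * h + q * (10 * a * m) + q * (10 * b * suc K * m)) + q * (6 * (10 * b) * P * m)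
         ≡ q * (Y * h + 6 * (10 * b) * P * m) + 10 * m * (q * (b * suc K + a) * Y)
    l₁ = solve-∀
    l₂ : ∀ Y q m b K P p → q * (Y * (10 * b * ((2 + K) * m + (6 * K + 5)) + 2 * suc m)) + 10 * m * (b * (p * Y + 6 * P * q))
         ≡ Y * (q * (10 * b * m + (10 * b * (6 * K + 5) + 2 * suc m)) + 10 * b * m * p + q * (10 * b * suc K * m)) + q * (6 * (10 * b) * P * m)
    l₂ = solve-∀

-- The coefficient to be proved is c / D, and a / b = (c + 50) / D is the slightly larger one in the
-- estimate of the logarithm. The surplus of 50 m pays for the errors that `linear` bounds and for
-- rounding. The constants are variables, so that the ring identities remain symbolic.
module Estimate (D a b c C : ℕ) (10b : 10 * b ≡ D) (10a : 10 * a ≡ c + 50)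
  (linear : ∀ K → K * (6 * D) + (5 * D + 2) ≤ 16 * 2 ^ suc K + C)
  (log : ∀ k m p q → 2 ^ k ≤ 4 * m → 4 * m ≤ 3 * 2 ^ k → m ^ q ≤ 2 ^ p → LogBound a b k m p q) where

 open Budget D public

 module _ (K r m p q : ℕ) (1≤K : 1 ≤ K) (r<t : t K + suc r ≤ t (suc K))
         (m≤u : m ≤ t K + suc r) (u≤1+m : t K + suc r ≤ suc m) (mp : m ^ q ≤ 2 ^ p) where
  private
    P = 2 ^ suc K
    tK≤m : t K ≤ m
    tK≤m = s≤s⁻¹ (≤-trans (≤-trans (s≤s (m≤m+n (t K) r)) (≤-reflexive (sym (+-suc (t K) r)))) u≤1+m)

    r≤ : r ≤ 2 * t K
    r≤ = s≤s⁻¹ (≤-trans (m≤n+m (suc r) (t K)) (≤-trans r<t (t-step≤ K)))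

    lower : P ≤ 4 * m
    lower = begin
      P ≤⟨ ≤3t K ⟩
      1 + 3 * t K ≤⟨ +-monoˡ-≤ (3 * t K) (t≥1 K) ⟩
      t K + 3 * t K ≤⟨ *-monoʳ-≤ 4 tK≤m ⟩
      4 * m ∎
      where open ≤-Reasoning

    upper : 4 * m ≤ 3 * P
    upper = *-cancelˡ-≤ 3 (+-cancelʳ-≤ (4 * (3 * t K) + 4) _ _ (begin
      3 * (4 * m) + (4 * (3 * t K) + 4) ≤⟨ +-monoˡ-≤ _ (*-monoʳ-≤ 3 (*-monoʳ-≤ 4 (≤-trans m≤u r<t))) ⟩
      3 * (4 * t (suc K)) + (4 * (3 * t K) + 4) ≡⟨ l₁ (t (suc K)) (t K) ⟩
      12 * (t K + t (suc K)) + 4 ≡⟨ cong (λ x → 12 * x + 4) (t-sum K) ⟩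
      -- This step uses `1≤K`: 4 = 2^2 ≤ P.
      12 * P + 4 ≤⟨ +-monoʳ-≤ (12 * P) (^-monoʳ-≤ 2 (s≤s 1≤K)) ⟩
      12 * P + P ≡⟨ l₂ P ⟩
      3 * (3 * P) + 4 * P ≤⟨ +-monoʳ-≤ _ (*-monoʳ-≤ 4 (≤3t K)) ⟩
      3 * (3 * P) + 4 * suc (3 * t K) ≡⟨ l₃ P (t K) ⟩
      3 * (3 * P) + (4 * (3 * t K) + 4) ∎))
      where
      open ≤-Reasoning
      l₁ : ∀ x y → 3 * (4 * x) + (4 * (3 * y) + 4) ≡ 12 * (y + x) + 4
      l₁ = solve-∀
      l₂ : ∀ P → 12 * P + P ≡ 3 * (3 * P) + 4 * P
      l₂ = solve-∀
      l₃ : ∀ P y → 3 * (3 * P) + 4 * suc (3 * y) ≡ 3 * (3 * P) + (4 * (3 * y) + 4)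
      l₃ = solve-∀

    -- The surplus 50 is 48 + 2: the term 16 P is at most 48 m + 16, and rounding `γ` and `δ` costs
    -- about 2 per element.
    rounding : D * (6 * K + 5) + 2 * suc m ≤ 50 * m + (16 + C)
    rounding = begin
      D * (6 * K + 5) + 2 * suc m ≡⟨ l₁ D K m ⟩
      (K * (6 * D) + (5 * D + 2)) + 2 * m ≤⟨ +-monoˡ-≤ (2 * m) (linear K) ⟩
      16 * P + C + 2 * m ≤⟨ +-monoˡ-≤ (2 * m) (+-monoˡ-≤ C (*-monoʳ-≤ 16 (≤-trans (≤3t K) (s≤s (*-monoʳ-≤ 3 tK≤m))))) ⟩
      16 * suc (3 * m) + C + 2 * m ≡⟨ l₂ m C ⟩
      50 * m + (16 + C) ∎
      where
      open ≤-Reasoning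
      l₁ : ∀ D K m → D * (6 * K + 5) + 2 * suc m ≡ (K * (6 * D) + (5 * D + 2)) + 2 * m
      l₁ = solve-∀
      l₂ : ∀ m C → 16 * suc (3 * m) + C + 2 * m ≡ 50 * m + (16 + C)
      l₂ = solve-∀

  budget-estimate : q * budget K r + q * (c * m) ≤ D * m * (p + q) + q * (16 + C)
  budget-estimate = +-cancelʳ-≤ (q * (50 * m)) _ _ (begin
    q * budget K r + q * (c * m) + q * (50 * m) ≡⟨ l₁ q (budget K r) c m ⟩
    q * budget K r + q * ((c + 50) * m) ≡⟨ cong (λ x → q * budget K r + q * (x * m)) 10a ⟨
    q * budget K r + q * (10 * a * m)
      ≤⟨ combine D a b K r m p q r≤ 10b m≤u u≤1+m (log (suc K) m p q lower upper mp) ⟩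
    q * (D * m + (D * (6 * K + 5) + 2 * suc m)) + D * m * p ≤⟨ +-monoˡ-≤ _ (*-monoʳ-≤ q (+-monoʳ-≤ (D * m) rounding)) ⟩
    q * (D * m + (50 * m + (16 + C))) + D * m * p ≡⟨ l₂ D q m p C ⟩
    D * m * (p + q) + q * (16 + C) + q * (50 * m) ∎)
    where
    open ≤-Reasoning
    l₁ : ∀ q h c m → q * h + q * (c * m) + q * (50 * m) ≡ q * h + q * ((c + 50) * m)
    l₁ = solve-∀
    l₂ : ∀ D q m p C → q * (D * m + (50 * m + (16 + C))) + D * m * p ≡ D * m * (p + q) + q * (16 + C) + q * (50 * m)
    l₂ = solve-∀

module Recurrence (D a b c C : ℕ) (10b : 10 * b ≡ D) (10a : 10 * a ≡ c + 50)
  (linear : ∀ K → K * (6 * D) + (5 * D + 2) ≤ 16 * 2 ^ suc K + C)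
  (log : ∀ k m p q → 2 ^ k ≤ 4 * m → 4 * m ≤ 3 * 2 ^ k → m ^ q ≤ 2 ^ p → LogBound a b k m p q) where

  open Estimate D a b c C 10b 10a linear log public

  -- The loss per level of the recursion: 16 + C remains from `budget-estimate`, and c occurs
  -- because n may be 2 m + 1.
  C₁ = 16 + C + c

  -- β ≤ D n log₂ n - c n + C₁ (1 + ⌊log₂ n⌋), where log₂ n ≤ p / q.
  LogarithmicBound : ℕ → ℕ → Set
  LogarithmicBound n β = ∀ p q → n ^ q ≤ 2 ^ p → q * β + q * (c * n) ≤ D * n * p + q * (C₁ * suc ⌊log₂ n ⌋)

  small-bound : ∀ n → n ≤ 1 → LogarithmicBound n 0
  small-bound n n≤1 p q _ = begin
    q * 0 + q * (c * n) ≡⟨ cong (_+ q * (c * n)) (*-zeroʳ q) ⟩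
    q * (c * n) ≤⟨ *-monoʳ-≤ q (*-mono-≤ (m≤n+m c (16 + C)) (≤-trans n≤1 (s≤s z≤n))) ⟩
    q * (C₁ * suc ⌊log₂ n ⌋) ≤⟨ m≤n+m _ (D * n * p) ⟩
    D * n * p + q * (C₁ * suc ⌊log₂ n ⌋) ∎
    where open ≤-Reasoning

  step-bound : ∀ n K r β → 2 ≤ n → 1 ≤ K → t K + suc r ≤ t (suc K) → ⌊ n /2⌋ + (t K + suc r) ≡ n →
               ⌊ n /2⌋ ≤ t K + suc r → t K + suc r ≤ suc ⌊ n /2⌋ →
               LogarithmicBound ⌊ n /2⌋ β → LogarithmicBound n (D * ⌊ n /2⌋ + β + budget K r)
  step-bound n K r β 2≤n 1≤K r<t m+u≡n m≤u u≤1+m ih p q np = begin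
    q * (D * m + β + h) + q * (c * n) ≤⟨ +-monoʳ-≤ _ (*-monoʳ-≤ q (*-monoʳ-≤ c n≤)) ⟩
    q * (D * m + β + h) + q * (c * (m + suc m)) ≡⟨ l₁ q D m β h c ⟩
    q * (D * m) + (q * β + q * (c * m)) + (q * h + q * (c * m)) + q * c
      ≤⟨ +-monoˡ-≤ (q * c) (+-mono-≤ (+-monoʳ-≤ (q * (D * m)) (ih p₁ q mp)) (budget-estimate K r m p₁ q 1≤K r<t m≤u u≤1+m mp)) ⟩
    q * (D * m) + (D * m * p₁ + q * (C₁ * suc ⌊log₂ m ⌋)) + (D * m * (p₁ + q) + q * (16 + C)) + q * c
      ≡⟨ l₂ q D m p₁ C c (suc ⌊log₂ m ⌋) ⟩
    D * (m + m) * (p₁ + q) + q * (C₁ * suc (suc ⌊log₂ m ⌋)) ≡⟨ cong₂ (λ x y → D * (m + m) * x + q * (C₁ * suc y)) (m∸n+n≡m q≤p) levels ⟩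
    D * (m + m) * p + q * (C₁ * suc ⌊log₂ n ⌋) ≤⟨ +-monoˡ-≤ _ (*-monoˡ-≤ p (*-monoʳ-≤ D 2m≤n)) ⟩
    D * n * p + q * (C₁ * suc ⌊log₂ n ⌋) ∎
    where
    open ≤-Reasoning
    m  = ⌊ n /2⌋
    h  = budget K r
    -- log₂ m ≤ log₂ n - 1 ≤ (p - q) / q, with q ≤ p because n ≥ 2.
    p₁ = p ∸ q
    n≤ : n ≤ m + suc m
    n≤ = subst (_≤ m + suc m) m+u≡n (+-monoʳ-≤ m u≤1+m)
    2m≤n : m + m ≤ n
    2m≤n = subst (m + m ≤_) m+u≡n (+-monoʳ-≤ m m≤u)
    q≤p : q ≤ p
    q≤p = 2^-cancel-≤ (≤-trans (^-monoˡ-≤ q 2≤n) np)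
    mp : m ^ q ≤ 2 ^ p₁
    mp = *-cancelʳ-≤ _ _ (2 ^ q) {{m^n≢0 2 q}} (begin
      m ^ q * 2 ^ q ≡⟨ ^-distribʳ-* q m 2 ⟨
      (m * 2) ^ q ≤⟨ ^-monoˡ-≤ q (≤-trans (≤-reflexive (trans (*-comm m 2) (cong (m +_) (+-identityʳ m)))) 2m≤n) ⟩
      n ^ q ≤⟨ np ⟩
      2 ^ p ≡⟨ cong (2 ^_) (m∸n+n≡m q≤p) ⟨
      2 ^ (p₁ + q) ≡⟨ ^-distribˡ-+-* 2 p₁ q ⟩
      2 ^ p₁ * 2 ^ q ∎)
    levels : suc ⌊log₂ m ⌋ ≡ ⌊log₂ n ⌋
    levels = trans (cong suc (⌊log₂⌊n/2⌋⌋≡⌊log₂n⌋∸1 n)) (trans (+-comm 1 _) (m∸n+n≡m (⌊log₂⌋-mono-≤ 2≤n)))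
    l₁ : ∀ q D m β h c → q * (D * m + β + h) + q * (c * (m + suc m)) ≡ q * (D * m) + (q * β + q * (c * m)) + (q * h + q * (c * m)) + q * c
    l₁ = solve-∀
    l₂ : ∀ q D m p C c L → q * (D * m) + (D * m * p + q * ((16 + C + c) * L)) + (D * m * (p + q) + q * (16 + C)) + q * c ≡ D * (m + m) * (p + q) + q * ((16 + C + c) * suc L)
    l₂ = solve-∀

-- Finite sums

∑ : ℕ → (ℕ → ℕ) → ℕ
∑ zero    f = 0
∑ (suc n) f = ∑ n f + f n

∑-cong : ∀ n {f g} → (∀ {i} → i < n → f i ≡ g i) → ∑ n f ≡ ∑ n g
∑-cong zero    eq = refl
∑-cong (suc n) eq = cong₂ _+_ (∑-cong n (λ i<n → eq (m≤n⇒m≤1+n i<n))) (eq ≤-refl)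

∑-mono : ∀ n {f g} → (∀ {i} → i < n → f i ≤ g i) → ∑ n f ≤ ∑ n g
∑-mono zero    le = z≤n
∑-mono (suc n) le = +-mono-≤ (∑-mono n (λ i<n → le (m≤n⇒m≤1+n i<n))) (le ≤-refl)

∑-const : ∀ n c → ∑ n (λ _ → c) ≡ n * c
∑-const zero    c = refl
∑-const (suc n) c = trans (cong (_+ c) (∑-const n c)) (+-comm (n * c) c)

∑-*ˡ : ∀ n c f → ∑ n (λ i → c * f i) ≡ c * ∑ n f
∑-*ˡ zero    c f = sym (*-zeroʳ c)
∑-*ˡ (suc n) c f = trans (cong (_+ c * f n) (∑-*ˡ n c f)) (sym (*-distribˡ-+ c (∑ n f) (f n)))

∑-*ʳ : ∀ n f c → ∑ n (λ i → f i * c) ≡ ∑ n f * c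
∑-*ʳ n f c = trans (∑-cong n (λ {i} _ → *-comm (f i) c)) (trans (∑-*ˡ n c f) (*-comm c (∑ n f)))

∑-+ : ∀ n f g → ∑ n (λ i → f i + g i) ≡ ∑ n f + ∑ n g
∑-+ zero    f g = refl
∑-+ (suc n) f g = trans (cong (_+ (f n + g n)) (∑-+ n f g)) (lem (∑ n f) (∑ n g) (f n) (g n))
  where
  lem : ∀ a b c d → a + b + (c + d) ≡ (a + c) + (b + d)
  lem = solve-∀

∑-split : ∀ m n f → ∑ (m + n) f ≡ ∑ m f + ∑ n (λ i → f (m + i))
∑-split m zero    f = trans (cong (λ x → ∑ x f) (+-identityʳ m)) (sym (+-identityʳ _))
∑-split m (suc n) f = trans (cong (λ x → ∑ x f) (+-suc m n))
  (trans (cong (_+ f (m + n)) (∑-split m n f)) (+-assoc (∑ m f) _ _))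

∑-≤ : ∀ {m n} → m ≤ n → ∀ f → ∑ m f ≤ ∑ n f
∑-≤ {m} {n} m≤n f = ≤-trans (m≤m+n _ _)
  (≤-reflexive (trans (sym (∑-split m (n ∸ m) f)) (cong (λ x → ∑ x f) (m+[n∸m]≡n m≤n))))

-- Summation by parts: a nonincreasing weight is a nonnegative combination of indicators of
-- prefixes, and their coefficients add up to at most w 0, the factor of the error E.
abel : ∀ (f g w : ℕ → ℕ) E n → (∀ {m} → m ≤ n → ∑ m f ≤ ∑ m g + E) → (∀ {i} → i < n → w (suc i) ≤ w i) →
       ∑ n (λ i → f i * w i) ≤ ∑ n (λ i → g i * w i) + E * w 0
abel f g w E n prefix w↓ = +-cancelʳ-≤ (F * w n) _ _ (begin
    ∑ n (λ i → f i * w i) + F * w n ≤⟨ +-monoʳ-≤ (∑ n (λ i → f i * w i)) (*-monoˡ-≤ (w n) (prefix ≤-refl)) ⟩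
    ∑ n (λ i → f i * w i) + (∑ n g + E) * w n ≤⟨ go n prefix w↓ ⟩
    ∑ n (λ i → g i * w i) + E * w 0 + F * w n ∎)
  where
  open ≤-Reasoning
  F = ∑ n f
  -- Strengthened for the induction: the slack of the current prefix, ∑ n g + E - ∑ n f, is carried
  -- along with weight w n.
  go : ∀ n → (∀ {m} → m ≤ n → ∑ m f ≤ ∑ m g + E) → (∀ {i} → i < n → w (suc i) ≤ w i) →
       ∑ n (λ i → f i * w i) + (∑ n g + E) * w n ≤ ∑ n (λ i → g i * w i) + E * w 0 + ∑ n f * w n
  go zero    _      _  = ≤-reflexive (sym (+-identityʳ (E * w 0)))
  go (suc n) prefix w↓ = +-cancelʳ-≤ (h * w n) _ _ (begin
      (X + f n * w n) + (∑ n g + g n + E) * w (suc n) + h * w n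
        ≡⟨ cong (λ x → (X + f n * w n) + x * w (suc n) + h * w n) (sym hyp) ⟩
      (X + f n * w n) + (∑ n f + f n + h) * w (suc n) + h * w n
        ≡⟨ l₁ X (f n) (w n) (∑ n f) h (w (suc n)) ⟩
      (X + f n * w n) + (∑ n f + f n) * w (suc n) + h * w n + h * w (suc n)
        ≤⟨ +-mono-≤ (step) (*-monoʳ-≤ h (w↓ ≤-refl)) ⟩
      Y + g n * w n + E * w 0 + (∑ n f + f n) * w (suc n) + h * w n ∎)
    where
    X = ∑ n (λ i → f i * w i)
    Y = ∑ n (λ i → g i * w i)
    h = (∑ n g + g n + E) ∸ (∑ n f + f n)
    hyp : ∑ n f + f n + h ≡ ∑ n g + g n + E
    hyp = m+[n∸m]≡n (prefix ≤-refl)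
    ih : X + (∑ n g + E) * w n ≤ Y + E * w 0 + ∑ n f * w n
    ih = go n (λ m≤n → prefix (m≤n⇒m≤1+n m≤n)) (λ i<n → w↓ (m≤n⇒m≤1+n i<n))
    step : (X + f n * w n) + (∑ n f + f n) * w (suc n) + h * w n ≤ Y + g n * w n + E * w 0 + (∑ n f + f n) * w (suc n)
    step = +-cancelʳ-≤ (∑ n f * w n) _ _ (begin
      (X + f n * w n) + (∑ n f + f n) * w (suc n) + h * w n + ∑ n f * w n
        ≡⟨ s₁ X (f n) (w n) (∑ n f) (w (suc n)) h ⟩
      X + (∑ n f + f n + h) * w n + (∑ n f + f n) * w (suc n)
        ≡⟨ cong (λ x → X + x * w n + (∑ n f + f n) * w (suc n)) hyp ⟩
      X + (∑ n g + g n + E) * w n + (∑ n f + f n) * w (suc n)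
        ≡⟨ s₂ X (∑ n g) (g n) E (w n) ((∑ n f + f n) * w (suc n)) ⟩
      X + (∑ n g + E) * w n + g n * w n + (∑ n f + f n) * w (suc n)
        ≤⟨ +-monoˡ-≤ _ (+-monoˡ-≤ (g n * w n) ih) ⟩
      Y + E * w 0 + ∑ n f * w n + g n * w n + (∑ n f + f n) * w (suc n)
        ≡⟨ s₃ Y (E * w 0) (∑ n f * w n) (g n * w n) ((∑ n f + f n) * w (suc n)) ⟩
      Y + g n * w n + E * w 0 + (∑ n f + f n) * w (suc n) + ∑ n f * w n ∎)
      where
      s₁ : ∀ X f w F w′ h → (X + f * w) + (F + f) * w′ + h * w + F * w ≡ X + (F + f + h) * w + (F + f) * w′
      s₁ = solve-∀
      s₂ : ∀ X G g E w x → X + (G + g + E) * w + x ≡ X + (G + E) * w + g * w + x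
      s₂ = solve-∀
      s₃ : ∀ Y e f g x → Y + e + f + g + x ≡ Y + g + e + x + f
      s₃ = solve-∀
    l₁ : ∀ X f w F h w′ → (X + f * w) + (F + f + h) * w′ + h * w ≡ (X + f * w) + (F + f) * w′ + h * w + h * w′
    l₁ = solve-∀

-- The depths of the leaves of binary search trees

-- The number of comparisons binaryInsert needs to place an element at
-- position p of a list of length L.
depth : ℕ → ℕ → ℕ → ℕ
depth zero    L       p = 0
depth (suc f) zero    p = 0
depth (suc f) (suc L) p =
  suc (if p ≤ᵇ ⌈ L /2⌉ then depth f ⌈ L /2⌉ p else depth f (L ∸ ⌈ L /2⌉) (p ∸ suc ⌈ L /2⌉))

≤ᵇ-true : ∀ {m n} → m ≤ n → (m ≤ᵇ n) ≡ true
≤ᵇ-true {m} {n} m≤n with m ≤ᵇ n | ≤⇒≤ᵇ m≤n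
... | true | _ = refl

≤ᵇ-false : ∀ {m n} → n < m → (m ≤ᵇ n) ≡ false
≤ᵇ-false {m} {n} n<m with m ≤ᵇ n in eq
... | false = refl
... | true  with () ← <⇒≱ n<m (≤ᵇ⇒≤ m n (subst T (sym eq) _))

L∸⌈L/2⌉ : ∀ L → L ∸ ⌈ L /2⌉ ≡ ⌊ L /2⌋
L∸⌈L/2⌉ L = trans (cong (_∸ ⌈ L /2⌉) (sym (⌊n/2⌋+⌈n/2⌉≡n L))) (m+n∸n≡m ⌊ L /2⌋ ⌈ L /2⌉)

depth-left : ∀ f L {p} → p ≤ ⌈ L /2⌉ → depth (suc f) (suc L) p ≡ suc (depth f ⌈ L /2⌉ p)
depth-left f L p≤ rewrite ≤ᵇ-true p≤ = refl

depth-right : ∀ f L p → depth (suc f) (suc L) (suc ⌈ L /2⌉ + p) ≡ suc (depth f ⌊ L /2⌋ p)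
depth-right f L p rewrite ≤ᵇ-false (s≤s (m≤m+n ⌈ L /2⌉ p)) | m+n∸m≡n ⌈ L /2⌉ p | L∸⌈L/2⌉ L = refl

halves-differ : ∀ L → (⌈ L /2⌉ ≡ ⌊ L /2⌋) ⊎ (⌈ L /2⌉ ≡ suc ⌊ L /2⌋)
halves-differ zero          = inj₁ refl
halves-differ (suc zero)    = inj₂ refl
halves-differ (suc (suc L)) with halves-differ L
... | inj₁ eq = inj₁ (cong suc eq)
... | inj₂ eq = inj₂ (cong suc eq)

leaves : ∀ L → suc ⌈ L /2⌉ + suc ⌊ L /2⌋ ≡ suc (suc L)
leaves L = cong suc (trans (+-suc ⌈ L /2⌉ ⌊ L /2⌋) (cong suc (trans (+-comm ⌈ L /2⌉ ⌊ L /2⌋) (⌊n/2⌋+⌈n/2⌉≡n L))))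

left-≤ : ∀ k L → suc (suc L) ≤ 2 ^ suc k → suc ⌈ L /2⌉ ≤ 2 ^ k
left-≤ k L h = subst (suc ⌈ L /2⌉ ≤_) (sym (n≡⌈n+n/2⌉ (2 ^ k))) (⌈n/2⌉-mono (subst (suc (suc L) ≤_) (2^-suc k) h))

right-≤ : ∀ k L → suc (suc L) ≤ 2 ^ suc k → suc ⌊ L /2⌋ ≤ 2 ^ k
right-≤ k L h = ≤-trans (s≤s (⌊n/2⌋≤⌈n/2⌉ L)) (left-≤ k L h)

right-≥ : ∀ k L → 2 ^ suc k ≤ suc (suc L) → 2 ^ k ≤ suc ⌊ L /2⌋
right-≥ k L h = subst (_≤ suc ⌊ L /2⌋) (sym (n≡⌊n+n/2⌋ (2 ^ k))) (⌊n/2⌋-mono (subst (_≤ suc (suc L)) (2^-suc k) h))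

left-≥ : ∀ k L → 2 ^ suc k ≤ suc (suc L) → 2 ^ k ≤ suc ⌈ L /2⌉
left-≥ k L h = ≤-trans (right-≥ k L h) (s≤s (⌊n/2⌋≤⌈n/2⌉ L))

⌈L/2⌉≤ : ∀ {f L} → suc L ≤ suc f → ⌈ L /2⌉ ≤ f
⌈L/2⌉≤ {f} {L} (s≤s L≤f) = ≤-trans (⌈n/2⌉≤n L) L≤f

⌊L/2⌋≤ : ∀ {f L} → suc L ≤ suc f → ⌊ L /2⌋ ≤ f
⌊L/2⌋≤ {f} {L} L≤f = ≤-trans (⌊n/2⌋≤⌈n/2⌉ L) (⌈L/2⌉≤ L≤f)

data Side (L p : ℕ) : Set where
  onLeft  : p ≤ ⌈ L /2⌉ → Side L p
  onRight : ∀ p′ → p ≡ suc ⌈ L /2⌉ + p′ → Side L p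

side : ∀ L p → Side L p
side L p with p ≤? ⌈ L /2⌉
... | yes p≤ = onLeft p≤
... | no  p≰ = onRight (p ∸ suc ⌈ L /2⌉) (sym (m+[n∸m]≡n (≰⇒> p≰)))

depth-≤ : ∀ f k L p → suc L ≤ 2 ^ k → depth f L p ≤ k
depth-≤ zero    k       L       p h = z≤n
depth-≤ (suc f) k       zero    p h = z≤n
depth-≤ (suc f) zero    (suc L) p (s≤s ())
depth-≤ (suc f) (suc k) (suc L) p h with side L p
... | onLeft p≤       = subst (_≤ suc k) (sym (depth-left f L p≤)) (s≤s (depth-≤ f k _ p (left-≤ k L h)))
... | onRight p′ refl = subst (_≤ suc k) (sym (depth-right f L p′)) (s≤s (depth-≤ f k _ p′ (right-≤ k L h)))

depth-≥ : ∀ f k L p → L ≤ f → 2 ^ k ≤ suc L → k ≤ depth f L p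
depth-≥ f       zero    L       p L≤f h = z≤n
depth-≥ f       (suc k) zero    p L≤f h with s≤s () ← ≤-trans (*-monoʳ-≤ 2 (m^n>0 2 k)) h
depth-≥ (suc f) (suc k) (suc L) p L≤f h with side L p
... | onLeft p≤       = subst (suc k ≤_) (sym (depth-left f L p≤)) (s≤s (depth-≥ f k _ p (⌈L/2⌉≤ L≤f) (left-≥ k L h)))
... | onRight p′ refl = subst (suc k ≤_) (sym (depth-right f L p′)) (s≤s (depth-≥ f k _ p′ (⌊L/2⌋≤ L≤f) (right-≥ k L h)))

∑-left : ∀ f L m → m ≤ suc ⌈ L /2⌉ → ∑ m (depth (suc f) (suc L)) ≡ m + ∑ m (depth f ⌈ L /2⌉)
∑-left f L m m≤ = trans (∑-cong m (λ p<m → depth-left f L (s≤s⁻¹ (≤-trans p<m m≤))))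
  (trans (∑-+ m (λ _ → 1) _) (cong (_+ ∑ m (depth f ⌈ L /2⌉)) (trans (∑-const m 1) (*-identityʳ m))))

∑-right : ∀ f L m → ∑ (suc ⌈ L /2⌉ + m) (depth (suc f) (suc L)) ≡
          (suc ⌈ L /2⌉ + ∑ (suc ⌈ L /2⌉) (depth f ⌈ L /2⌉)) + (m + ∑ m (depth f ⌊ L /2⌋))
∑-right f L m = trans (∑-split (suc ⌈ L /2⌉) m _) (cong₂ _+_ (∑-left f L (suc ⌈ L /2⌉) ≤-refl)
  (trans (∑-cong m (λ {p} _ → depth-right f L p))
         (trans (∑-+ m (λ _ → 1) _) (cong (_+ ∑ m (depth f ⌊ L /2⌋)) (trans (∑-const m 1) (*-identityʳ m))))))

-- There are 2^(k + 1) - (L + 1) leaves of depth k, and all others have depth k + 1. Both bounds on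
-- L admit equality, so that the same k serves for the two subtrees even if only one of them is
-- complete.
∑-depth : ∀ f k L → L ≤ f → 2 ^ k ≤ suc L → suc L ≤ 2 ^ suc k →
          ∑ (suc L) (depth f L) + 2 ^ suc k ≡ suc L * (2 + k)
∑-depth zero    zero    zero          _   _  _  = refl
∑-depth (suc f) zero    zero          _   _  _  = refl
∑-depth (suc zero)    zero (suc zero) L≤f lo hi = refl
∑-depth (suc (suc f)) zero (suc zero) L≤f lo hi = refl
∑-depth f       zero    (suc (suc L)) _   _  (s≤s (s≤s ()))
∑-depth f       (suc k) zero          _   lo _  with s≤s () ← ≤-trans (*-monoʳ-≤ 2 (m^n>0 2 k)) lo
∑-depth (suc f) (suc k) (suc L)       L≤f lo hi = begin
  ∑ (suc (suc L)) (depth (suc f) (suc L)) + 2 ^ suc (suc k) ≡⟨ cong₂ (λ x y → ∑ x (depth (suc f) (suc L)) + y) (sym (leaves L)) (2^-suc (suc k)) ⟩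
  ∑ (a + b) (depth (suc f) (suc L)) + (P + P) ≡⟨ cong (_+ (P + P)) (∑-right f L b) ⟩
  (a + X) + (b + Y) + (P + P) ≡⟨ l a X b Y P ⟩
  (a + b) + (X + P) + (Y + P) ≡⟨ cong₂ (λ x y → (a + b) + x + y)
                                                                       (∑-depth f k ⌈ L /2⌉ (⌈L/2⌉≤ L≤f) (left-≥ k L lo) (left-≤ (suc k) L hi))
                                                                       (∑-depth f k ⌊ L /2⌋ (⌊L/2⌋≤ L≤f) (right-≥ k L lo) (right-≤ (suc k) L hi)) ⟩
  (a + b) + a * (2 + k) + b * (2 + k) ≡⟨ l′ a b k ⟩
  (a + b) * (2 + suc k) ≡⟨ cong (_* (2 + suc k)) (leaves L) ⟩
  suc (suc L) * (2 + suc k) ∎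
  where
  open ≡-Reasoning
  a = suc ⌈ L /2⌉
  b = suc ⌊ L /2⌋
  X = ∑ a (depth f ⌈ L /2⌉)
  Y = ∑ b (depth f ⌊ L /2⌋)
  P = 2 ^ suc k
  l : ∀ a X b Y P → (a + X) + (b + Y) + (P + P) ≡ (a + b) + (X + P) + (Y + P)
  l = solve-∀
  l′ : ∀ a b k → (a + b) + a * (2 + k) + b * (2 + k) ≡ (a + b) * (2 + suc k)
  l′ = solve-∀

module _ (k m a b P X Y : ℕ) where
  private
    target : ℕ → ℕ → Set
    target m X = (a + b) * X + m * (P + P) ≤ m * (a + b) * (3 + k) + (a + b) * (4 * suc k)

  open ≤-Reasoning

  prefix-left-even : a ≡ b → a * X + m * P ≤ m * a * (2 + k) + a * (4 * k) → target m (m + X)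
  prefix-left-even refl ih = begin
    (a + a) * (m + X) + m * (P + P) ≡⟨ l a m X P ⟩
    (a + a) * m + 2 * (a * X + m * P) ≤⟨ +-monoʳ-≤ ((a + b) * m) (*-monoʳ-≤ 2 ih) ⟩
    (a + a) * m + 2 * (m * a * (2 + k) + a * (4 * k)) ≤⟨ m≤m+n _ (8 * a) ⟩
    (a + a) * m + 2 * (m * a * (2 + k) + a * (4 * k)) + 8 * a ≡⟨ l′ a m k ⟩
    m * (a + a) * (3 + k) + (a + a) * (4 * suc k) ∎
    where
    l : ∀ a m X P → (a + a) * (m + X) + m * (P + P) ≡ (a + a) * m + 2 * (a * X + m * P)
    l = solve-∀
    l′ : ∀ a m k → (a + a) * m + 2 * (m * a * (2 + k) + a * (4 * k)) + 8 * a ≡ m * (a + a) * (3 + k) + (a + a) * (4 * suc k)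
    l′ = solve-∀

  -- Here a and b count the leaves of the two subtrees. Doubling the hypothesis gives 2 a = (a + b)
  -- + 1 copies of X; the surplus X is offset by the m k that appears on the right, since every leaf
  -- has depth at least k. The rest fits into the 4 (a + b) by which the error term may grow per
  -- level.
  prefix-left-odd : a ≡ suc b → m ≤ a → m * k ≤ X → suc (4 * k) ≤ 3 * (a + b) →
                    a * X + m * P ≤ m * a * (2 + k) + a * (4 * k) → target m (m + X)
  prefix-left-odd refl m≤a mk≤X k≤ ih = +-cancelʳ-≤ X _ _ (begin
    (a + b) * (m + X) + m * (P + P) + X ≡⟨ l b m X P ⟩
    (a + b) * m + 2 * (a * X + m * P) ≤⟨ +-monoʳ-≤ ((a + b) * m) (*-monoʳ-≤ 2 ih) ⟩
    (a + b) * m + 2 * (m * a * (2 + k) + a * (4 * k)) ≡⟨ l′ b m k ⟩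
    m * (a + b) * (3 + k) + (a + b) * (4 * k) + (m * k + 2 * m + 4 * k) ≤⟨ +-monoʳ-≤ (m * (a + b) * (3 + k) + (a + b) * (4 * k)) (+-monoˡ-≤ (4 * k) (+-mono-≤ mk≤X (*-monoʳ-≤ 2 m≤a))) ⟩
    m * (a + b) * (3 + k) + (a + b) * (4 * k) + (X + 2 * a + 4 * k) ≡⟨ l‴ (m * (a + b) * (3 + k)) (a + b) k X b ⟩
    m * (a + b) * (3 + k) + (a + b) * (4 * k) + (suc (4 * k) + (a + b)) + X ≤⟨ +-monoˡ-≤ X (+-monoʳ-≤ (m * (a + b) * (3 + k) + (a + b) * (4 * k)) (+-monoˡ-≤ (a + b) k≤)) ⟩
    m * (a + b) * (3 + k) + (a + b) * (4 * k) + (3 * (a + b) + (a + b)) + X ≡⟨ l″ (m * (a + b) * (3 + k)) (a + b) k X ⟩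
    m * (a + b) * (3 + k) + (a + b) * (4 * suc k) + X ∎)
    where
    l : ∀ b m X P → (suc b + b) * (m + X) + m * (P + P) + X ≡ (suc b + b) * m + 2 * (suc b * X + m * P)
    l = solve-∀
    l′ : ∀ b m k → (suc b + b) * m + 2 * (m * suc b * (2 + k) + suc b * (4 * k)) ≡ m * (suc b + b) * (3 + k) + (suc b + b) * (4 * k) + (m * k + 2 * m + 4 * k)
    l′ = solve-∀
    l‴ : ∀ x N k X b → x + N * (4 * k) + (X + 2 * suc b + 4 * k) ≡ x + N * (4 * k) + (suc (4 * k) + (suc b + b)) + X
    l‴ = solve-∀
    l″ : ∀ x N k X → x + N * (4 * k) + (3 * N + N) + X ≡ x + N * (4 * suc k) + X
    l″ = solve-∀

  prefix-right-even : a ≡ b → X + P ≡ a * (2 + k) → b * Y + m * P ≤ m * b * (2 + k) + b * (4 * k) →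
                      target (a + m) ((a + X) + (m + Y))
  prefix-right-even refl full ih = begin
    (a + a) * ((a + X) + (m + Y)) + (a + m) * (P + P) ≡⟨ l a m X Y P ⟩
    (a + a) * (a + m) + (a + a) * (X + P) + 2 * (a * Y + m * P) ≤⟨ +-mono-≤ (≤-reflexive (cong (λ x → (a + a) * (a + m) + (a + a) * x) full)) (*-monoʳ-≤ 2 ih) ⟩
    (a + a) * (a + m) + (a + a) * (a * (2 + k)) + 2 * (m * a * (2 + k) + a * (4 * k)) ≤⟨ m≤m+n _ (8 * a) ⟩
    (a + a) * (a + m) + (a + a) * (a * (2 + k)) + 2 * (m * a * (2 + k) + a * (4 * k)) + 8 * a ≡⟨ l′ a m k ⟩
    (a + m) * (a + a) * (3 + k) + (a + a) * (4 * suc k) ∎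
    where
    l : ∀ a m X Y P → (a + a) * ((a + X) + (m + Y)) + (a + m) * (P + P) ≡ (a + a) * (a + m) + (a + a) * (X + P) + 2 * (a * Y + m * P)
    l = solve-∀
    l′ : ∀ a m k → (a + a) * (a + m) + (a + a) * (a * (2 + k)) + 2 * (m * a * (2 + k) + a * (4 * k)) + 8 * a ≡ (a + m) * (a + a) * (3 + k) + (a + a) * (4 * suc k)
    l′ = solve-∀

  -- The left subtree is contained completely and its total `full` is exact. From 2 a = (a + b) + 1
  -- one P is left over, and from 2 b = (a + b) - 1 one Y; both are covered by the allowance for
  -- this level.
  prefix-right-odd : a ≡ suc b → P ≤ a + b → Y ≤ m * suc k → X + P ≡ a * (2 + k) →
                     b * Y + m * P ≤ m * b * (2 + k) + b * (4 * k) → target (a + m) ((a + X) + (m + Y))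
  prefix-right-odd refl P≤ Y≤ full ih = begin
    (a + b) * ((a + X) + (m + Y)) + (a + m) * (P + P)
      ≡⟨ l b m X Y P ⟩
    (a + b) * (a + m) + (a + b) * (X + P) + P + 2 * (b * Y + m * P) + Y
      ≤⟨ +-mono-≤ (+-mono-≤ (+-mono-≤ (≤-reflexive (cong (λ x → (a + b) * (a + m) + (a + b) * x) full)) P≤) (*-monoʳ-≤ 2 ih)) Y≤ ⟩
    (a + b) * (a + m) + (a + b) * (a * (2 + k)) + (a + b) + 2 * (m * b * (2 + k) + b * (4 * k)) + m * suc k
      ≤⟨ m≤m+n _ (m + 4 * k + 3 * (a + b)) ⟩
    (a + b) * (a + m) + (a + b) * (a * (2 + k)) + (a + b) + 2 * (m * b * (2 + k) + b * (4 * k)) + m * suc k + (m + 4 * k + 3 * (a + b))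
      ≡⟨ l′ b m k ⟩
    (a + m) * (a + b) * (3 + k) + (a + b) * (4 * suc k) ∎
    where
    l : ∀ b m X Y P → (suc b + b) * ((suc b + X) + (m + Y)) + (suc b + m) * (P + P) ≡ (suc b + b) * (suc b + m) + (suc b + b) * (X + P) + P + 2 * (b * Y + m * P) + Y
    l = solve-∀
    l′ : ∀ b m k → (suc b + b) * (suc b + m) + (suc b + b) * (suc b * (2 + k)) + (suc b + b) + 2 * (m * b * (2 + k) + b * (4 * k)) + m * suc k + (m + 4 * k + 3 * (suc b + b)) ≡ (suc b + m) * (suc b + b) * (3 + k) + (suc b + b) * (4 * suc k)
    l′ = solve-∀

-- The first m leaves are on average at most as deep as all leaves, up to an
-- error of 4 k / m: the deep leaves are evenly distributed.
prefix-depth : ∀ f k L m → L ≤ f → 2 ^ k ≤ suc L → suc L ≤ 2 ^ suc k → m ≤ suc L →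
               suc L * ∑ m (depth f L) + m * 2 ^ suc k ≤ m * suc L * (2 + k) + suc L * (4 * k)
prefix-depth f       zero    zero          m _   _  _  _  = ≤-trans (+-monoˡ-≤ (m * 2) (*-monoʳ-≤ 1 (∑-mono m (λ {p} _ → depth-≤ f 0 0 p ≤-refl))))
  (≤-reflexive (trans (cong (λ x → 1 * x + m * 2) (trans (∑-const m 0) (*-zeroʳ m))) (l m)))
  where
  l : ∀ m → 1 * 0 + m * 2 ≡ m * 1 * 2 + 1 * 0
  l = solve-∀
prefix-depth f       zero    (suc zero)    m _   _  _  _  = ≤-trans (+-monoˡ-≤ (m * 2) (*-monoʳ-≤ 2 (∑-mono m (λ {p} _ → depth-≤ f 1 1 p ≤-refl))))
  (≤-reflexive (trans (cong (λ x → 2 * x + m * 2) (trans (∑-const m 1) (*-identityʳ m))) (l m)))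
  where
  l : ∀ m → 2 * m + m * 2 ≡ m * 2 * 2 + 2 * 0
  l = solve-∀
prefix-depth f       zero    (suc (suc L)) m _   _  (s≤s (s≤s ())) _
prefix-depth f       (suc k) zero          m _   lo _  _  with s≤s () ← ≤-trans (*-monoʳ-≤ 2 (m^n>0 2 k)) lo
prefix-depth (suc f) (suc k) (suc L)       m L≤f lo hi m≤ =
  subst₂ (λ x y → x * ∑ m (depth (suc f) (suc L)) + m * y ≤ m * x * (3 + k) + x * (4 * suc k)) (leaves L) (sym (2^-suc (suc k)))
    (by-cases (m ≤? a) (halves-differ L))
  where
  a = suc ⌈ L /2⌉
  b = suc ⌊ L /2⌋
  P = 2 ^ suc k
  target = λ m → (a + b) * ∑ m (depth (suc f) (suc L)) + m * (P + P) ≤ m * (a + b) * (3 + k) + (a + b) * (4 * suc k)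
  ihᵃ : ∀ n → n ≤ a → a * ∑ n (depth f ⌈ L /2⌉) + n * P ≤ n * a * (2 + k) + a * (4 * k)
  ihᵃ n n≤ = prefix-depth f k ⌈ L /2⌉ n (⌈L/2⌉≤ L≤f) (left-≥ k L lo) (left-≤ (suc k) L hi) n≤
  ihᵇ : ∀ n → n ≤ b → b * ∑ n (depth f ⌊ L /2⌋) + n * P ≤ n * b * (2 + k) + b * (4 * k)
  ihᵇ n n≤ = prefix-depth f k ⌊ L /2⌋ n (⌊L/2⌋≤ L≤f) (right-≥ k L lo) (right-≤ (suc k) L hi) n≤
  fullᵃ : ∑ a (depth f ⌈ L /2⌉) + P ≡ a * (2 + k)
  fullᵃ = ∑-depth f k ⌈ L /2⌉ (⌈L/2⌉≤ L≤f) (left-≥ k L lo) (left-≤ (suc k) L hi)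
  P≤N : P ≤ a + b
  P≤N = subst (P ≤_) (sym (leaves L)) lo
  4k<3N : suc (4 * k) ≤ 3 * (a + b)
  4k<3N = begin
    1 + 4 * k ≤⟨ +-mono-≤ (m^n>0 2 k) (*-monoʳ-≤ 4 (n≤2^n k)) ⟩
    2 ^ k + 4 * 2 ^ k ≤⟨ m≤m+n _ (2 ^ k) ⟩
    2 ^ k + 4 * 2 ^ k + 2 ^ k ≡⟨ l (2 ^ k) ⟩
    3 * (2 * 2 ^ k) ≤⟨ *-monoʳ-≤ 3 P≤N ⟩
    3 * (a + b) ∎
    where
    open ≤-Reasoning
    l : ∀ x → x + 4 * x + x ≡ 3 * (2 * x)
    l = solve-∀
  by-cases : Dec (m ≤ a) → (⌈ L /2⌉ ≡ ⌊ L /2⌋) ⊎ (⌈ L /2⌉ ≡ suc ⌊ L /2⌋) → target m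
  by-cases (yes m≤a) (inj₁ eq) rewrite ∑-left f L m m≤a = prefix-left-even k m a b P _ 0 (cong suc eq) (ihᵃ m m≤a)
  by-cases (yes m≤a) (inj₂ eq) rewrite ∑-left f L m m≤a = prefix-left-odd k m a b P _ 0 (cong suc eq) m≤a
                    (subst (_≤ ∑ m (depth f ⌈ L /2⌉)) (∑-const m k) (∑-mono m (λ {p} _ → depth-≥ f k ⌈ L /2⌉ p (⌈L/2⌉≤ L≤f) (left-≥ k L lo))))
                    4k<3N (ihᵃ m m≤a)
  by-cases (no m≰a) par = subst target (m+[n∸m]≡n (≰⇒≥ m≰a)) (beyond par)
    where
    n = m ∸ a
    n≤b : n ≤ b
    n≤b = +-cancelˡ-≤ a _ _ (subst₂ _≤_ (sym (m+[n∸m]≡n (≰⇒≥ m≰a))) (sym (leaves L)) m≤)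
    beyond : (⌈ L /2⌉ ≡ ⌊ L /2⌋) ⊎ (⌈ L /2⌉ ≡ suc ⌊ L /2⌋) → target (a + n)
    beyond (inj₁ eq) rewrite ∑-right f L n = prefix-right-even k n a b P _ _ (cong suc eq) fullᵃ (ihᵇ n n≤b)
    beyond (inj₂ eq) rewrite ∑-right f L n = prefix-right-odd k n a b P _ _ (cong suc eq) P≤N
                      (subst (∑ n (depth f ⌊ L /2⌋) ≤_) (∑-const n (suc k)) (∑-mono n (λ {p} _ → depth-≤ f (suc k) ⌊ L /2⌋ p (right-≤ (suc k) L hi))))
                      fullᵃ (ihᵇ n n≤b)

-- Sequences of insertions

-- The position, after an insertion at position p, of the element previously at position x.
bump : ℕ → ℕ → ℕ
bump zero    x       = suc x
bump (suc p) zero    = zero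
bump (suc p) (suc x) = suc (bump p x)

bump-≤ : ∀ {p x} → p ≤ x → bump p x ≡ suc x
bump-≤ z≤n     = refl
bump-≤ (s≤s h) = cong suc (bump-≤ h)

bump-> : ∀ {p x} → x < p → bump p x ≡ x
bump-> {suc p} {zero}  _       = refl
bump-> {suc p} {suc x} (s≤s h) = cong suc (bump-> h)

bump-upper : ∀ p x → bump p x ≤ suc x
bump-upper zero    x       = ≤-refl
bump-upper (suc p) zero    = z≤n
bump-upper (suc p) (suc x) = s≤s (bump-upper p x)

bump-lower : ∀ p x → x ≤ bump p x
bump-lower zero    x       = n≤1+n x
bump-lower (suc p) zero    = z≤n
bump-lower (suc p) (suc x) = s≤s (bump-lower p x)

bump-mono : ∀ p {x y} → x ≤ y → bump p x ≤ bump p y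
bump-mono zero    x≤y               = s≤s x≤y
bump-mono (suc p) {zero}            x≤y = z≤n
bump-mono (suc p) {suc x} {suc y}   x≤y = s≤s (bump-mono p (s≤s⁻¹ x≤y))

bump-anti : ∀ p x → bump (suc p) x ≤ bump p x
bump-anti p       zero    = z≤n
bump-anti zero    (suc x) = ≤-refl
bump-anti (suc p) (suc x) = s≤s (bump-anti p x)

-- The element with index i may be inserted at any position up to pos i, and
-- pos is then updated by bump.  ways counts the sequences of insertions for
-- the given indices, and totalCost adds up their numbers of comparisons.
ways : List ℕ → (ℕ → ℕ) → ℕ
ways []       pos = 1
ways (i ∷ is) pos = ∑ (suc (pos i)) λ p → ways is (bump p ∘ pos)

totalCost : List ℕ → (ℕ → ℕ) → ℕ
totalCost []       pos = 0
totalCost (i ∷ is) pos = ∑ (suc (pos i)) λ p →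
  depth (pos i) (pos i) p * ways is (bump p ∘ pos) + totalCost is (bump p ∘ pos)

ways-mono : ∀ is {pos pos′} → All (λ j → pos j ≤ pos′ j) is → ways is pos ≤ ways is pos′
ways-mono []       []         = ≤-refl
ways-mono (i ∷ is) {pos} {pos′} (le ∷ les) = ≤-trans
  (∑-mono (suc (pos i)) (λ {p} _ → ways-mono is (All.map (bump-mono p) les)))
  (∑-≤ (s≤s le) _)

ways-cong : ∀ is {pos pos′} → All (λ j → pos j ≡ pos′ j) is → ways is pos ≡ ways is pos′
ways-cong is eq = ≤-antisym (ways-mono is (All.map ≤-reflexive eq)) (ways-mono is (All.map (≤-reflexive ∘ sym) eq))

totalCost-cong : ∀ is {pos pos′} → All (λ j → pos j ≡ pos′ j) is → totalCost is pos ≡ totalCost is pos′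
totalCost-cong []       []         = refl
totalCost-cong (i ∷ is) {pos} {pos′} (eq ∷ eqs) rewrite eq = ∑-cong (suc (pos′ i)) λ {p} _ →
  cong₂ (λ w c → depth (pos′ i) (pos′ i) p * w + c)
        (ways-cong is (All.map (cong (bump p)) eqs)) (totalCost-cong is (All.map (cong (bump p)) eqs))

module _ {ys : List ℕ} {posʸ : ℕ → ℕ} where

  shifted : ∀ {p} n (pos : ℕ → ℕ) → All (λ j → p ≤ pos j) ys → All (λ j → posʸ j ≡ suc n + pos j) ys →
            All (λ j → posʸ j ≡ n + bump p (pos j)) ys
  shifted {p} n pos p≤ eqs = All.zipWith (λ {j} (p≤ , eq) → trans eq
    (trans (sym (+-suc n (pos j))) (cong (n +_) (sym (bump-≤ p≤))))) (p≤ , eqs)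

  below : ∀ {p} xs {pos : ℕ → ℕ} → All (λ i → All (λ j → pos i ≤ pos j) ys) xs → All (λ i → All (λ j → bump p (pos i) ≤ bump p (pos j)) ys) xs
  below {p} xs = All.map (All.map (bump-mono p))

  -- Every insertion of an element of xs happens at or below all bounds for ys and raises each of
  -- them by exactly 1, wherever it takes place. So the choices for ys do not depend on those for
  -- xs.
  ways-++ : ∀ xs {pos} → All (λ i → All (λ j → pos i ≤ pos j) ys) xs → All (λ j → posʸ j ≡ length xs + pos j) ys →
            ways (xs ++ ys) pos ≡ ways xs pos * ways ys posʸ
  ways-++ []       {pos} _          eqs = trans (ways-cong ys (All.map sym eqs)) (sym (*-identityˡ _))
  ways-++ (x ∷ xs) {pos} (le ∷ les) eqs = trans
    (∑-cong (suc (pos x)) λ {p} p< → ways-++ xs (below xs les) (shifted (length xs) pos (All.map (≤-trans (s≤s⁻¹ p<)) le) eqs))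
    (∑-*ʳ (suc (pos x)) _ _)

  totalCost-++ : ∀ xs {pos} → All (λ i → All (λ j → pos i ≤ pos j) ys) xs → All (λ j → posʸ j ≡ length xs + pos j) ys →
                 totalCost (xs ++ ys) pos ≡ totalCost xs pos * ways ys posʸ + ways xs pos * totalCost ys posʸ
  totalCost-++ []       {pos} _          eqs = trans (totalCost-cong ys (All.map sym eqs)) (sym (+-identityʳ _))
  totalCost-++ (x ∷ xs) {pos} (le ∷ les) eqs = begin
    ∑ n (λ p → d p * ways (xs ++ ys) (bump p ∘ pos) + totalCost (xs ++ ys) (bump p ∘ pos))
      ≡⟨ ∑-cong n (λ {p} p< → let les′ = below xs les; eqs′ = shifted (length xs) pos (All.map (≤-trans (s≤s⁻¹ p<)) le) eqs in
           trans (cong₂ (λ a b → d p * a + b) (ways-++ xs les′ eqs′) (totalCost-++ xs les′ eqs′))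
                 (l (d p) (ways xs (bump p ∘ pos)) W (totalCost xs (bump p ∘ pos)) C)) ⟩
    ∑ n (λ p → (d p * ways xs (bump p ∘ pos) + totalCost xs (bump p ∘ pos)) * W + ways xs (bump p ∘ pos) * C)
      ≡⟨ trans (∑-+ n _ _) (cong₂ _+_ (∑-*ʳ n _ W) (∑-*ʳ n _ C)) ⟩
    totalCost (x ∷ xs) pos * W + ways (x ∷ xs) pos * C ∎
    where
    open ≡-Reasoning
    n = suc (pos x)
    d = depth (pos x) (pos x)
    W = ways ys posʸ
    C = totalCost ys posʸ
    l : ∀ d a W b C → d * (a * W) + (b * W + a * C) ≡ (d * a + b) * W + a * C
    l = solve-∀

-- Insertions within a group

descending : ℕ → ℕ → List ℕ
descending s zero    = []
descending s (suc r) = s + suc r ∷ descending s r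

descending-All : ∀ {P : ℕ → Set} s r → (∀ l → l < r → P (s + suc l)) → All P (descending s r)
descending-All s zero    h = []
descending-All s (suc r) h = h r ≤-refl ∷ descending-All s r (λ l l<r → h l (m≤n⇒m≤1+n l<r))

Monotone : (ℕ → ℕ) → Set
Monotone pos = ∀ {i j} → i ≤ j → pos i ≤ pos j

factors : ℕ → ℕ → (ℕ → ℕ) → ℕ
factors s zero    pos = 1
factors s (suc r) pos = (pos (s + suc r) + suc r) * factors s r pos

factors-cong : ∀ s r {pos pos′} → (∀ l → l < r → pos (s + suc l) ≡ pos′ (s + suc l)) → factors s r pos ≡ factors s r pos′
factors-cong s zero    eq = refl
factors-cong s (suc r) eq = cong₂ (λ x y → (x + suc r) * y) (eq r ≤-refl) (factors-cong s r (λ l l<r → eq l (m≤n⇒m≤1+n l<r)))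

-- The number of ways does not depend on the order of insertion: in ascending order the l-th element
-- of the group would have pos (s + l) + l gaps, and an element above all of them would have y + suc
-- r. In the induction, positions p beyond the bound x of the next element move nothing and
-- contribute equal summands, while all p ≤ x raise that bound by 1.
∑-factors : ∀ s r {pos} → Monotone pos → ∀ y → pos (s + r) ≤ y →
            ∑ (suc y) (λ p → factors s r (bump p ∘ pos)) ≡ (y + suc r) * factors s r pos
∑-factors s zero    {pos} mono y _  = trans (∑-const (suc y) 1) (cong (_* 1) (+-comm 1 y))
∑-factors s (suc r) {pos} mono y x≤y = subst (λ y → ∑ (suc y) (λ p → factors s (suc r) (bump p ∘ pos)) ≡ (y + suc (suc r)) * factors s (suc r) pos)
    (m+[n∸m]≡n x≤y) (go (y ∸ x))
  where
  open ≡-Reasoning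
  x = pos (s + suc r)
  go : ∀ e → ∑ (suc (x + e)) (λ p → factors s (suc r) (bump p ∘ pos)) ≡ (x + e + suc (suc r)) * factors s (suc r) pos
  go zero    = begin
    ∑ (suc (x + 0)) (λ p → factors s (suc r) (bump p ∘ pos)) ≡⟨ cong (λ z → ∑ (suc z) (λ p → factors s (suc r) (bump p ∘ pos))) (+-identityʳ x) ⟩
    ∑ (suc x) (λ p → (bump p x + suc r) * factors s r (bump p ∘ pos)) ≡⟨ ∑-cong (suc x) (λ {p} p≤ → cong (λ z → (z + suc r) * factors s r (bump p ∘ pos)) (bump-≤ (s≤s⁻¹ p≤))) ⟩
    ∑ (suc x) (λ p → (suc x + suc r) * factors s r (bump p ∘ pos)) ≡⟨ ∑-*ˡ (suc x) (suc x + suc r) _ ⟩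
    (suc x + suc r) * ∑ (suc x) (λ p → factors s r (bump p ∘ pos)) ≡⟨ cong ((suc x + suc r) *_) (∑-factors s r mono x (mono (+-monoʳ-≤ s (n≤1+n r)))) ⟩
    (suc x + suc r) * ((x + suc r) * factors s r pos) ≡⟨ cong (_* ((x + suc r) * factors s r pos)) (l x r) ⟩
    (x + 0 + suc (suc r)) * ((x + suc r) * factors s r pos) ∎
    where
    l : ∀ x r → suc x + suc r ≡ x + 0 + suc (suc r)
    l = solve-∀
  go (suc e) = begin
    ∑ (suc (x + suc e)) (λ p → factors s (suc r) (bump p ∘ pos))
      ≡⟨ cong₂ (λ y z → ∑ y (λ p → factors s (suc r) (bump p ∘ pos)) + z) (+-suc x e) (factors-cong s (suc r) {bump (x + suc e) ∘ pos} {pos} (λ l l≤r → bump-> (above l l≤r))) ⟩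
    ∑ (suc (x + e)) (λ p → factors s (suc r) (bump p ∘ pos)) + factors s (suc r) pos
      ≡⟨ cong (_+ factors s (suc r) pos) (go e) ⟩
    (x + e + suc (suc r)) * factors s (suc r) pos + factors s (suc r) pos
      ≡⟨ l x e r (factors s (suc r) pos) ⟩
    (x + suc e + suc (suc r)) * factors s (suc r) pos ∎
    where
    l : ∀ x e r F → (x + e + suc (suc r)) * F + F ≡ (x + suc e + suc (suc r)) * F
    l = solve-∀
    above : ∀ l → l < suc r → pos (s + suc l) < x + suc e
    above l l≤r = ≤-trans (s≤s (mono (+-monoʳ-≤ s l≤r))) (≤-trans (s≤s (m≤m+n x e)) (≤-reflexive (sym (+-suc x e))))

ways-descending : ∀ s r {pos} → Monotone pos → ways (descending s r) pos ≡ factors s r pos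
ways-descending s zero    mono = refl
ways-descending s (suc r) {pos} mono = trans
  (∑-cong (suc (pos (s + suc r))) (λ {p} _ → ways-descending s r {bump p ∘ pos} (bump-mono p ∘ mono)))
  (∑-factors s r mono (pos (s + suc r)) (mono (+-monoʳ-≤ s (n≤1+n r))))

-- pos (s + l) ≤ B + l ∸ r for l ≤ r: at each insertion the positions grow by at most 1,
-- so every element of the group has a position of at most B when it is inserted.
Below : ℕ → ℕ → ℕ → (ℕ → ℕ) → Set
Below B s r pos = ∀ l → l < r → pos (s + suc l) + r ≤ B + suc l

Below-bump : ∀ {B s r pos} p → Below B s (suc r) pos → Below B s r (bump p ∘ pos)
Below-bump {r = r} {pos} p h l l<r = ≤-trans (+-monoˡ-≤ r (bump-upper p (pos _)))
  (≤-trans (≤-reflexive (sym (+-suc (pos _) r))) (h l (m≤n⇒m≤1+n l<r)))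

Below-head : ∀ {B s r pos} → Below B s (suc r) pos → pos (s + suc r) ≤ B
Below-head {r = r} h = +-cancelʳ-≤ (suc r) _ _ (h r ≤-refl)

full-group : ∀ {B k} → suc B ≤ 2 ^ k → ∀ s r {pos} → Below B s r pos →
             totalCost (descending s r) pos ≤ r * k * ways (descending s r) pos
full-group hi s zero    h = z≤n
full-group {B} {k} hi s (suc r) {pos} h = begin
  ∑ n (λ p → d p * w p + totalCost (descending s r) (bump p ∘ pos))
    ≤⟨ ∑-mono n (λ {p} _ → +-mono-≤ (*-monoˡ-≤ (w p) (depth-≤ (pos i) k (pos i) p (≤-trans (s≤s (Below-head {s = s} {pos = pos} h)) hi))) (full-group hi s r (Below-bump {s = s} {pos = pos} p h))) ⟩
  ∑ n (λ p → k * w p + r * k * w p)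
    ≡⟨ ∑-cong n (λ {p} _ → sym (*-distribʳ-+ (w p) k (r * k))) ⟩
  ∑ n (λ p → suc r * k * w p)
    ≡⟨ ∑-*ˡ n (suc r * k) w ⟩
  suc r * k * ∑ n w ∎
  where
  open ≤-Reasoning
  i = s + suc r
  n = suc (pos i)
  d = depth (pos i) (pos i)
  w = λ p → ways (descending s r) (bump p ∘ pos)

-- The heart of the average case analysis.  The weights w are nonincreasing
-- because an insertion further to the right leaves less room for the elements
-- inserted later, so that the prefix sums of the depths bound the cost.
module Partial (D K B M g d e : ℕ)
  (M≥ : 2 ^ K ≤ suc M) (B≤ : suc B ≤ 2 ^ suc K)
  (g≤ : suc B * g ≤ D * 2 ^ suc K) (d≥ : D * (4 * K) ≤ suc M * d) (e≡ : e + g ≡ D * (2 + K) + d) where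

  open ≤-Reasoning

  -- `abel` leaves the error D (4 K) w 0. As w is constant on the first M + 1 positions, (M + 1) w 0
  -- is at most the sum of all weights, and the error adds no more than d to the scaled average.
  insertion-cost : ∀ L w → M ≤ L → L ≤ B → (∀ p → w (suc p) ≤ w p) → (∀ p → p ≤ M → w p ≡ w 0) →
                   D * ∑ (suc L) (λ p → depth L L p * w p) ≤ e * ∑ (suc L) w
  insertion-cost L w M≤L L≤B w↓ flat = +-cancelʳ-≤ (g * W) _ _ (begin
    D * ∑ N (λ p → depth L L p * w p) + g * W
      ≡⟨ cong₂ _+_ (sym (trans (∑-cong N (λ {p} _ → *-assoc D (depth L L p) (w p))) (∑-*ˡ N D _))) (sym (∑-*ˡ N g w)) ⟩
    ∑ N (λ p → D * depth L L p * w p) + ∑ N (λ p → g * w p)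
      ≡⟨ trans (sym (∑-+ N _ _)) (∑-cong N (λ {p} _ → sym (*-distribʳ-+ (w p) (D * depth L L p) g))) ⟩
    ∑ N (λ p → (D * depth L L p + g) * w p)
      ≤⟨ abel (λ p → D * depth L L p + g) (λ _ → D * (2 + K)) w (D * (4 * K)) N prefix (λ {p} _ → w↓ p) ⟩
    ∑ N (λ p → D * (2 + K) * w p) + D * (4 * K) * w 0
      ≤⟨ +-mono-≤ (≤-reflexive (∑-*ˡ N (D * (2 + K)) w)) (*-monoˡ-≤ (w 0) d≥) ⟩
    D * (2 + K) * W + suc M * d * w 0
      ≡⟨ cong (D * (2 + K) * W +_) (l (suc M) d (w 0)) ⟩
    D * (2 + K) * W + d * (suc M * w 0)
      ≤⟨ +-monoʳ-≤ (D * (2 + K) * W) (*-monoʳ-≤ d first) ⟩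
    D * (2 + K) * W + d * W
      ≡⟨ *-distribʳ-+ W (D * (2 + K)) d ⟨
    (D * (2 + K) + d) * W
      ≡⟨ trans (cong (_* W) (sym e≡)) (*-distribʳ-+ W e g) ⟩
    e * W + g * W ∎)
    where
    N = suc L
    W = ∑ N w
    l : ∀ a b c → a * b * c ≡ b * (a * c)
    l = solve-∀
    first : suc M * w 0 ≤ W
    first = ≤-trans (≤-reflexive (trans (sym (∑-const (suc M) (w 0))) (∑-cong (suc M) (λ {p} p< → sym (flat p (s≤s⁻¹ p<)))))) (∑-≤ (s≤s M≤L) w)
    prefix : ∀ {m} → m ≤ N → ∑ m (λ p → D * depth L L p + g) ≤ ∑ m (λ _ → D * (2 + K)) + D * (4 * K)
    prefix {m} m≤N = *-cancelˡ-≤ N (begin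
      N * ∑ m (λ p → D * depth L L p + g)
        ≡⟨ cong (N *_) (trans (∑-+ m _ _) (cong₂ _+_ (∑-*ˡ m D (depth L L)) (∑-const m g))) ⟩
      N * (D * ∑ m (depth L L) + m * g)
        ≡⟨ l₁ N D (∑ m (depth L L)) m g ⟩
      D * (N * ∑ m (depth L L)) + m * (N * g)
        ≤⟨ +-monoʳ-≤ (D * (N * ∑ m (depth L L))) (*-monoʳ-≤ m (≤-trans (*-monoˡ-≤ g (s≤s L≤B)) g≤)) ⟩
      D * (N * ∑ m (depth L L)) + m * (D * 2 ^ suc K)
        ≡⟨ l₂ D (N * ∑ m (depth L L)) m (2 ^ suc K) ⟩
      D * (N * ∑ m (depth L L) + m * 2 ^ suc K)
        ≤⟨ *-monoʳ-≤ D (prefix-depth L K L m ≤-refl (≤-trans M≥ (s≤s M≤L)) (≤-trans (s≤s L≤B) B≤) m≤N) ⟩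
      D * (m * N * (2 + K) + N * (4 * K))
        ≡⟨ l₃ D m N K ⟩
      N * (m * (D * (2 + K)) + D * (4 * K))
        ≡⟨ cong (λ x → N * (x + D * (4 * K))) (sym (∑-const m (D * (2 + K)))) ⟩
      N * (∑ m (λ _ → D * (2 + K)) + D * (4 * K)) ∎)
      where
      l₁ : ∀ N D S m g → N * (D * S + m * g) ≡ D * (N * S) + m * (N * g)
      l₁ = solve-∀
      l₂ : ∀ D x m P → D * x + m * (D * P) ≡ D * (x + m * P)
      l₂ = solve-∀
      l₃ : ∀ D m N K → D * (m * N * (2 + K) + N * (4 * K)) ≡ N * (m * (D * (2 + K)) + D * (4 * K))
      l₃ = solve-∀

  partial-group : ∀ s r {pos} → Below B s r pos → (∀ l → l < r → M ≤ pos (s + suc l)) →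
                  D * totalCost (descending s r) pos ≤ r * e * ways (descending s r) pos
  partial-group s zero    h lo = ≤-reflexive (*-zeroʳ D)
  partial-group s (suc r) {pos} h lo = begin
    D * ∑ n (λ p → dep p * w p + c p)
      ≡⟨ trans (cong (D *_) (∑-+ n _ _)) (*-distribˡ-+ D (∑ n (λ p → dep p * w p)) (∑ n c)) ⟩
    D * ∑ n (λ p → dep p * w p) + D * ∑ n c
      ≤⟨ +-mono-≤ (insertion-cost (pos i) w (lo r ≤-refl) (Below-head {s = s} {pos = pos} h) w↓ flat) rest ⟩
    e * ∑ n w + r * e * ∑ n w
      ≡⟨ *-distribʳ-+ (∑ n w) e (r * e) ⟨
    suc r * e * ∑ n w ∎
    where
    i = s + suc r
    n = suc (pos i)
    dep = depth (pos i) (pos i)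
    w = λ p → ways (descending s r) (bump p ∘ pos)
    c = λ p → totalCost (descending s r) (bump p ∘ pos)
    w↓ : ∀ p → w (suc p) ≤ w p
    w↓ p = ways-mono (descending s r) (All.universal (λ j → bump-anti p (pos j)) (descending s r))
    -- An insertion at p ≤ M lies below the bounds of all remaining elements and raises each of them
    -- by 1.
    flat : ∀ p → p ≤ M → w p ≡ w 0
    flat p p≤M = ways-cong (descending s r) (descending-All s r (λ l l<r → bump-≤ (≤-trans p≤M (lo l (m≤n⇒m≤1+n l<r)))))
    rest : D * ∑ n c ≤ r * e * ∑ n w
    rest = ≤-trans (≤-reflexive (sym (∑-*ˡ n D c))) (≤-trans
      (∑-mono n (λ {p} _ → partial-group s r (Below-bump {s = s} {pos = pos} p h) (λ l l<r → ≤-trans (lo l (m≤n⇒m≤1+n l<r)) (bump-lower p (pos _)))))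
      (≤-reflexive (∑-*ˡ n (r * e) w)))

fullGroups : ℕ → List ℕ
fullGroups zero    = []
fullGroups (suc K) = fullGroups K ++ descending (t K) (t (suc K) ∸ t K)

order : ℕ → ℕ → List ℕ
order K r = fullGroups K ++ descending (t K) r

descending-length : ∀ s r → length (descending s r) ≡ r
descending-length s zero    = refl
descending-length s (suc r) = cong suc (descending-length s r)

fullGroups-length : ∀ K → suc (length (fullGroups K)) ≡ t K
fullGroups-length zero    = refl
fullGroups-length (suc K) = trans (cong suc (length-++ (fullGroups K)))
  (trans (cong₂ _+_ (fullGroups-length K) (descending-length (t K) _)) (m+[n∸m]≡n (t-mono K)))

fullGroups-≤ : ∀ K → All (_≤ t K) (fullGroups K)
fullGroups-≤ zero    = []
fullGroups-≤ (suc K) = All.++⁺ (All.map (λ h → ≤-trans h (t-mono K)) (fullGroups-≤ K))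
  (descending-All (t K) _ (λ l l< → ≤-trans (+-monoʳ-≤ (t K) l<) (≤-reflexive (m+[n∸m]≡n (t-mono K)))))

-- The double factorial (2 u - 1)!!. In ascending order of insertion the element bᵢ would have 2 i -
-- 1 gaps.
oddFactorial : ℕ → ℕ
oddFactorial zero    = 1
oddFactorial (suc u) = suc (2 * u) * oddFactorial u

module _ (K : ℕ) where
  private
    L = length (fullGroups K)

  separated : ∀ r → All (λ i → All (i ≤_) (descending (t K) r)) (fullGroups K)
  separated r = All.map (λ i≤ → descending-All (t K) r (λ l _ → ≤-trans i≤ (m≤m+n (t K) (suc l)))) (fullGroups-≤ K)

  factors-odd : ∀ r → factors (t K) r (L +_) * oddFactorial (t K) ≡ oddFactorial (t K + r)
  factors-odd zero    = trans (*-identityˡ _) (cong oddFactorial (sym (+-identityʳ (t K))))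
  factors-odd (suc r) = begin
    (L + (t K + suc r) + suc r) * factors (t K) r (L +_) * oddFactorial (t K) ≡⟨ *-assoc (L + (t K + suc r) + suc r) _ _ ⟩
    (L + (t K + suc r) + suc r) * (factors (t K) r (L +_) * oddFactorial (t K)) ≡⟨ cong₂ _*_ eq (factors-odd r) ⟩
    suc (2 * (t K + r)) * oddFactorial (t K + r) ≡⟨ cong oddFactorial (+-suc (t K) r) ⟨
    oddFactorial (t K + suc r) ∎
    where
    open ≡-Reasoning
    l₁ : ∀ L x r → L + (x + suc r) + suc r ≡ suc L + x + r + suc r
    l₁ = solve-∀
    l₂ : ∀ x r → x + x + r + suc r ≡ suc (2 * (x + r))
    l₂ = solve-∀
    eq : L + (t K + suc r) + suc r ≡ suc (2 * (t K + r))
    eq = trans (l₁ L (t K) r) (trans (cong (λ x → x + t K + r + suc r) (fullGroups-length K)) (l₂ (t K) r))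

  ways-order-* : ∀ r → ways (order K r) id ≡ ways (fullGroups K) id * factors (t K) r (L +_)
  ways-order-* r = trans (ways-++ {posʸ = L +_} (fullGroups K) (separated r) (All.universal (λ _ → refl) (descending (t K) r)))
    (cong (ways (fullGroups K) id *_) (ways-descending (t K) r (+-monoʳ-≤ L)))

  totalCost-order : ∀ r → totalCost (order K r) id ≡ totalCost (fullGroups K) id * ways (descending (t K) r) (L +_) + ways (fullGroups K) id * totalCost (descending (t K) r) (L +_)
  totalCost-order r = totalCost-++ {posʸ = L +_} (fullGroups K) (separated r) (All.universal (λ _ → refl) (descending (t K) r))

  below-order : ∀ r → Below (L + t K + r) (t K) r (L +_)
  below-order r l _ = ≤-reflexive (lem L (t K) l r)
    where
    lem : ∀ L x l r → L + (x + suc l) + r ≡ L + x + r + suc l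
    lem = solve-∀

ways-fullGroups : ∀ K → ways (fullGroups K) id ≡ oddFactorial (t K)
ways-fullGroups zero    = refl
ways-fullGroups (suc K) = begin
  ways (fullGroups (suc K)) id ≡⟨ ways-order-* K r ⟩
  ways (fullGroups K) id * factors (t K) r (length (fullGroups K) +_) ≡⟨ cong (_* factors (t K) r (length (fullGroups K) +_)) (ways-fullGroups K) ⟩
  oddFactorial (t K) * factors (t K) r (length (fullGroups K) +_) ≡⟨ *-comm (oddFactorial (t K)) _ ⟩
  factors (t K) r (length (fullGroups K) +_) * oddFactorial (t K) ≡⟨ factors-odd K r ⟩
  oddFactorial (t K + r) ≡⟨ cong oddFactorial (m+[n∸m]≡n (t-mono K)) ⟩
  oddFactorial (t (suc K)) ∎
  where
  open ≡-Reasoning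
  r = t (suc K) ∸ t K

ways-order : ∀ K r → ways (order K r) id ≡ oddFactorial (t K + r)
ways-order K r = trans (ways-order-* K r) (trans (cong (_* factors (t K) r (length (fullGroups K) +_)) (ways-fullGroups K))
  (trans (*-comm (oddFactorial (t K)) _) (factors-odd K r)))

module _ (D : ℕ) where

  -- Costs relative to the number of ways are additive.
  extend : ∀ K r h → totalCost (fullGroups K) id ≤ fullCost K * ways (fullGroups K) id →
           D * totalCost (descending (t K) r) (length (fullGroups K) +_) ≤ h * ways (descending (t K) r) (length (fullGroups K) +_) →
           D * totalCost (order K r) id ≤ (D * fullCost K + h) * ways (order K r) id
  extend K r h full group = begin
    D * totalCost (order K r) id ≡⟨ cong (D *_) (totalCost-order K r) ⟩
    D * (C₁ * W₂ + W₁ * C₂) ≡⟨ l₁ D C₁ W₂ W₁ C₂ ⟩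
    D * C₁ * W₂ + W₁ * (D * C₂) ≤⟨ +-mono-≤ (*-monoˡ-≤ W₂ (*-monoʳ-≤ D full)) (*-monoʳ-≤ W₁ group) ⟩
    D * (fullCost K * W₁) * W₂ + W₁ * (h * W₂) ≡⟨ l₂ D (fullCost K) W₁ W₂ h ⟩
    (D * fullCost K + h) * (W₁ * W₂) ≡⟨ cong ((D * fullCost K + h) *_) (ways-++ {posʸ = length (fullGroups K) +_} (fullGroups K) (separated K r) (All.universal (λ _ → refl) (descending (t K) r))) ⟨
    (D * fullCost K + h) * ways (order K r) id ∎
    where
    open ≤-Reasoning
    C₁ = totalCost (fullGroups K) id
    W₁ = ways (fullGroups K) id
    C₂ = totalCost (descending (t K) r) (length (fullGroups K) +_)
    W₂ = ways (descending (t K) r) (length (fullGroups K) +_)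
    l₁ : ∀ D c w w′ c′ → D * (c * w + w′ * c′) ≡ D * c * w + w′ * (D * c′)
    l₁ = solve-∀
    l₂ : ∀ D f w w′ h → D * (f * w) * w′ + w * (h * w′) ≡ (D * f + h) * (w * w′)
    l₂ = solve-∀

fullGroups-cost : ∀ K → totalCost (fullGroups K) id ≤ fullCost K * ways (fullGroups K) id
fullGroups-cost zero    = z≤n
fullGroups-cost (suc K) = subst₂ _≤_ (*-identityˡ _) (cong (_* ways (order K r) id) eq)
  (extend 1 K r (r * suc K) (fullGroups-cost K) (≤-trans (≤-reflexive (*-identityˡ _)) (full-group hi (t K) r (below-order K r))))
  where
  r = t (suc K) ∸ t K
  hi : suc (length (fullGroups K) + t K + r) ≤ 2 ^ suc K
  hi = ≤-reflexive (trans (cong (λ x → x + t K + r) (fullGroups-length K)) (trans (+-assoc (t K) (t K) r)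
         (trans (cong (t K +_) (m+[n∸m]≡n (t-mono K))) (t-sum K))))
  eq : 1 * fullCost K + r * suc K ≡ fullCost (suc K)
  eq = cong₂ _+_ (*-identityˡ (fullCost K)) (*-comm r (suc K))

module _ (D : ℕ) where

  open Budget D

  order-cost : ∀ K r → t K + suc r ≤ t (suc K) → D * totalCost (order K (suc r)) id ≤ budget K r * ways (order K (suc r)) id
  order-cost K r r≤ = extend D K (suc r) (suc r * η K r) (fullGroups-cost K)
    (partial-group (t K) (suc r) (below-order K (suc r)) lo)
    where
    L = length (fullGroups K)
    -- L is t K - 1, because b₁ belongs to the initial chain.
    B≡ : suc (L + t K + suc r) ≡ suc (2 * t K + r)
    B≡ = trans (cong (λ x → x + t K + suc r) (fullGroups-length K)) (l (t K) r)
      where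
      l : ∀ x r → x + x + suc r ≡ suc (2 * x + r)
      l = solve-∀
    hi : suc (L + t K + suc r) ≤ 2 ^ suc K
    hi = ≤-trans (≤-reflexive (trans (cong (λ x → x + t K + suc r) (fullGroups-length K)) (+-assoc (t K) (t K) (suc r))))
           (≤-trans (+-monoʳ-≤ (t K) r≤) (≤-reflexive (t-sum K)))
    lo : ∀ l → l < suc r → 2 * t K ≤ L + (t K + suc l)
    lo l _ = subst₂ _≤_ (cong (t K +_) (sym (+-identityʳ (t K)))) (l′ L (t K) l) (≤-trans (≤-reflexive (cong (_+ t K) (sym (fullGroups-length K)))) (m≤m+n (suc L + t K) l))
      where
      l′ : ∀ L x l → suc L + x + l ≡ L + (x + suc l)
      l′ = solve-∀
    M≥ : 2 ^ K ≤ suc (2 * t K)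
    M≥ = *-cancelˡ-≤ 2 (≤-trans (≤3t K) (≤-trans (m≤m+n (suc (3 * t K)) (suc (t K))) (≤-reflexive (l (t K)))))
      where
      l : ∀ x → suc (3 * x) + suc x ≡ 2 * suc (2 * x)
      l = solve-∀
    η+γ : η K r + γ K r ≡ D * (2 + K) + δ K
    η+γ = trans (l (D * (2 + K) ∸ γ K r) (δ K) (γ K r)) (cong (_+ δ K) (m∸n+n≡m (γ≤ K r)))
      where
      l : ∀ a b c → a + b + c ≡ a + c + b
      l = solve-∀
    open Partial D K (L + t K + suc r) (2 * t K) (γ K r) (δ K) (η K r) M≥ hi
      (≤-trans (≤-reflexive (cong (_* γ K r) B≡)) (γ-upper K r)) (δ-lower K) η+γ

-- Correctness of binary insertion

<ᵇ-true : ∀ {m n} → m < n → (m <ᵇ n) ≡ true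
<ᵇ-true m<n = Equivalence.to T-≡ (<⇒<ᵇ m<n)

<ᵇ-false : ∀ {m n} → n ≤ m → (m <ᵇ n) ≡ false
<ᵇ-false {m} {n} n≤m with m <ᵇ n in eq
... | false = refl
... | true  = ⊥-elim (≤⇒≯ n≤m (<ᵇ⇒< m n (Equivalence.from T-≡ eq)))

compareBy : (A → ℕ) → Compare A
compareBy key x y = 1 , (key x <ᵇ key y)

splitAt-++ : ∀ (xs ys : List A) → splitAt (length xs) (xs ++ ys) ≡ (xs , ys)
splitAt-++ []       ys = refl
splitAt-++ (x ∷ xs) ys rewrite splitAt-++ xs ys = refl

-- For a list split at the insertion point and at the pivot m: the pivot belongs either to the
-- smaller or to the greater elements.
++-compare : ∀ (ls : List A) {rs} xs {m ys} → ls ++ rs ≡ xs ++ m ∷ ys →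
             (∃[ zs ] ls ≡ xs ++ m ∷ zs × ys ≡ zs ++ rs) ⊎ (∃[ zs ] xs ≡ ls ++ zs × rs ≡ zs ++ m ∷ ys)
++-compare []       xs       eq   = inj₂ (xs , refl , eq)
++-compare (l ∷ ls) []       refl = inj₁ (ls , refl , refl)
++-compare (l ∷ ls) (x ∷ xs) eq with refl ← cong (take 1) eq | ++-compare ls xs (cong (drop 1) eq)
... | inj₁ (zs , refl , ys≡) = inj₁ (zs , refl , ys≡)
... | inj₂ (zs , refl , rs≡) = inj₂ (zs , refl , rs≡)

++-split : ∀ n (xs : List A) → n < length xs → ∃[ ys ] ∃[ m ] ∃[ zs ] xs ≡ ys ++ m ∷ zs × length ys ≡ n
++-split zero    (x ∷ xs) _        = [] , x , xs , refl , refl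
++-split (suc n) (x ∷ xs) (s≤s n<) with ys , m , zs , refl , eq ← ++-split n xs n< = x ∷ ys , m , zs , refl , cong suc eq

module _ (key : A → ℕ) where

  Less : A → List A → Set
  Less y = All (λ x → key x < key y)

  Greater : A → List A → Set
  Greater y = All (λ x → key y < key x)

  binaryInsert-unfold : ∀ f y xs m ys → length xs ≡ ⌊ length (xs ++ m ∷ ys) /2⌋ →
    binaryInsert (suc f) (compareBy key) y (xs ++ m ∷ ys) ≡
    ((compareBy key y m) >>= λ y≺m → if y≺m
      then (binaryInsert f (compareBy key) y xs >>= λ xs′ → return (xs′ ++ m ∷ ys))
      else (binaryInsert f (compareBy key) y ys >>= λ ys′ → return (xs ++ m ∷ ys′)))
  binaryInsert-unfold f y xs m ys eq rewrite sym eq | splitAt-++ xs (m ∷ ys) = refl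

  -- Once the insertion point is presented as a splitting of the list, the outcome of every
  -- comparison is known, and the search follows the path to the leaf with number length ls.
  binaryInsert-split : ∀ f y ls rs → length (ls ++ rs) ≤ f → Less y ls → Greater y rs →
    binaryInsert f (compareBy key) y (ls ++ rs) ≡ (depth f (length (ls ++ rs)) (length ls) , ls ++ y ∷ rs)

  binaryInsert-step : ∀ f y ls rs xs m ys → ls ++ rs ≡ xs ++ m ∷ ys → length xs ≡ ⌊ length (xs ++ m ∷ ys) /2⌋ →
    length (xs ++ m ∷ ys) ≤ suc f → Less y ls → Greater y rs →
    binaryInsert (suc f) (compareBy key) y (xs ++ m ∷ ys) ≡ (depth (suc f) (length (xs ++ m ∷ ys)) (length ls) , ls ++ y ∷ rs)
  binaryInsert-step f y ls rs xs m ys eq half len lo hi = trans (binaryInsert-unfold f y xs m ys half) (cases (++-compare ls xs eq))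
    where
    L = length xs + length ys
    size : length (xs ++ m ∷ ys) ≡ suc L
    size = trans (length-++ xs) (+-suc (length xs) (length ys))
    -- ⌈ L /2⌉ is by definition ⌊ suc L /2⌋, the position of the pivot in a list of length suc L.
    xs≡ : length xs ≡ ⌈ L /2⌉
    xs≡ = trans half (cong ⌊_/2⌋ size)
    ys≡ : length ys ≡ ⌊ L /2⌋
    ys≡ = +-cancelˡ-≡ (length xs) _ _ (sym (trans (cong (_+ ⌊ L /2⌋) xs≡) (trans (+-comm ⌈ L /2⌉ ⌊ L /2⌋) (⌊n/2⌋+⌈n/2⌉≡n L))))
    L≤f : L ≤ f
    L≤f = s≤s⁻¹ (subst (_≤ suc f) size len)
    cases : (∃[ zs ] ls ≡ xs ++ m ∷ zs × ys ≡ zs ++ rs) ⊎ (∃[ zs ] xs ≡ ls ++ zs × rs ≡ zs ++ m ∷ ys) →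
      ((compareBy key y m) >>= λ y≺m → if y≺m
        then (binaryInsert f (compareBy key) y xs >>= λ xs′ → return (xs′ ++ m ∷ ys))
        else (binaryInsert f (compareBy key) y ys >>= λ ys′ → return (xs ++ m ∷ ys′)))
      ≡ (depth (suc f) (length (xs ++ m ∷ ys)) (length ls) , ls ++ y ∷ rs)
    cases (inj₁ (zs , refl , refl))
      rewrite <ᵇ-false (<⇒≤ (All.head (All.++⁻ʳ xs lo)))
            | binaryInsert-split f y zs rs (≤-trans (m≤n+m (length (zs ++ rs)) (length xs)) L≤f) (All.tail (All.++⁻ʳ xs lo)) hi
      = cong₂ _,_ (begin
          suc (depth f (length (zs ++ rs)) (length zs) + 0) ≡⟨ cong suc (+-identityʳ _) ⟩
          suc (depth f (length (zs ++ rs)) (length zs)) ≡⟨ cong (λ x → suc (depth f x (length zs))) ys≡ ⟩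
          suc (depth f ⌊ L /2⌋ (length zs)) ≡⟨ depth-right f L (length zs) ⟨
          depth (suc f) (suc L) (suc ⌈ L /2⌉ + length zs) ≡⟨ cong₂ (depth (suc f)) (sym size)
                                                                     (trans (cong (λ x → suc x + length zs) (sym xs≡)) (trans (sym (+-suc (length xs) _)) (sym (length-++ xs)))) ⟩
          depth (suc f) (length (xs ++ m ∷ ys)) (length (xs ++ m ∷ zs)) ∎)
        (sym (++-assoc xs (m ∷ zs) (y ∷ rs)))
      where open ≡-Reasoning
    cases (inj₂ (zs , refl , refl))
      rewrite <ᵇ-true (All.head (All.++⁻ʳ zs hi))
            | binaryInsert-split f y ls zs (≤-trans (m≤m+n (length (ls ++ zs)) (length ys)) L≤f) lo (All.++⁻ˡ zs hi)
      = cong₂ _,_ (begin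
          suc (depth f (length (ls ++ zs)) (length ls) + 0) ≡⟨ cong suc (+-identityʳ _) ⟩
          suc (depth f (length (ls ++ zs)) (length ls)) ≡⟨ cong (λ x → suc (depth f x (length ls))) xs≡ ⟩
          suc (depth f ⌈ L /2⌉ (length ls)) ≡⟨ depth-left f L (subst (length ls ≤_) xs≡ (≤-trans (m≤m+n _ _) (≤-reflexive (sym (length-++ ls))))) ⟨
          depth (suc f) (suc L) (length ls) ≡⟨ cong (λ x → depth (suc f) x (length ls)) (sym size) ⟩
          depth (suc f) (length (xs ++ m ∷ ys)) (length ls) ∎)
        (++-assoc ls (y ∷ zs) (m ∷ ys))
      where open ≡-Reasoning

  binaryInsert-split zero    y []       []       _  _  _  = refl
  binaryInsert-split (suc f) y ls rs len lo hi = go (ls ++ rs) refl len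
    where
    go : ∀ zs → ls ++ rs ≡ zs → length zs ≤ suc f →
         binaryInsert (suc f) (compareBy key) y zs ≡ (depth (suc f) (length zs) (length ls) , ls ++ y ∷ rs)
    go []       eq _   with refl ← ++-conicalˡ ls rs eq | refl ← ++-conicalʳ ls rs eq = refl
    go (z ∷ zs) eq len with xs , m , ys , eq′ , half ← ++-split ⌊ suc (length zs) /2⌋ (z ∷ zs) (⌊n/2⌋<n (length zs)) =
      subst (λ w → binaryInsert (suc f) (compareBy key) y w ≡ (depth (suc f) (length w) (length ls) , ls ++ y ∷ rs)) (sym eq′)
        (binaryInsert-step f y ls rs xs m ys (trans eq eq′) (trans half (cong (λ w → ⌊ length w /2⌋) eq′))
          (subst (λ w → length w ≤ suc f) eq′ len) lo hi)

  Ascending : List A → Set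
  Ascending = AllPairs (λ x y → key x < key y)

  ascending-split : ∀ y xs → Ascending xs → All (λ x → key x ≢ key y) xs →
                    ∃₂ λ ls rs → xs ≡ ls ++ rs × Less y ls × Greater y rs
  ascending-split y []       _            _            = [] , [] , refl , [] , []
  ascending-split y (x ∷ xs) (x< ∷ asc) (x≢y ∷ xs≢y) with <-cmp (key x) (key y)
  ... | tri≈ _ x≡y _ = ⊥-elim (x≢y x≡y)
  ... | tri> _ _ y<x = [] , x ∷ xs , refl , [] , y<x ∷ All.map (<-trans y<x) x<
  ... | tri< x<y _ _ with ls , rs , refl , lo , hi ← ascending-split y xs asc xs≢y = x ∷ ls , rs , refl , x<y ∷ lo , hi

  ascending-insert : ∀ y ls rs → Ascending (ls ++ rs) → Less y ls → Greater y rs → Ascending (ls ++ y ∷ rs)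
  ascending-insert y []       rs asc        []         hi = hi ∷ asc
  ascending-insert y (l ∷ ls) rs (l< ∷ asc) (l<y ∷ lo) hi =
    All.++⁺ (All.++⁻ˡ ls l<) (l<y ∷ All.++⁻ʳ ls l<) ∷ ascending-insert y ls rs asc lo hi

-- Insertion into the labelled main chain

AllPairs-++⁻ : ∀ {R : A → A → Set} xs {ys} → AllPairs R (xs ++ ys) → AllPairs R xs × AllPairs R ys
AllPairs-++⁻ []       h       = [] , h
AllPairs-++⁻ (x ∷ xs) (r ∷ h) = All.++⁻ˡ xs r ∷ proj₁ (AllPairs-++⁻ xs h) , proj₂ (AllPairs-++⁻ xs h)

-- The length of the chain if no element has label i.
labelPosition : ℕ → List (Entry A) → ℕ
labelPosition i []       = 0
labelPosition i (e ∷ es) = if does (Maybe.≡-dec _≟_ (proj₂ e) (just i)) then 0 else suc (labelPosition i es)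

-- Links the chain to the abstract positions: an inserted entry carries no label and can only shift
-- the sought one. If the label does not occur, the position is the length of the chain, which grows
-- likewise.
labelPosition-insert : ∀ j (b : A) ls rs →
  labelPosition j (ls ++ (b , nothing) ∷ rs) ≡ bump (length ls) (labelPosition j (ls ++ rs))
labelPosition-insert j b []       rs = refl
labelPosition-insert j b (e ∷ ls) rs with does (Maybe.≡-dec _≟_ (proj₂ e) (just j))
... | true  = refl
... | false = cong suc (labelPosition-insert j b ls rs)

break-label : ∀ i (chain : List (Entry A)) → ∃₂ λ below above →
  break (λ e → Maybe.≡-dec _≟_ (proj₂ e) (just i)) chain ≡ (below , above) × chain ≡ below ++ above ×
  length below ≡ labelPosition i chain × (above ≡ [] ⊎ ∃₂ λ a above′ → above ≡ (a , just i) ∷ above′)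
break-label i []       = [] , [] , refl , refl , refl , inj₁ refl
break-label i (e ∷ es) with Maybe.≡-dec _≟_ (proj₂ e) (just i)
... | yes eq = [] , e ∷ es , refl , refl , refl , inj₂ (proj₁ e , es , cong (λ l → (proj₁ e , l) ∷ es) eq)
... | no  _  with below , above , eq , refl , len , hd ← break-label i es rewrite eq = e ∷ below , above , refl , refl , cong suc len , hd

module _ (key : A → ℕ) where

  entryKey : Entry A → ℕ
  entryKey = key ∘ proj₁

  -- For the unpaired element this is vacuous, as its index is not a label in the chain.
  Bounded : ℕ → A → List (Entry A) → Set
  Bounded i b = All (λ e → proj₂ e ≡ just i → key b < entryKey e)

  insertBelow-split : ∀ i b chain → Ascending entryKey chain → All (λ e → entryKey e ≢ key b) chain → Bounded i b chain →
    ∃₂ λ ls rs → chain ≡ ls ++ rs × length ls ≤ labelPosition i chain × Ascending entryKey (ls ++ (b , nothing) ∷ rs) ×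
    insertBelow (compareBy key) i b chain ≡ (depth (labelPosition i chain) (labelPosition i chain) (length ls) , ls ++ (b , nothing) ∷ rs)
  insertBelow-split i b chain asc fresh bounded
    with below , above , eq , refl , len , hd ← break-label i chain
    with ls , rs , refl , lo , hi ← ascending-split entryKey (b , nothing) below (proj₁ (AllPairs-++⁻ below asc)) (All.++⁻ˡ below fresh)
    rewrite eq | sym len
    = ls , rs ++ above , ++-assoc ls rs above , ≤-trans (m≤m+n _ _) (≤-reflexive (sym (length-++ ls)))
    , ascending-insert entryKey (b , nothing) ls (rs ++ above) (subst (Ascending entryKey) (++-assoc ls rs above) asc) lo (All.++⁺ hi (above-greater hd (proj₂ (AllPairs-++⁻ (ls ++ rs) asc)) (All.++⁻ʳ (ls ++ rs) bounded)))
    , result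
    where
    above-greater : ∀ {above} → above ≡ [] ⊎ ∃₂ (λ a above′ → above ≡ (a , just i) ∷ above′) →
                    Ascending entryKey above → Bounded i b above → Greater entryKey (b , nothing) above
    above-greater (inj₁ refl)             _            _           = []
    above-greater (inj₂ (a , es , refl)) (a< ∷ _) (h ∷ _) = h refl ∷ All.map (<-trans (h refl)) a<
    result : (binaryInsert (length (ls ++ rs)) (compareBy entryKey) (b , nothing) (ls ++ rs) >>= λ xs → return (xs ++ above)) ≡
             (depth (length (ls ++ rs)) (length (ls ++ rs)) (length ls) , ls ++ (b , nothing) ∷ rs ++ above)
    result rewrite binaryInsert-split entryKey (length (ls ++ rs)) (b , nothing) ls rs ≤-refl lo hi
      = cong₂ _,_ (+-identityʳ _) (++-assoc ls ((b , nothing) ∷ rs) above)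

-- The sequences of positions counted by ways, with their numbers of comparisons.
outcomes : List ℕ → (ℕ → ℕ) → List (List ℕ × ℕ)
outcomes []       pos = ([] , 0) ∷ []
outcomes (i ∷ is) pos = concatMap (λ p → map (λ (ps , c) → p ∷ ps , depth (pos i) (pos i) p + c) (outcomes is (bump p ∘ pos)))
                                  (upTo (suc (pos i)))

outcomes-cong : ∀ is {pos pos′} → All (λ j → pos j ≡ pos′ j) is → outcomes is pos ≡ outcomes is pos′
outcomes-cong []       []         = refl
outcomes-cong (i ∷ is) {pos} {pos′} (eq ∷ eqs) rewrite eq =
  concatMap-cong (λ p → cong (map _) (outcomes-cong is (All.map (cong (bump p)) eqs))) (upTo (suc (pos′ i)))

sum-concatMap : ∀ (g : B → ℕ) (h : A → List B) xs → sum (map g (concatMap h xs)) ≡ sum (map (λ x → sum (map g (h x))) xs)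
sum-concatMap g h []       = refl
sum-concatMap g h (x ∷ xs) = trans (cong sum (map-++ g (h x) (concatMap h xs)))
  (trans (sum-++ (map g (h x)) _) (cong (sum (map g (h x)) +_) (sum-concatMap g h xs)))

sum-upTo : ∀ n f → sum (map f (upTo n)) ≡ ∑ n f
sum-upTo zero    f = refl
sum-upTo (suc n) f = begin
  sum (map f (upTo (suc n))) ≡⟨ cong (sum ∘ map f) (upTo-∷ʳ n) ⟨
  sum (map f (upTo n ++ n ∷ [])) ≡⟨ cong sum (map-++ f (upTo n) (n ∷ [])) ⟩
  sum (map f (upTo n) ++ f n ∷ []) ≡⟨ sum-++ (map f (upTo n)) (f n ∷ []) ⟩
  sum (map f (upTo n)) + (f n + 0) ≡⟨ cong₂ _+_ (sum-upTo n f) (+-identityʳ (f n)) ⟩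
  ∑ n f + f n ∎
  where open ≡-Reasoning

sum-const : ∀ (xs : List A) c → sum (map (λ _ → c) xs) ≡ length xs * c
sum-const []       c = refl
sum-const (x ∷ xs) c = cong (c +_) (sum-const xs c)

sum-+ : ∀ (f g : A → ℕ) xs → sum (map (λ x → f x + g x) xs) ≡ sum (map f xs) + sum (map g xs)
sum-+ f g []       = refl
sum-+ f g (x ∷ xs) = trans (cong (f x + g x +_) (sum-+ f g xs)) (lem (f x) (g x) (sum (map f xs)) (sum (map g xs)))
  where
  lem : ∀ a b c d → a + b + (c + d) ≡ a + c + (b + d)
  lem = solve-∀

-- In the induction the constant a takes up the comparisons already spent on earlier insertions.
outcomes-sum : ∀ is pos a d → sum (map (λ o → a + d * proj₂ o) (outcomes is pos)) ≡ a * ways is pos + d * totalCost is pos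
outcomes-sum []       pos a d = lem a d
  where
  lem : ∀ a d → a + d * 0 + 0 ≡ a * 1 + d * 0
  lem = solve-∀
outcomes-sum (i ∷ is) pos a d = begin
  sum (map (λ o → a + d * proj₂ o) (outcomes (i ∷ is) pos))
    ≡⟨ sum-concatMap (λ o → a + d * proj₂ o) (λ p → map (λ (ps , c) → p ∷ ps , e p + c) (outcomes is (bump p ∘ pos))) (upTo n) ⟩
  sum (map (λ p → sum (map (λ o → a + d * proj₂ o) (map (λ (ps , c) → p ∷ ps , e p + c) (outcomes is (bump p ∘ pos))))) (upTo n))
    ≡⟨ sum-upTo n _ ⟩
  ∑ n (λ p → sum (map (λ o → a + d * proj₂ o) (map (λ (ps , c) → p ∷ ps , e p + c) (outcomes is (bump p ∘ pos)))))
    ≡⟨ ∑-cong n (λ {p} _ → trans (cong sum (sym (map-∘ (outcomes is (bump p ∘ pos)))))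
         (trans (cong sum (map-cong (λ o → regroup a d (e p) (proj₂ o)) (outcomes is (bump p ∘ pos))))
           (trans (outcomes-sum is (bump p ∘ pos) (a + d * e p) d) (lem a d (e p) (w p) (c p))))) ⟩
  ∑ n (λ p → a * w p + d * (e p * w p + c p))
    ≡⟨ trans (∑-+ n _ _) (cong₂ _+_ (∑-*ˡ n a w) (∑-*ˡ n d (λ p → e p * w p + c p))) ⟩
  a * ways (i ∷ is) pos + d * totalCost (i ∷ is) pos ∎
  where
  open ≡-Reasoning
  n = suc (pos i)
  e = depth (pos i) (pos i)
  w = λ p → ways is (bump p ∘ pos)
  c = λ p → totalCost is (bump p ∘ pos)
  regroup : ∀ a d e c → a + d * (e + c) ≡ a + d * e + d * c
  regroup = solve-∀
  lem : ∀ a d e w c → (a + d * e) * w + d * c ≡ a * w + d * (e * w + c)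
  lem = solve-∀

data Built {A : Set} : List ℕ → List A → List A → List A → Set where
  done   : ∀ {xs} → Built [] [] xs xs
  insert : ∀ {p ps b bs} ls rs {zs} → length ls ≡ p → Built ps bs (ls ++ b ∷ rs) zs → Built (p ∷ ps) (b ∷ bs) (ls ++ rs) zs

∷-middle-injective : ∀ (ls ls′ : List A) {rs rs′ b b′} → length ls ≡ length ls′ → ls ++ b ∷ rs ≡ ls′ ++ b′ ∷ rs′ →
                     ls ++ rs ≡ ls′ ++ rs′ × b ≡ b′
∷-middle-injective []       []         _   refl = refl , refl
∷-middle-injective (x ∷ ls) (x′ ∷ ls′) len eq with refl , eq′ ← ∷-injective eq
  with e , b≡ ← ∷-middle-injective ls ls′ (suc-injective len) eq′ = cong (x ∷_) e , b≡

-- The insertions can be undone from the last to the first, since the positions tell which element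
-- to remove.
Built-injective : ∀ {ps} {bs bs′ xs xs′ zs : List A} → Built ps bs xs zs → Built ps bs′ xs′ zs → bs ≡ bs′ × xs ≡ xs′
Built-injective done done = refl , refl
Built-injective (insert ls rs len h) (insert ls′ rs′ len′ h′)
  with refl , eq ← Built-injective h h′
  with eq′ , refl ← ∷-middle-injective ls ls′ (trans len (sym len′)) eq = refl , eq′

Built-↭ : ∀ {ps} {bs xs zs : List A} → Built ps bs xs zs → zs ↭ bs ++ xs
Built-↭ done = ↭-refl
Built-↭ {bs = b ∷ bs} (insert ls rs {zs} _ h) = begin
  zs ↭⟨ Built-↭ h ⟩
  bs ++ ls ++ b ∷ rs ↭⟨ ↭.++⁺ˡ bs (↭.shift b ls rs) ⟩
  bs ++ b ∷ ls ++ rs ↭⟨ ↭.shift b bs (ls ++ rs) ⟩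
  b ∷ bs ++ ls ++ rs ∎
  where open PermutationReasoning

All-insert : ∀ {P : A → Set} ls {x rs} → P x → All P (ls ++ rs) → All P (ls ++ x ∷ rs)
All-insert ls px h = All.++⁺ (All.++⁻ˡ ls h) (px ∷ All.++⁻ʳ ls h)

>>=-≡ : ∀ {x : Counted A} (f : A → Counted B) {m a n b} → x ≡ (m , a) → f a ≡ (n , b) → (x >>= f) ≡ (m + n , b)
>>=-≡ f refl refl = refl

module _ (key : A → ℕ) where

  -- The cost of an insertion depends on the chain only through the position of the label and the
  -- place found, and `labelPosition-insert` keeps the former in step with `bump`. So every actual
  -- run occurs among the abstract outcomes.
  insertAll-run : ∀ L chain → Ascending (entryKey key) chain →
    All (λ (i , b) → All (λ e → entryKey key e ≢ key b) chain) L →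
    AllPairs (λ x y → key (proj₂ x) ≢ key (proj₂ y)) L →
    All (λ (i , b) → Bounded key i b chain) L →
    ∃[ ps ] ∃[ c ] ∃[ final ]
      (ps , c) ∈ outcomes (map proj₁ L) (λ j → labelPosition j chain) ×
      insertAll (compareBy key) L chain ≡ (c , final) × Ascending (entryKey key) final ×
      Built ps (map proj₂ L) (map proj₁ chain) (map proj₁ final)
  insertAll-run []            chain asc _             _               _         = [] , 0 , chain , here refl , refl , asc , done
  insertAll-run ((i , b) ∷ L) chain asc (fresh ∷ fr) (distinct ∷ ds) (bnd ∷ bs)
    with ls , rs , refl , p≤ , asc′ , eq ← insertBelow-split key i b chain asc fresh bnd
    with ps , c , final , mem , run , ascᶠ , built ← insertAll-run L (ls ++ (b , nothing) ∷ rs) asc′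
           (All.zipWith (λ (ne , h) → All-insert ls ne h) (distinct , fr)) ds
           (All.map (λ h → All-insert ls (λ ()) h) bs)
    = length ls ∷ ps , _ , final
    , ∈-concatMap⁺ (λ p → map (λ (ps , c) → p ∷ ps , depth q q p + c) (outcomes (map proj₁ L) (bump p ∘ pos))) (lose (∈-upTo⁺ (s≤s p≤))
        (∈-map⁺ (λ (ps , c) → length ls ∷ ps , depth q q (length ls) + c)
          (subst (_ ∈_) (outcomes-cong (map proj₁ L) (All.universal (λ j → labelPosition-insert j b ls rs) (map proj₁ L))) mem)))
    , >>=-≡ (insertAll (compareBy key) L) eq run , ascᶠ
    , subst (λ xs → Built _ _ xs _) (sym (map-++ proj₁ ls rs))
        (insert (map proj₁ ls) (map proj₁ rs) (length-map proj₁ ls) (subst (λ xs → Built ps (map proj₂ L) xs (map proj₁ final)) (map-++ proj₁ ls ((b , nothing) ∷ rs)) built))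
    where
    pos = λ j → labelPosition j (ls ++ rs)
    q = pos i

-- The order of insertion

-- Equality would give 2 t (k + 1) = 2^(k + 2) = 2 t k + 2 t (k + 1) and thus t k = 0. The index is
-- shifted because t 0 = t 1 = 1.
t-strict : ∀ k → t (suc k) < t (2 + k)
t-strict k = ≤∧≢⇒< (t-mono (suc k)) λ eq → <⇒≢ (t≥1 k) (sym (m+n≡0⇒m≡0 (t k)
  (sym (+-cancelʳ-≡ (t (suc k) + t (suc k)) 0 (t k + t k) (begin
    t (suc k) + t (suc k) ≡⟨ cong (t (suc k) +_) eq ⟩
    t (suc k) + t (2 + k) ≡⟨ t-sum (suc k) ⟩
    2 ^ (2 + k) ≡⟨ cong (2 *_) (t-sum k) ⟨
    2 * (t k + t (suc k)) ≡⟨ l (t k) (t (suc k)) ⟩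
    t k + t k + (t (suc k) + t (suc k)) ∎)))))
  where
  open ≡-Reasoning
  l : ∀ x y → 2 * (x + y) ≡ x + x + (y + y)
  l = solve-∀

-- The last group is that with index K + 1, and suc r of its elements exist. `K≤t` guarantees that
-- the groups enumerated by `insertionSequence` extend as far as this one.
record Level (u : ℕ) : Set where
  constructor level
  field
    K r    : ℕ
    1≤K    : 1 ≤ K
    K≤t    : K ≤ t K
    within : t K + suc r ≤ t (suc K)
    index  : t K + suc r ≡ u

findLevel : ∀ v → Level (2 + v)
findLevel zero    = level 1 0 (s≤s z≤n) (s≤s z≤n) (s≤s (s≤s z≤n)) refl
findLevel (suc v) with findLevel v
... | level (suc K) r 1≤K K≤t within index with t (suc K) + suc (suc r) ≤? t (2 + K)
...   | yes fits = level (suc K) (suc r) 1≤K K≤t fits (trans (+-suc (t (suc K)) (suc r)) (cong suc index))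
...   | no  full = level (2 + K) 0 (s≤s z≤n) (≤-trans (s≤s K≤t) (t-strict K))
        (subst (_≤ t (3 + K)) (+-comm 1 (t (2 + K))) (t-strict (suc K)))
        (trans (+-comm (t (2 + K)) 1) (cong suc (trans (≤-antisym (s≤s⁻¹ (≤-trans (≰⇒> full) (≤-reflexive (+-suc (t (suc K)) (suc r))))) within) index)))

group-descending : ∀ k → group (suc k) ≡ descending (t k) (t (suc k) ∸ t k)
group-descending k = trans (reverse-applyUpTo (λ j → suc (t k + j)) (t (suc k) ∸ t k)) (down (t (suc k) ∸ t k))
  where
  down : ∀ r → applyDownFrom (λ j → suc (t k + j)) r ≡ descending (t k) r
  down zero    = refl
  down (suc r) = cong₂ _∷_ (sym (+-suc (t k) r)) (down r)

fullGroups-concatMap : ∀ v → concatMap (λ j → group (2 + j)) (upTo v) ≡ fullGroups (suc v)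
-- `fullGroups` also contains group 1, which is empty.
fullGroups-concatMap zero    = refl
fullGroups-concatMap (suc v) = begin
  concatMap g (upTo (suc v)) ≡⟨ cong (concatMap g) (upTo-∷ʳ v) ⟨
  concatMap g (upTo v ∷ʳ v) ≡⟨ concatMap-++ g (upTo v) (v ∷ []) ⟩
  concatMap g (upTo v) ++ g v ++ [] ≡⟨ cong₂ _++_ (fullGroups-concatMap v) (trans (++-identityʳ (g v)) (group-descending (suc v))) ⟩
  fullGroups (suc (suc v)) ∎
  where
  open ≡-Reasoning
  g = λ j → group (2 + j)

fullGroups-extend : ∀ K e → ∃[ rest ] fullGroups (e + K) ≡ fullGroups K ++ rest × All (t K <_) rest
fullGroups-extend K zero    = [] , sym (++-identityʳ (fullGroups K)) , []
fullGroups-extend K (suc e) with rest , eq , above ← fullGroups-extend K e =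
  rest ++ new , trans (cong (_++ new) eq) (++-assoc (fullGroups K) rest new) ,
  All.++⁺ above (descending-All (t (e + K)) _ (λ l _ → ≤-trans (s≤s (t-mono* e)) (≤-trans (s≤s (m≤m+n (t (e + K)) l)) (≤-reflexive (sym (+-suc (t (e + K)) l))))))
  where
  new = descending (t (e + K)) (t (suc (e + K)) ∸ t (e + K))
  t-mono* : ∀ e → t K ≤ t (e + K)
  t-mono* zero    = ≤-refl
  t-mono* (suc e) = ≤-trans (t-mono* e) (t-mono (e + K))

descending-++ : ∀ s r e → descending s (e + r) ≡ descending (s + r) e ++ descending s r
descending-++ s r zero    = refl
descending-++ s r (suc e) = cong₂ _∷_ (l s r e) (descending-++ s r e)
  where
  l : ∀ s r e → s + suc (e + r) ≡ s + r + suc e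
  l = solve-∀

-- The default d is irrelevant for 1 ≤ i ≤ length bs.
get : A → List A → ℕ → A
get d bs i = Maybe.fromMaybe d (head (drop (i ∸ 1) bs))

select : List A → ℕ → Maybe (ℕ × A)
select bs i = Maybe.map (i ,_) (head (drop (i ∸ 1) bs))

head-drop-just : ∀ (d : A) bs j → j < length bs → head (drop j bs) ≡ just (Maybe.fromMaybe d (head (drop j bs)))
head-drop-just d (b ∷ bs) zero    _       = refl
head-drop-just d (b ∷ bs) (suc j) (s≤s h) = head-drop-just d bs j h

head-drop-nothing : ∀ (bs : List A) j → length bs ≤ j → head (drop j bs) ≡ nothing
head-drop-nothing []       zero    _       = refl
head-drop-nothing []       (suc j) _       = refl
head-drop-nothing (b ∷ bs) (suc j) (s≤s h) = head-drop-nothing bs j h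

mapMaybe-select : ∀ (d : A) bs is → All (λ i → 1 ≤ i × i ≤ length bs) is → mapMaybe (select bs) is ≡ map (λ i → i , get d bs i) is
mapMaybe-select d bs []           []             = refl
mapMaybe-select d bs (suc i ∷ is) ((_ , i≤) ∷ h) rewrite head-drop-just d bs i i≤ = cong (_ ∷_) (mapMaybe-select d bs is h)

mapMaybe-skip : ∀ (bs : List A) is → All (λ i → length bs < i) is → mapMaybe (select bs) is ≡ []
mapMaybe-skip bs []           []             = refl
mapMaybe-skip bs (suc i ∷ is) ((s≤s i≥) ∷ h) rewrite head-drop-nothing bs i i≥ = mapMaybe-skip bs is h

fullGroups-≥1 : ∀ K → All (1 ≤_) (fullGroups K)
fullGroups-≥1 zero    = []
fullGroups-≥1 (suc K) = All.++⁺ (fullGroups-≥1 K) (descending-All (t K) _ (λ l _ → ≤-trans (t≥1 K) (m≤m+n (t K) (suc l))))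

insertionOrder : ℕ → List ℕ
insertionOrder zero          = []
insertionOrder (suc zero)    = []
insertionOrder (suc (suc v)) = let open Level (findLevel v) in order K (suc r)

-- The enumerated indices that exceed the number of elements are the upper end `high` of the last
-- group and the groups after it, `rest`; exactly these are skipped.
insertionSequence-order : ∀ (d : A) bs → insertionSequence bs ≡ map (λ i → i , get d bs i) (insertionOrder (length bs))
insertionSequence-order d []           = refl
insertionSequence-order d (b ∷ [])     = mapMaybe-skip (b ∷ []) (group 2 ++ []) (s≤s (s≤s z≤n) ∷ s≤s (s≤s z≤n) ∷ [])
insertionSequence-order d bs@(b₁ ∷ b₂ ∷ bs′) = begin
  mapMaybe (select bs) (concatMap (λ j → group (2 + j)) (upTo u))
    ≡⟨ cong (mapMaybe (select bs)) (trans (fullGroups-concatMap u) (trans (cong fullGroups u≡) eq)) ⟩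
  mapMaybe (select bs) (((fullGroups K ++ descending (t K) R)) ++ rest)
    ≡⟨ cong (λ l → mapMaybe (select bs) ((fullGroups K ++ l) ++ rest)) (trans (cong (descending (t K)) (sym (m∸n+n≡m r<R))) (descending-++ (t K) (suc r) (R ∸ suc r))) ⟩
  mapMaybe (select bs) ((fullGroups K ++ high ++ low) ++ rest)
    ≡⟨ trans (mapMaybe-++ (select bs) (fullGroups K ++ high ++ low) rest)
         (cong₂ _++_ (trans (mapMaybe-++ (select bs) (fullGroups K) (high ++ low)) (cong (mapMaybe (select bs) (fullGroups K) ++_) (mapMaybe-++ (select bs) high low)))
                     (mapMaybe-skip bs rest (All.map (≤-trans (s≤s u≤)) above))) ⟩
  (mapMaybe (select bs) (fullGroups K) ++ mapMaybe (select bs) high ++ mapMaybe (select bs) low) ++ []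
    ≡⟨ ++-identityʳ _ ⟩
  mapMaybe (select bs) (fullGroups K) ++ mapMaybe (select bs) high ++ mapMaybe (select bs) low
    ≡⟨ cong₂ (λ x y → x ++ y ++ mapMaybe (select bs) low)
         (mapMaybe-select d bs (fullGroups K) (All.zipWith id (fullGroups-≥1 K , All.map (λ h → ≤-trans h (≤-trans (m≤m+n (t K) (suc r)) (≤-reflexive index))) (fullGroups-≤ K))))
         (mapMaybe-skip bs high (descending-All (t K + suc r) _ (λ l _ → ≤-trans (s≤s (≤-reflexive (sym index))) (≤-trans (s≤s (m≤m+n _ l)) (≤-reflexive (sym (+-suc _ l))))))) ⟩
  map pick (fullGroups K) ++ mapMaybe (select bs) low
    ≡⟨ cong (map pick (fullGroups K) ++_) (mapMaybe-select d bs low (descending-All (t K) (suc r) (λ l l< → ≤-trans (t≥1 K) (m≤m+n (t K) (suc l)) , ≤-trans (+-monoʳ-≤ (t K) l<) (≤-reflexive index)))) ⟩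
  map pick (fullGroups K) ++ map pick low
    ≡⟨ map-++ pick (fullGroups K) low ⟨
  map pick (order K (suc r)) ∎
  where
  open ≡-Reasoning
  open Level (findLevel (length bs′))
  u = length bs
  pick = λ i → i , get d bs i
  R = t (suc K) ∸ t K
  high = descending (t K + suc r) (R ∸ suc r)
  low = descending (t K) (suc r)
  r<R : suc r ≤ R
  r<R = +-cancelˡ-≤ (t K) _ _ (≤-trans within (≤-reflexive (sym (m+[n∸m]≡n (t-mono K)))))
  K≤u : K ≤ u
  K≤u = ≤-trans K≤t (≤-trans (m≤m+n (t K) (suc r)) (≤-reflexive index))
  u≡ : suc u ≡ (u ∸ K) + suc K
  u≡ = sym (trans (+-suc (u ∸ K) K) (cong suc (m∸n+n≡m K≤u)))
  u≤ : u ≤ t (suc K)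
  u≤ = ≤-trans (≤-reflexive (sym index)) within
  extension = fullGroups-extend (suc K) (u ∸ K)
  rest = proj₁ extension
  eq = proj₁ (proj₂ extension)
  above = proj₂ (proj₂ extension)

applyUpTo-++ : ∀ (f : ℕ → A) m n → applyUpTo f (m + n) ≡ applyUpTo f m ++ applyUpTo (λ j → f (m + j)) n
applyUpTo-++ f zero    n = refl
applyUpTo-++ f (suc m) n = cong (f 0 ∷_) (applyUpTo-++ (f ∘ suc) m n)

descending-↭ : ∀ s r → descending s r ↭ applyUpTo (λ j → suc (s + j)) r
descending-↭ s zero    = ↭-refl
descending-↭ s (suc r) = ↭-trans (prep (s + suc r) (descending-↭ s r)) (↭-trans (↭.∷↭∷ʳ (s + suc r) _)
  (↭-reflexive (trans (cong (applyUpTo (λ j → suc (s + j)) r ∷ʳ_) (+-suc s r)) (applyUpTo-∷ʳ (λ j → suc (s + j)) r))))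

range-++ : ∀ {s r} → 1 ≤ s → applyUpTo (2 +_) (s ∸ 1) ++ applyUpTo (λ j → suc (s + j)) r ≡ applyUpTo (2 +_) (s + r ∸ 1)
range-++ {suc s} {r} _ = sym (applyUpTo-++ (2 +_) s r)

fullGroups-↭ : ∀ K → fullGroups K ↭ applyUpTo (2 +_) (t K ∸ 1)
fullGroups-↭ zero    = ↭-refl
fullGroups-↭ (suc K) = ↭-trans (↭.++⁺ (fullGroups-↭ K) (descending-↭ (t K) _))
  (↭-reflexive (trans (range-++ {r = t (suc K) ∸ t K} (t≥1 K)) (cong (λ x → applyUpTo (2 +_) (x ∸ 1)) (m+[n∸m]≡n (t-mono K)))))

insertionOrder-↭ : ∀ u → insertionOrder u ↭ applyUpTo (2 +_) (u ∸ 1)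
insertionOrder-↭ zero          = ↭-refl
insertionOrder-↭ (suc zero)    = ↭-refl
insertionOrder-↭ (suc (suc v)) = ↭-trans (↭.++⁺ (fullGroups-↭ K) (descending-↭ (t K) (suc r)))
  (↭-reflexive (trans (range-++ {r = suc r} (t≥1 K)) (cong (λ x → applyUpTo (2 +_) (x ∸ 1)) index)))
  where open Level (findLevel v)

-- Correctness of the insertion of all elements

module _ (key : A → ℕ) where

  Distinct : List A → Set
  Distinct = AllPairs (λ x y → key x ≢ key y)

  Distinct-resp-↭ : ∀ {xs ys} → xs ↭ ys → Distinct xs → Distinct ys
  Distinct-resp-↭ _↭_.refl       d                     = d
  Distinct-resp-↭ (prep x p)     (x≢ ∷ d)              = ↭.All-resp-↭ p x≢ ∷ Distinct-resp-↭ p d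
  Distinct-resp-↭ (swap x y p)   ((x≢y ∷ x≢) ∷ y≢ ∷ d) = ((x≢y ∘ sym) ∷ ↭.All-resp-↭ p y≢) ∷ ↭.All-resp-↭ p x≢ ∷ Distinct-resp-↭ p d
  Distinct-resp-↭ (_↭_.trans p q) d                    = Distinct-resp-↭ q (Distinct-resp-↭ p d)

AllPairs-cross : ∀ {R : A → A → Set} xs {ys} → AllPairs R (xs ++ ys) → All (λ x → All (R x) ys) xs
AllPairs-cross []       _       = []
AllPairs-cross (x ∷ xs) (r ∷ h) = All.++⁻ʳ xs r ∷ AllPairs-cross xs h

labelled : List A → (ℕ → ℕ) → List (Entry A)
labelled as f = zip as (map just (applyUpTo f (length as)))

map-proj₁-labelled : ∀ (as : List A) f → map proj₁ (labelled as f) ≡ as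
map-proj₁-labelled []       f = refl
map-proj₁-labelled (a ∷ as) f = cong (a ∷_) (map-proj₁-labelled as (f ∘ suc))

-- The case i = length as is that of the unpaired element: its label is absent, and the whole chain
-- is searched.
labelled-position : ∀ (as : List A) f → (∀ {i j} → f i ≡ f j → i ≡ j) → ∀ i → i ≤ length as → labelPosition (f i) (labelled as f) ≡ i
labelled-position []       f inj zero    _       = refl
labelled-position (a ∷ as) f inj zero    _       with f 0 ≡ᵇ f 0 | ≡⇒≡ᵇ (f 0) (f 0) refl
... | true | _ = refl
labelled-position (a ∷ as) f inj (suc i) (s≤s i≤) with f 0 ≡ᵇ f (suc i) | ≡ᵇ⇒≡ (f 0) (f (suc i))
... | true  | eq with () ← inj (eq tt)
... | false | _  = cong suc (labelled-position as (f ∘ suc) (suc-injective ∘ inj) i i≤)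

applyUpTo-drop : ∀ (d : A) xs ys → applyUpTo (λ j → Maybe.fromMaybe d (head (drop j (xs ++ ys)))) (length xs) ≡ xs
applyUpTo-drop d []       ys = refl
applyUpTo-drop d (x ∷ xs) ys = cong (x ∷_) (applyUpTo-drop d xs ys)

get-tail : ∀ (d : A) x xs → map (get d (x ∷ xs)) (applyUpTo (2 +_) (length xs)) ≡ xs
get-tail d x xs = trans (map-applyUpTo (2 +_) (get d (x ∷ xs)) (length xs))
  (subst (λ l → applyUpTo (λ j → Maybe.fromMaybe d (head (drop j l))) (length xs) ≡ xs) (++-identityʳ xs) (applyUpTo-drop d xs []))

module _ (key : A → ℕ) where

  Oriented : List (A × A) → Set
  Oriented = All (λ (a , b) → key b < key a)

  labelled-bounded : ∀ ss (f : ℕ → ℕ) (g : ℕ → A) → applyUpTo (g ∘ f) (length ss) ≡ map proj₂ ss → Oriented ss →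
                     All (λ e → ∀ i → proj₂ e ≡ just i → key (g i) < key (proj₁ e)) (labelled (map proj₁ ss) f)
  labelled-bounded []             f g eq []       = []
  labelled-bounded ((a , b) ∷ ss) f g eq (lt ∷ o) =
    (λ { i refl → subst (λ x → key x < key a) (sym (∷-injectiveˡ eq)) lt }) ∷ labelled-bounded ss (f ∘ suc) g (∷-injectiveʳ eq) o

  smaller : List (A × A) → Maybe A → List A
  smaller ss rest = map proj₂ ss ++ fromMaybe rest

  initialChain : List (A × A) → Maybe A → List (Entry A)
  initialChain ss rest = map (_, nothing) (take 1 (smaller ss rest)) ++ labelled (map proj₁ ss) suc

  length-fromMaybe : ∀ (rest : Maybe A) → length (fromMaybe rest) ≤ 1
  length-fromMaybe nothing  = z≤n
  length-fromMaybe (just _) = s≤s z≤n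

  module _ (a₁ b₁ : A) (ss′ : List (A × A)) (rest : Maybe A) where
    private
      ss = (a₁ , b₁) ∷ ss′
      bs = smaller ss rest
      bs′ = smaller ss′ rest
      as = map proj₁ ss
      u = length bs

    picked : List A
    picked = map (get b₁ bs) (insertionOrder u)

    picked-↭ : picked ↭ bs′
    picked-↭ = ↭-trans (↭.map⁺ (get b₁ bs) (insertionOrder-↭ u)) (↭-reflexive (get-tail b₁ b₁ bs′))

    module _ (asc : Ascending (key ∘ proj₁) ss) (oriented : Oriented ss) (distinct : Distinct key (bs ++ as)) where
      private
        L = map (λ i → i , get b₁ bs i) (insertionOrder u)
        chain = initialChain ss rest
        indices : map proj₁ L ≡ insertionOrder u
        indices = trans (sym (map-∘ (insertionOrder u))) (map-id (insertionOrder u))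
        elements : map proj₂ L ≡ picked
        elements = sym (map-∘ (insertionOrder u))
        chain-elements : map proj₁ chain ≡ b₁ ∷ as
        chain-elements = cong (b₁ ∷_) (map-proj₁-labelled as suc)
        asc₀ : Ascending (entryKey key) chain
        asc₀ = AllPairs.map⁻ (subst (Ascending key) (sym chain-elements)
          ((All.head oriented ∷ All.map (<-trans (All.head oriented)) (AllPairs.head ascᵃ)) ∷ ascᵃ))
          where
          ascᵃ : Ascending key as
          ascᵃ = AllPairs.map⁺ asc
        all-distinct : Distinct key (picked ++ b₁ ∷ as)
        all-distinct = Distinct-resp-↭ key (begin
          b₁ ∷ bs′ ++ as ↭⟨ ↭.shift b₁ bs′ as ⟨
          bs′ ++ b₁ ∷ as ↭⟨ ↭.++⁺ʳ (b₁ ∷ as) picked-↭ ⟨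
          picked ++ b₁ ∷ as ∎) distinct
          where open PermutationReasoning
        fresh : All (λ (i , b) → All (λ e → entryKey key e ≢ key b) chain) L
        fresh = All.map⁻ (subst (All (λ b → All (λ e → entryKey key e ≢ key b) chain)) (sym elements)
          (All.map (λ h → All.map⁻ (subst (All _) (sym chain-elements) (All.map (λ ne → ne ∘ sym) h))) (AllPairs-cross picked all-distinct)))
        distinctL : AllPairs (λ x y → key (proj₂ x) ≢ key (proj₂ y)) L
        distinctL = AllPairs.map⁻ (subst (Distinct key) (sym elements) (proj₁ (AllPairs-++⁻ picked all-distinct)))
        bounded : All (λ (i , b) → Bounded key i b chain) L
        bounded = All.map⁺ (All.universal (λ i → (λ ()) ∷ All.map (λ h → h i) all-bounded) (insertionOrder u))
          where
          all-bounded = labelled-bounded ss suc (get b₁ bs) (trans (cong (applyUpTo (get b₁ bs ∘ suc)) (sym (length-map proj₂ ss))) (applyUpTo-drop b₁ (map proj₂ ss) (fromMaybe rest))) oriented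
        -- With b₁ in front, a with label j has position j, so that the initial bounds are given by
        -- `id`.
        positions : All (λ j → labelPosition j chain ≡ j) (insertionOrder u)
        positions = ↭.All-resp-↭ (↭-sym (insertionOrder-↭ u)) (All.applyUpTo⁺₁ (2 +_) (u ∸ 1) λ {i} i< →
          cong suc (labelled-position as suc suc-injective (suc i) (≤-trans i< (≤-trans (≤-reflexive (length-++ (map proj₂ ss′)))
            (≤-trans (+-mono-≤ (≤-reflexive (trans (length-map proj₂ ss′) (sym (length-map proj₁ ss′)))) (length-fromMaybe rest)) (≤-reflexive (+-comm _ 1)))))))

      insertion-run : ∃[ ps ] ∃[ c ] ∃[ final ]
        (ps , c) ∈ outcomes (insertionOrder u) id ×
        insertAll (compareBy key) (insertionSequence bs) (initialChain ss rest) ≡ (c , final) ×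
        Ascending (entryKey key) final ×
        Built ps picked (b₁ ∷ as) (map proj₁ final)
      insertion-run
        with ps , c , final , mem , run , ascᶠ , built ← insertAll-run key L chain asc₀ fresh distinctL bounded
        = ps , c , final
        , subst ((ps , c) ∈_) (trans (cong (λ is → outcomes is (λ j → labelPosition j chain)) indices) (outcomes-cong (insertionOrder u) positions)) mem
        , trans (cong (λ l → insertAll (compareBy key) l chain) (insertionSequence-order b₁ bs)) run
        , ascᶠ
        , subst₂ (λ x y → Built ps x y (map proj₁ final)) elements chain-elements built

-- The course of MergeInsertion

module _ (key : A → ℕ) where

  data Pairing : List A → List (A × A) → Maybe A → Set where
    none : Pairing [] [] nothing
    one  : ∀ {x} → Pairing (x ∷ []) [] (just x)
    up   : ∀ {x y zs ps r} → key x < key y → Pairing zs ps r → Pairing (x ∷ y ∷ zs) ((y , x) ∷ ps) r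
    down : ∀ {x y zs ps r} → key y < key x → Pairing zs ps r → Pairing (x ∷ y ∷ zs) ((x , y) ∷ ps) r

  pairing : ∀ xs → Distinct key xs → ∃₂ λ ps r → Pairing xs ps r
  pairing []           _                     = [] , nothing , none
  pairing (x ∷ [])     _                     = [] , just x , one
  pairing (x ∷ y ∷ zs) ((x≢y ∷ _) ∷ _ ∷ d) with ps , r , p ← pairing zs d | <-cmp (key x) (key y)
  ... | tri< x<y _ _ = _ , r , up x<y p
  ... | tri≈ _ x≡y _ = ⊥-elim (x≢y x≡y)
  ... | tri> _ _ y<x = _ , r , down y<x p

  Pairing-pairUp : ∀ {xs ps r} → Pairing xs ps r → pairUp (compareBy key) xs ≡ (⌊ length xs /2⌋ , ps , r)
  Pairing-pairUp none         = refl
  Pairing-pairUp one          = refl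
  Pairing-pairUp (up lt p)    rewrite Pairing-pairUp p | <ᵇ-true lt = cong (λ n → suc n , _) (+-identityʳ _)
  Pairing-pairUp (down lt p)  rewrite Pairing-pairUp p | <ᵇ-false (<⇒≤ lt) = cong (λ n → suc n , _) (+-identityʳ _)

  Pairing-oriented : ∀ {xs ps r} → Pairing xs ps r → Oriented key ps
  Pairing-oriented none        = []
  Pairing-oriented one         = []
  Pairing-oriented (up lt p)   = lt ∷ Pairing-oriented p
  Pairing-oriented (down lt p) = lt ∷ Pairing-oriented p

  Pairing-length : ∀ {xs ps r} → Pairing xs ps r → length ps ≡ ⌊ length xs /2⌋
  Pairing-length none        = refl
  Pairing-length one         = refl
  Pairing-length (up lt p)   = cong suc (Pairing-length p)
  Pairing-length (down lt p) = cong suc (Pairing-length p)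

  Pairing-↭ : ∀ {xs ps r} → Pairing xs ps r → xs ↭ smaller key ps r ++ map proj₁ ps
  Pairing-↭ none = ↭-refl
  Pairing-↭ one  = ↭-refl
  Pairing-↭ (up {x} {y} {ps = ps} {r} _ p)   = prep x (↭-trans (prep y (Pairing-↭ p)) (↭-sym (↭.shift y (smaller key ps r) (map proj₁ ps))))
  Pairing-↭ (down {x} {y} {ps = ps} {r} _ p) = ↭-trans (swap x y (Pairing-↭ p)) (prep y (↭-sym (↭.shift x (smaller key ps r) (map proj₁ ps))))

unpair : List (A × A) → Maybe A → List (List A)
unpair []             r = fromMaybe r ∷ []
unpair ((a , b) ∷ ps) r = map (λ zs → a ∷ b ∷ zs) (unpair ps r) ++ map (λ zs → b ∷ a ∷ zs) (unpair ps r)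

∈-unpair : ∀ (key : A → ℕ) {xs ps r} → Pairing key xs ps r → xs ∈ unpair ps r
∈-unpair key none        = here refl
∈-unpair key one         = here refl
∈-unpair key (up {ps = ps} {r} _ p) = ∈-++⁺ʳ (map _ (unpair ps r)) (∈-map⁺ _ (∈-unpair key p))
∈-unpair key (down _ p)  = ∈-++⁺ˡ (∈-map⁺ _ (∈-unpair key p))

length-unpair : ∀ (ps : List (A × A)) r → length (unpair ps r) ≡ 2 ^ length ps
length-unpair []       r = refl
length-unpair (_ ∷ ps) r = trans (length-++ (map _ (unpair ps r)))
  (cong₂ _+_ (trans (length-map _ (unpair ps r)) (length-unpair ps r))
             (trans (trans (length-map _ (unpair ps r)) (length-unpair ps r)) (sym (+-identityʳ _))))

module _ (key : A → ℕ) where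

  recursiveCost : ℕ → List (A × A) → ℕ
  recursiveCost f ps = proj₁ (mergeInsertion f (compareBy (key ∘ proj₁)) ps)

  -- What happens on the input xs: the pairs ps, sorted as (a₁ , b₁) ∷ ss, the
  -- positions at which the elements b are inserted and the number of comparisons for that.
  record Run (f : ℕ) (xs : List A) : Set where
    field
      ps        : List (A × A)
      a₁ b₁     : A
      ss        : List (A × A)
      rest      : Maybe A
      paired    : Pairing key xs ps rest
      sorted    : (a₁ , b₁) ∷ ss ↭ ps
      positions : List ℕ
      cost      : ℕ
      output    : List A
    bs = smaller key ((a₁ , b₁) ∷ ss) rest
    as = map proj₁ ((a₁ , b₁) ∷ ss)
    field
      possible  : (positions , cost) ∈ outcomes (insertionOrder (length bs)) id
      built     : Built positions (picked key a₁ b₁ ss rest) (b₁ ∷ as) output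
      result    : mergeInsertion (suc f) (compareBy key) xs ≡ (⌊ length xs /2⌋ + (recursiveCost f ps + cost) , output)
      ascending : Ascending key output

    elements-↭ : bs ++ as ↭ xs
    elements-↭ = ↭-trans (↭.++⁺ (↭.++⁺ʳ (fromMaybe rest) (↭.map⁺ proj₂ sorted)) (↭.map⁺ proj₁ sorted)) (↭-sym (Pairing-↭ key paired))

    output-↭ : output ↭ xs
    output-↭ = begin
      output ↭⟨ Built-↭ built ⟩
      picked key a₁ b₁ ss rest ++ b₁ ∷ as ↭⟨ ↭.++⁺ʳ (b₁ ∷ as) (picked-↭ key a₁ b₁ ss rest) ⟩
      smaller key ss rest ++ b₁ ∷ as ↭⟨ ↭.shift b₁ (smaller key ss rest) as ⟩
      bs ++ as ↭⟨ elements-↭ ⟩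
      xs ∎
      where open PermutationReasoning

    length-pairs : suc (length ss) ≡ ⌊ length xs /2⌋
    length-pairs = trans (↭.↭-length sorted) (Pairing-length key paired)

    length-bs : length bs + ⌊ length xs /2⌋ ≡ length xs
    length-bs = trans (cong (length bs +_) (trans (sym length-pairs) (sym (length-map proj₁ ((a₁ , b₁) ∷ ss)))))
      (trans (sym (length-++ bs)) (↭.↭-length elements-↭))

  merge-result : ∀ f {xs ps r c ss cᵢ final} → Pairing key xs ps r →
    mergeInsertion f (compareBy (key ∘ proj₁)) ps ≡ (c , ss) →
    insertAll (compareBy key) (insertionSequence (smaller key ss r)) (initialChain key ss r) ≡ (cᵢ , final) →
    mergeInsertion (suc f) (compareBy key) xs ≡ (⌊ length xs /2⌋ + (c + cᵢ) , map proj₁ final)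
  merge-result f {xs} {c = c} {cᵢ = cᵢ} {final} p eq run rewrite Pairing-pairUp key p | eq | run =
    cong (λ x → ⌊ length xs /2⌋ + (c + x) , map proj₁ final) (+-identityʳ cᵢ)

  makeRun : ∀ f xs → 2 ≤ length xs → Distinct key xs → ∀ {ps r} → Pairing key xs ps r →
            Ascending (key ∘ proj₁) (proj₂ (mergeInsertion f (compareBy (key ∘ proj₁)) ps)) ×
            proj₂ (mergeInsertion f (compareBy (key ∘ proj₁)) ps) ↭ ps → Run f xs
  makeRun f xs 2≤n distinct {ps} {r} p (asc , sorted) with mergeInsertion f (compareBy (key ∘ proj₁)) ps in eq
  ... | c , [] with () ← ≤-trans (⌊n/2⌋-mono 2≤n) (≤-reflexive (trans (sym (Pairing-length key p)) (sym (↭.↭-length sorted))))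
  ... | c , (a₁ , b₁) ∷ ss
    with positions , cost , final , possible , run , ascᶠ , built ← insertion-run key a₁ b₁ ss r asc
           (↭.All-resp-↭ (↭-sym sorted) (Pairing-oriented key p))
           (Distinct-resp-↭ key (↭-trans (Pairing-↭ key p) (↭-sym (↭.++⁺ (↭.++⁺ʳ (fromMaybe r) (↭.map⁺ proj₂ sorted)) (↭.map⁺ proj₁ sorted)))) distinct)
    = record
      { ps = ps ; a₁ = a₁ ; b₁ = b₁ ; ss = ss ; rest = r ; paired = p ; sorted = sorted
      ; positions = positions ; cost = cost ; output = map proj₁ final ; possible = possible ; built = built
      ; result = trans (merge-result f p eq run) (cong (λ x → ⌊ length xs /2⌋ + (x + cost) , map proj₁ final) (sym (cong proj₁ eq)))
      ; ascending = AllPairs.map⁺ ascᶠ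
      }

mergeInsertion-[] : ∀ f (_≺_ : Compare A) → mergeInsertion f _≺_ [] ≡ (0 , [])
mergeInsertion-[] zero    _≺_ = refl
mergeInsertion-[] {A} (suc f) _≺_ rewrite mergeInsertion-[] {A × A} f (_≺_ on proj₁) = refl

mergeInsertion-[x] : ∀ f (_≺_ : Compare A) x → mergeInsertion (suc f) _≺_ (x ∷ []) ≡ (0 , x ∷ [])
mergeInsertion-[x] {A} f _≺_ x rewrite mergeInsertion-[] {A × A} f (_≺_ on proj₁) = refl

sorts-≡ : ∀ f (key : A → ℕ) {xs ys c} → mergeInsertion f (compareBy key) xs ≡ (c , ys) → Ascending key ys → ys ↭ xs →
          Ascending key (proj₂ (mergeInsertion f (compareBy key) xs)) × proj₂ (mergeInsertion f (compareBy key) xs) ↭ xs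
sorts-≡ f key {xs} eq asc p = subst (Ascending key) (sym (cong proj₂ eq)) asc , subst (_↭ xs) (sym (cong proj₂ eq)) p

-- General in the element type and the key, since the recursive call sorts pairs by the key of the
-- first component.
mergeInsertion-sorts : ∀ f (key : A → ℕ) xs → length xs ≤ f → Distinct key xs →
  Ascending key (proj₂ (mergeInsertion f (compareBy key) xs)) × proj₂ (mergeInsertion f (compareBy key) xs) ↭ xs

run : ∀ f (key : A → ℕ) xs → length xs ≤ suc f → 2 ≤ length xs → Distinct key xs → Run key f xs

pairs-sorted : ∀ f (key : A → ℕ) xs → length xs ≤ suc f → 2 ≤ length xs → Distinct key xs → ∀ {ps r} → Pairing key xs ps r →
  Ascending (key ∘ proj₁) (proj₂ (mergeInsertion f (compareBy (key ∘ proj₁)) ps)) × proj₂ (mergeInsertion f (compareBy (key ∘ proj₁)) ps) ↭ ps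
pairs-sorted f key xs len 2≤ distinct {ps} {r} p = mergeInsertion-sorts f (key ∘ proj₁) ps
  (≤-trans (≤-reflexive (Pairing-length key p)) (s≤s⁻¹ (≤-trans (shrink 2≤) len)))
  (AllPairs.map⁻ (proj₂ (AllPairs-++⁻ (smaller key ps r) (Distinct-resp-↭ key (Pairing-↭ key p) distinct))))
  where
  shrink : ∀ {n} → 2 ≤ n → ⌊ n /2⌋ < n
  shrink {suc n} _ = ⌊n/2⌋<n n

run f key xs len 2≤ distinct with ps , r , p ← pairing key xs distinct =
  makeRun key f xs 2≤ distinct p (pairs-sorted f key xs len 2≤ distinct p)

mergeInsertion-sorts zero    key []           _   _ = [] , ↭-refl
mergeInsertion-sorts (suc f) key []           _   _ = sorts-≡ (suc f) key (mergeInsertion-[] (suc f) (compareBy key)) [] ↭-refl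
mergeInsertion-sorts (suc f) key (x ∷ [])     _   _ = sorts-≡ (suc f) key (mergeInsertion-[x] f (compareBy key) x) ([] ∷ []) ↭-refl
mergeInsertion-sorts (suc f) key xs@(x ∷ y ∷ zs) len d = sorts-≡ (suc f) key result ascending output-↭
  where open Run (run f key xs len (s≤s (s≤s z≤n)) d)

-- Counting inputs

sum-⊆ : ∀ (g : A → ℕ) {xs} ys → Unique xs → All (_∈ ys) xs → sum (map g xs) ≤ sum (map g ys)
sum-⊆ g ys []          []           = z≤n
sum-⊆ g {x ∷ xs} ys (x∉ ∷ uniq) (x∈ ∷ xs⊆) with ls , rs , refl ← ∈-∃++ x∈ = begin
  g x + sum (map g xs) ≤⟨ +-monoʳ-≤ (g x) (sum-⊆ g (ls ++ rs) uniq (All.zipWith (uncurry elsewhere) (x∉ , xs⊆))) ⟩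
  g x + sum (map g (ls ++ rs)) ≡⟨ sum-↭ (↭.map⁺ g (↭.shift x ls rs)) ⟨
  sum (map g (ls ++ x ∷ rs)) ∎
  where
  open ≤-Reasoning
  elsewhere : ∀ {x y} {ls rs : List _} → x ≢ y → y ∈ ls ++ x ∷ rs → y ∈ ls ++ rs
  elsewhere {ls = ls} x≢y y∈ with ∈-++⁻ ls y∈
  ... | inj₁ y∈ls         = ∈-++⁺ˡ y∈ls
  ... | inj₂ (here refl)  = ⊥-elim (x≢y refl)
  ... | inj₂ (there y∈rs) = ∈-++⁺ʳ ls y∈rs

sum-filter : ∀ {P : A → Set} (P? : Decidable P) (f : A → ℕ) xs →
             sum (map f xs) ≡ sum (map f (filter P? xs)) + sum (map f (filter (¬? ∘ P?) xs))
sum-filter P? f []       = refl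
sum-filter P? f (x ∷ xs) with P? x
... | yes _ = trans (cong (f x +_) (sum-filter P? f xs)) (sym (+-assoc (f x) _ _))
... | no  _ = trans (cong (f x +_) (sum-filter P? f xs)) (lem (f x) (sum (map f (filter P? xs))) (sum (map f (filter (¬? ∘ P?) xs))))
  where
  lem : ∀ a b c → a + (b + c) ≡ b + (a + c)
  lem = solve-∀

-- Distinctness is required of the labels, because the elements will be runs, which contain proofs,
-- while their inputs are known to be distinct.
fibre-sum : ∀ {C : Set} (_≟_ : DecidableEquality B) (κ : A → B) (label : A → C) (f : A → ℕ) (bound : B → ℕ) →
  (∀ q xs → Unique (map label xs) → All (λ x → κ x ≡ q) xs → sum (map f xs) ≤ bound q) →
  ∀ qs xs → Unique (map label xs) → All (λ x → κ x ∈ qs) xs → sum (map f xs) ≤ sum (map bound qs)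
fibre-sum _≟_ κ label f bound fibre []       []       _    _       = z≤n
fibre-sum _≟_ κ label f bound fibre []       (x ∷ xs) _    (() ∷ _)
fibre-sum _≟_ κ label f bound fibre (q ∷ qs) xs       uniq κ∈      = begin
  sum (map f xs) ≡⟨ sum-filter here? f xs ⟩
  sum (map f (filter here? xs)) + sum (map f (filter (¬? ∘ here?) xs)) ≤⟨ +-mono-≤
    (fibre q (filter here? xs) (AllPairs.map⁺ (AllPairs.filter⁺ here? (AllPairs.map⁻ uniq))) (All.all-filter here? xs))
    (fibre-sum _≟_ κ label f bound fibre qs (filter (¬? ∘ here?) xs) (AllPairs.map⁺ (AllPairs.filter⁺ (¬? ∘ here?) (AllPairs.map⁻ uniq)))
      (All.zipWith (uncurry later) (All.all-filter (¬? ∘ here?) xs , All.filter⁺ (¬? ∘ here?) κ∈))) ⟩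
  bound q + sum (map bound qs) ∎
  where
  open ≤-Reasoning
  here? = λ x → κ x ≟ q
  later : ∀ {x} → κ x ≢ q → κ x ∈ q ∷ qs → κ x ∈ qs
  later ne (here eq)  = ⊥-elim (ne eq)
  later ne (there ∈q) = ∈q

-- Enumeration of the permutations

insertions-↭ : ∀ (x : A) ys → All (_↭ x ∷ ys) (insertions x ys)
insertions-↭ x []       = ↭-refl ∷ []
insertions-↭ x (y ∷ ys) = ↭-refl ∷ All.map⁺ (All.map (λ p → ↭-trans (prep y p) (swap y x ↭-refl)) (insertions-↭ x ys))

permutations-↭ : ∀ (xs : List A) → All (_↭ xs) (permutations xs)
permutations-↭ []       = ↭-refl ∷ []
permutations-↭ (x ∷ xs) = All.concat⁺ (All.map⁺ (All.map (λ {ys} p → All.map (λ q → ↭-trans q (prep x p)) (insertions-↭ x ys)) (permutations-↭ xs)))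

∈-insertions : ∀ (x : A) ls rs → ls ++ x ∷ rs ∈ insertions x (ls ++ rs)
∈-insertions x []       []       = here refl
∈-insertions x []       (r ∷ rs) = here refl
∈-insertions x (l ∷ ls) rs       = there (∈-map⁺ (l ∷_) (∈-insertions x ls rs))

∈-permutations : ∀ (xs : List A) {ys} → ys ↭ xs → ys ∈ permutations xs
∈-permutations []       p with refl ← ↭.↭-empty-inv p = here refl
∈-permutations (x ∷ xs) p with ls , rs , refl ← ∈-∃++ (↭.∈-resp-↭ (↭-sym p) (here refl)) =
  ∈-concatMap⁺ (insertions x) (lose (∈-permutations xs (↭.drop-mid ls [] p)) (∈-insertions x ls rs))

length-insertions : ∀ (x : A) ys → length (insertions x ys) ≡ suc (length ys)
length-insertions x []       = refl
length-insertions x (y ∷ ys) = cong suc (trans (length-map (y ∷_) (insertions x ys)) (length-insertions x ys))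

length-permutations : ∀ (xs : List A) → length (permutations xs) ≡ length xs !
length-permutations []       = refl
length-permutations (x ∷ xs) = trans (go (permutations xs) (permutations-↭ xs)) (trans (*-comm (length (permutations xs)) _) (cong (suc (length xs) *_) (length-permutations xs)))
  where
  go : ∀ yss → All (_↭ xs) yss → length (concatMap (insertions x) yss) ≡ length yss * suc (length xs)
  go []         []       = refl
  go (ys ∷ yss) (p ∷ ps) = trans (length-++ (insertions x ys)) (cong₂ _+_ (trans (length-insertions x ys) (cong suc (↭.↭-length p))) (go yss ps))

∈-insertions⁻ : ∀ (x : A) ys {zs} → zs ∈ insertions x ys → ∃₂ λ ls rs → ys ≡ ls ++ rs × zs ≡ ls ++ x ∷ rs
∈-insertions⁻ x []       (here refl) = [] , [] , refl , refl
∈-insertions⁻ x (y ∷ ys) (here refl) = [] , y ∷ ys , refl , refl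
∈-insertions⁻ x (y ∷ ys) (there zs∈) with zs , zs∈′ , refl ← ∈-map⁻ (y ∷_) zs∈
  with ls , rs , refl , refl ← ∈-insertions⁻ x ys zs∈′ = y ∷ ls , rs , refl , refl

delete-unique : ∀ {x : A} ls {rs} ls′ {rs′} → x ∉ ls ++ rs → x ∉ ls′ ++ rs′ → ls ++ x ∷ rs ≡ ls′ ++ x ∷ rs′ → ls ++ rs ≡ ls′ ++ rs′
delete-unique []       []         _ _  refl = refl
delete-unique []       (l′ ∷ ls′) _ x∉ refl = ⊥-elim (x∉ (here refl))
delete-unique (l ∷ ls) []         x∉ _ refl = ⊥-elim (x∉ (here refl))
delete-unique (l ∷ ls) (l′ ∷ ls′) x∉ x∉′ eq with refl , eq′ ← ∷-injective eq =
  cong (l ∷_) (delete-unique ls ls′ (x∉ ∘ there) (x∉′ ∘ there) eq′)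

insertions-unique : ∀ (x : A) ys → x ∉ ys → Unique (insertions x ys)
insertions-unique x []       _  = [] ∷ []
insertions-unique x (y ∷ ys) x∉ = All.map⁺ (All.universal (λ zs eq → x∉ (here (∷-injectiveˡ eq))) (insertions x ys)) ∷
  Unique.map⁺ ∷-injectiveʳ (insertions-unique x ys (x∉ ∘ there))

permutations-unique : ∀ (xs : List A) → Unique xs → Unique (permutations xs)
permutations-unique []       _           = [] ∷ []
permutations-unique (x ∷ xs) (x≢ ∷ uniq) = Unique.concat⁺
  (All.map⁺ (All.map (λ p → insertions-unique x _ (x∉ p)) (permutations-↭ xs)))
  (AllPairs.map⁺ (disjoint (permutations-↭ xs) (permutations-unique xs uniq)))
  where
  x∉ : ∀ {ys} → ys ↭ xs → x ∉ ys
  x∉ p x∈ = All.lookup x≢ (↭.∈-resp-↭ p x∈) refl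
  disjoint : ∀ {yss} → All (_↭ xs) yss → Unique yss → AllPairs (λ ys zs → Disjoint (insertions x ys) (insertions x zs)) yss
  disjoint []       []           = []
  disjoint (p ∷ ps) (ne ∷ uniq) = All.zipWith (λ (q , ys≢zs) {v} i → ys≢zs (same p q (proj₁ i) (proj₂ i))) (ps , ne) ∷ disjoint ps uniq
    where
    same : ∀ {ys zs v} → ys ↭ xs → zs ↭ xs → v ∈ insertions x ys → v ∈ insertions x zs → ys ≡ zs
    same {ys} {zs} p q in₁ in₂
      with ls , rs , refl , refl ← ∈-insertions⁻ x ys in₁
      with ls′ , rs′ , refl , eq ← ∈-insertions⁻ x zs in₂ = delete-unique ls ls′ (x∉ p) (x∉ q) eq

ascending-unique : ∀ (key : A → ℕ) {xs ys} → Ascending key xs → Ascending key ys → xs ↭ ys → xs ≡ ys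
ascending-unique key {[]}     {ys}     _         _         p = sym (↭.↭-empty-inv (↭-sym p))
ascending-unique key {x ∷ xs} {[]}     _         _         p with () ← ↭.↭-empty-inv p
ascending-unique key {x ∷ xs} {y ∷ ys} (x< ∷ ax) (y< ∷ ay) p = cong₂ _∷_ x≡y
  (ascending-unique key ax ay (↭.drop-∷ (subst (λ z → x ∷ xs ↭ z ∷ ys) (sym x≡y) p)))
  where
  x≡y : x ≡ y
  x≡y with ↭.∈-resp-↭ p (here refl) | ↭.∈-resp-↭ (↭-sym p) (here refl)
  ... | here eq  | _        = eq
  ... | there _  | here eq  = sym eq
  ... | there x∈ | there y∈ = ⊥-elim (<-asym (All.lookup x< y∈) (All.lookup y< x∈))

-- Reconstruction of the sorted pairs from the positions

map-≡⇒All : ∀ {f g : A → B} xs → map f xs ≡ map g xs → All (λ x → f x ≡ g x) xs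
map-≡⇒All []       _  = []
map-≡⇒All (x ∷ xs) eq = ∷-injectiveˡ eq ∷ map-≡⇒All xs (∷-injectiveʳ eq)

fromMaybe-injective : ∀ (r r′ : Maybe A) → fromMaybe r ≡ fromMaybe r′ → r ≡ r′
fromMaybe-injective nothing  nothing  _    = refl
fromMaybe-injective (just _) (just _) refl = refl
fromMaybe-injective nothing  (just _) ()
fromMaybe-injective (just _) nothing  ()

module _ (key : A → ℕ) where

  smaller-injective : ∀ (ss ss′ : List (A × A)) {r r′} → map proj₁ ss ≡ map proj₁ ss′ → smaller key ss r ≡ smaller key ss′ r′ → ss ≡ ss′ × r ≡ r′
  smaller-injective []             []               _  eq = refl , fromMaybe-injective _ _ eq
  smaller-injective ((a , b) ∷ ss) ((a′ , b′) ∷ ss′) eq eq′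
    with refl ← ∷-injectiveˡ eq | refl ← ∷-injectiveˡ eq′
    with refl , refl ← smaller-injective ss ss′ (∷-injectiveʳ eq) (∷-injectiveʳ eq′) = refl , refl

  module _ {f : ℕ} {xs xs′ : List A} (R : Run key f xs) (R′ : Run key f xs′) where
    private
      module R = Run R
      module R′ = Run R′

    -- Both outputs are the sorted list of the same elements. Undoing the insertions at the known
    -- positions yields b₁, the sorted aᵢ and the other bᵢ in the order of insertion, which is a
    -- permutation of all indices.
    Run-injective : xs ↭ xs′ → R.positions ≡ R′.positions → (R.a₁ , R.b₁) ∷ R.ss ≡ (R′.a₁ , R′.b₁) ∷ R′.ss × R.rest ≡ R′.rest
    Run-injective xs↭xs′ same =
      smaller-injective ((R.a₁ , R.b₁) ∷ R.ss) ((R′.a₁ , R′.b₁) ∷ R′.ss) (∷-injectiveʳ chains) (cong₂ _∷_ (∷-injectiveˡ chains) tails)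
      where
      outputs : R.output ≡ R′.output
      outputs = ascending-unique key R.ascending R′.ascending (↭-trans R.output-↭ (↭-trans xs↭xs′ (↭-sym R′.output-↭)))
      inputs = Built-injective R.built (subst₂ (λ ps zs → Built ps _ _ zs) (sym same) (sym outputs) R′.built)
      chains = proj₂ inputs
      lengths : length R.bs ≡ length R′.bs
      lengths = +-cancelʳ-≡ ⌊ length xs /2⌋ _ _ (trans R.length-bs (trans (↭.↭-length xs↭xs′) (trans (sym R′.length-bs)
        (cong (λ n → length R′.bs + ⌊ n /2⌋) (sym (↭.↭-length xs↭xs′))))))
      tails : smaller key R.ss R.rest ≡ smaller key R′.ss R′.rest
      tails = trans (sym (get-tail R.b₁ R.b₁ _)) (trans (map-cong-local everywhere)
        (trans (cong (λ n → map (get R′.b₁ R′.bs) (applyUpTo (2 +_) (n ∸ 1))) lengths) (get-tail R′.b₁ R′.b₁ _)))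
        where
        everywhere : All (λ i → get R.b₁ R.bs i ≡ get R′.b₁ R′.bs i) (applyUpTo (2 +_) (length R.bs ∸ 1))
        everywhere = ↭.All-resp-↭ (insertionOrder-↭ (length R.bs)) (map-≡⇒All (insertionOrder (length R.bs))
          (trans (proj₁ inputs) (cong (λ n → map (get R′.b₁ R′.bs) (insertionOrder n)) (sym lengths))))

-- The total number of comparisons

ways-insertionOrder : ∀ u → ways (insertionOrder u) id ≡ oddFactorial u
ways-insertionOrder zero          = refl
ways-insertionOrder (suc zero)    = refl
ways-insertionOrder (suc (suc v)) = trans (ways-order K (suc r)) (cong oddFactorial index)
  where open Level (findLevel v)

halves-factorial : ∀ m → (2 ^ m * m ! * oddFactorial m ≡ (m + m) !) × (2 ^ m * m ! * oddFactorial (suc m) ≡ (m + suc m) !)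
halves-factorial m = even m , odd m
  where
  open ≡-Reasoning
  even : ∀ m → 2 ^ m * m ! * oddFactorial m ≡ (m + m) !
  odd  : ∀ m → 2 ^ m * m ! * oddFactorial (suc m) ≡ (m + suc m) !
  odd m = begin
    2 ^ m * m ! * (suc (2 * m) * oddFactorial m) ≡⟨ l (2 ^ m * m !) m (oddFactorial m) ⟩
    suc (m + m) * (2 ^ m * m ! * oddFactorial m) ≡⟨ cong (suc (m + m) *_) (even m) ⟩
    suc (m + m) ! ≡⟨ cong _! (+-suc m m) ⟨
    (m + suc m) ! ∎
    where
    l : ∀ x m y → x * (suc (2 * m) * y) ≡ suc (m + m) * (x * y)
    l = solve-∀
  even zero    = refl
  even (suc m) = begin
    2 * 2 ^ m * (suc m * m !) * oddFactorial (suc m) ≡⟨ l (2 ^ m) m (m !) (oddFactorial (suc m)) ⟩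
    suc (m + suc m) * (2 ^ m * m ! * oddFactorial (suc m)) ≡⟨ cong (suc (m + suc m) *_) (odd m) ⟩
    suc (m + suc m) ! ∎
    where
    l : ∀ p m f o → 2 * p * (suc m * f) * o ≡ suc (m + suc m) * (p * f * o)
    l = solve-∀

-- Orientations, orders of the pairs and sequences of positions together number n !, so replacing
-- the inputs by all such choices preserves the denominator of the average.
outcome-count : ∀ n m u → m + u ≡ n → (u ≡ m ⊎ u ≡ suc m) → 2 ^ m * m ! * ways (insertionOrder u) id ≡ n !
outcome-count _ m u refl h = trans (cong (2 ^ m * m ! *_) (ways-insertionOrder u)) (cases h)
  where
  cases : u ≡ m ⊎ u ≡ suc m → 2 ^ m * m ! * oddFactorial u ≡ (m + u) !
  cases (inj₁ refl) = proj₁ (halves-factorial m)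
  cases (inj₂ refl) = proj₂ (halves-factorial m)

-- The average number of comparisons is at most β / D.
TotalBound : ℕ → ℕ → ℕ → Set₁
TotalBound D n β = ∀ {A : Set} (key : A → ℕ) f xs → length xs ≡ n → n ≤ f → Distinct key xs →
  D * sum (map (λ π → proj₁ (mergeInsertion f (compareBy key) π)) (permutations xs)) ≤ n ! * β

sum-* : ∀ d (f : A → ℕ) xs → sum (map (λ x → d * f x) xs) ≡ d * sum (map f xs)
sum-* d f []       = sym (*-zeroʳ d)
sum-* d f (x ∷ xs) = trans (cong (d * f x +_) (sum-* d f xs)) (sym (*-distribˡ-+ d (f x) _))

sum-cong-All : ∀ {f g : A → ℕ} {xs} → All (λ x → f x ≡ g x) xs → sum (map f xs) ≡ sum (map g xs)
sum-cong-All eqs = cong sum (map-cong-local eqs)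

map-proj₁-toList : ∀ {P : A → Set} {xs} (pxs : All P xs) → map proj₁ (All.toList pxs) ≡ xs
map-proj₁-toList []       = refl
map-proj₁-toList (_ ∷ ps) = cong (_ ∷_) (map-proj₁-toList ps)

Distinct⇒Unique : ∀ (key : A → ℕ) {xs} → Distinct key xs → Unique xs
Distinct⇒Unique key = AllPairs.map (λ ne eq → ne (cong key eq))

module _ (key : A → ℕ) (f : ℕ) (xs : List A) (distinct : Distinct key xs) where
  private
    n = length xs
    m = ⌊ n /2⌋
    u = n ∸ m

  RunOf : Set
  RunOf = ∃ λ π → π ↭ xs × Run key f π

  outcome : RunOf → List ℕ × ℕ
  outcome (_ , _ , R) = Run.positions R , Run.cost R

  runCost : RunOf → ℕ
  runCost (_ , _ , R) = m + (recursiveCost key f (Run.ps R) + Run.cost R)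

  candidates : List (A × A) → Maybe A → List (List (A × A) × List A)
  candidates ss r = concatMap (λ σ → map (σ ,_) (unpair σ r)) (permutations ss)

  module _ (D β : ℕ) (ih : TotalBound D m β) (m≤f : m ≤ f) where
    private
      fibreBound : List ℕ × ℕ → ℕ
      fibreBound q = 2 ^ m * m ! * ((D * m + β) + D * proj₂ q)

    candidates-sum : ∀ c ss r → length ss ≡ m → Distinct (key ∘ proj₁) ss →
      sum (map (λ (σ , _) → D * (m + (recursiveCost key f σ + c))) (candidates ss r)) ≤ fibreBound ([] , c)
    candidates-sum c ss r len dist = begin
      sum (map g (candidates ss r))
        ≡⟨ sum-concatMap g (λ σ → map (σ ,_) (unpair σ r)) (permutations ss) ⟩
      sum (map (λ σ → sum (map g (map (σ ,_) (unpair σ r)))) (permutations ss))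
        ≡⟨ sum-cong-All (All.map (λ {σ} p → trans (cong sum (sym (map-∘ (unpair σ r)))) (trans (sum-const (unpair σ r) (g (σ , [])))
             (trans (cong (_* g (σ , [])) (trans (length-unpair σ r) (cong (2 ^_) (trans (↭.↭-length p) len)))) (split (2 ^ m) D m (recursiveCost key f σ) c)))) (permutations-↭ ss)) ⟩
      sum (map (λ σ → 2 ^ m * (D * (m + c)) + 2 ^ m * (D * recursiveCost key f σ)) (permutations ss))
        ≡⟨ sum-+ (λ _ → 2 ^ m * (D * (m + c))) (λ σ → 2 ^ m * (D * recursiveCost key f σ)) (permutations ss) ⟩
      sum (map (λ _ → 2 ^ m * (D * (m + c))) (permutations ss)) + sum (map (λ σ → 2 ^ m * (D * recursiveCost key f σ)) (permutations ss))
        ≡⟨ cong₂ _+_ (trans (sum-const (permutations ss) _) (cong (_* (2 ^ m * (D * (m + c)))) (trans (length-permutations ss) (cong _! len))))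
                     (trans (sum-* (2 ^ m) _ (permutations ss)) (cong (2 ^ m *_) (sum-* D (recursiveCost key f) (permutations ss)))) ⟩
      m ! * (2 ^ m * (D * (m + c))) + 2 ^ m * (D * sum (map (recursiveCost key f) (permutations ss)))
        ≤⟨ +-monoʳ-≤ (m ! * (2 ^ m * (D * (m + c)))) (*-monoʳ-≤ (2 ^ m) (ih (key ∘ proj₁) f ss len m≤f dist)) ⟩
      m ! * (2 ^ m * (D * (m + c))) + 2 ^ m * (m ! * β)
        ≡⟨ collect (m !) (2 ^ m) D m c β ⟩
      2 ^ m * m ! * ((D * m + β) + D * c) ∎
      where
      open ≤-Reasoning
      g : List (A × A) × List A → ℕ
      g (σ , _) = D * (m + (recursiveCost key f σ + c))
      split : ∀ p D m s c → p * (D * (m + (s + c))) ≡ p * (D * (m + c)) + p * (D * s)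
      split = solve-∀
      collect : ∀ f p D m c β → f * (p * (D * (m + c))) + p * (f * β) ≡ p * f * ((D * m + β) + D * c)
      collect = solve-∀

    -- By `Run-injective`, inputs with the same outcome share the sorted pairs and the unpaired
    -- element; they differ in the order of the pairs, over which the hypothesis `ih` averages, and
    -- in the orientations.
    fibre-bound : ∀ q (zs : List RunOf) → Unique (map proj₁ zs) → All (λ z → outcome z ≡ q) zs →
                  sum (map (λ z → D * runCost z) zs) ≤ fibreBound q
    fibre-bound q []       _    _             = z≤n
    fibre-bound q zs@(z₀ ∷ _) uniq eqs@(refl ∷ _) = begin
      sum (map (λ z → D * runCost z) zs)
        ≡⟨ sum-cong-All (All.map (λ {z} eq → cong (λ o → D * (m + (recursiveCost key f (Run.ps (proj₂ (proj₂ z))) + proj₂ o))) eq) eqs) ⟩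
      sum (map (λ z → g (code z)) zs)
        ≡⟨ cong sum (map-∘ zs) ⟩
      sum (map g (map code zs))
        ≤⟨ sum-⊆ g (candidates ss₀ (Run.rest R₀)) codes-unique (All.map⁺ (All.map (λ {z} → coded z) eqs)) ⟩
      sum (map g (candidates ss₀ (Run.rest R₀)))
        ≤⟨ candidates-sum (Run.cost R₀) ss₀ (Run.rest R₀) length₀ distinct₀ ⟩
      fibreBound q ∎
      where
      open ≤-Reasoning
      π₀↭ = proj₁ (proj₂ z₀)
      R₀ = proj₂ (proj₂ z₀)
      ss₀ = (Run.a₁ R₀ , Run.b₁ R₀) ∷ Run.ss R₀
      g : List (A × A) × List A → ℕ
      g (σ , _) = D * (m + (recursiveCost key f σ + Run.cost R₀))
      code : RunOf → List (A × A) × List A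
      code (π , _ , R) = Run.ps R , π
      codes-unique : Unique (map code zs)
      codes-unique = Unique.map⁻ (subst Unique (map-∘ {g = proj₂} {f = code} zs) uniq)
      coded : ∀ z → outcome z ≡ outcome z₀ → code z ∈ candidates ss₀ (Run.rest R₀)
      coded (π , π↭ , R) eq with pairs , rests ← Run-injective key R R₀ (↭-trans π↭ (↭-sym π₀↭)) (cong proj₁ eq) =
        ∈-concatMap⁺ (λ σ → map (σ ,_) (unpair σ (Run.rest R₀)))
          (lose (∈-permutations ss₀ (↭-sym (subst (_↭ Run.ps R) pairs (Run.sorted R))))
                (∈-map⁺ (Run.ps R ,_) (∈-unpair key (subst (Pairing key π (Run.ps R)) rests (Run.paired R)))))
      length₀ : length ss₀ ≡ m
      length₀ = trans (Run.length-pairs R₀) (cong ⌊_/2⌋ (↭.↭-length π₀↭))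
      distinct₀ : Distinct (key ∘ proj₁) ss₀
      distinct₀ = AllPairs.map⁻ (proj₂ (AllPairs-++⁻ (Run.bs R₀) (Distinct-resp-↭ key (↭-sym (↭-trans (Run.elements-↭ R₀) π₀↭)) distinct)))

    inputCost : List A → ℕ
    inputCost π = proj₁ (mergeInsertion (suc f) (compareBy key) π)

    inputCost≡runCost : ∀ z → inputCost (proj₁ z) ≡ runCost z
    inputCost≡runCost (π , p , R) = trans (cong proj₁ (Run.result R))
      (cong (λ l → ⌊ l /2⌋ + (recursiveCost key f (Run.ps R) + Run.cost R)) (↭.↭-length p))

    outcome-possible : ∀ z → outcome z ∈ outcomes (insertionOrder u) id
    outcome-possible (π , p , R) = subst (λ u → (Run.positions R , Run.cost R) ∈ outcomes (insertionOrder u) id) count (Run.possible R)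
      where
      count : length (Run.bs R) ≡ u
      count = trans (sym (m+n∸n≡m (length (Run.bs R)) ⌊ length π /2⌋))
        (trans (cong (_∸ ⌊ length π /2⌋) (Run.length-bs R)) (cong (λ l → l ∸ ⌊ l /2⌋) (↭.↭-length p)))

    module _ (2≤n : 2 ≤ n) (n≤f : n ≤ suc f) where

      allRuns : All (λ π → π ↭ xs × Run key f π) (permutations xs)
      allRuns = All.map (λ {π} p → p , run f key π (subst (_≤ suc f) (sym (↭.↭-length p)) n≤f)
        (subst (2 ≤_) (sym (↭.↭-length p)) 2≤n) (Distinct-resp-↭ key (↭-sym p) distinct)) (permutations-↭ xs)

      total-runs : ∀ zs → map proj₁ zs ≡ permutations xs →
                   D * sum (map inputCost (permutations xs)) ≡ sum (map (λ z → D * runCost z) zs)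
      total-runs zs eq = begin
        D * sum (map inputCost (permutations xs)) ≡⟨ cong (λ πs → D * sum (map inputCost πs)) eq ⟨
        D * sum (map inputCost (map proj₁ zs)) ≡⟨ cong (λ x → D * sum x) (map-∘ zs) ⟨
        D * sum (map (inputCost ∘ proj₁) zs) ≡⟨ cong (λ x → D * sum x) (map-cong inputCost≡runCost zs) ⟩
        D * sum (map runCost zs) ≡⟨ sum-* D runCost zs ⟨
        sum (map (λ z → D * runCost z) zs) ∎
        where open ≡-Reasoning

      total-fibres : ∀ zs → map proj₁ zs ≡ permutations xs →
                     sum (map (λ z → D * runCost z) zs) ≤ sum (map fibreBound (outcomes (insertionOrder u) id))
      total-fibres zs eq = fibre-sum (×.≡-dec (List.≡-dec _≟_) _≟_) outcome proj₁ (λ z → D * runCost z) fibreBound fibre-bound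
        (outcomes (insertionOrder u) id) zs
        (subst Unique (sym eq) (permutations-unique xs (Distinct⇒Unique key distinct))) (All.universal outcome-possible zs)

      fibres-total : ∀ h → D * totalCost (insertionOrder u) id ≤ h * ways (insertionOrder u) id → u ≡ m ⊎ u ≡ suc m →
                     sum (map fibreBound (outcomes (insertionOrder u) id)) ≤ n ! * (D * m + β + h)
      fibres-total h hbound u≡ = begin
        sum (map fibreBound (outcomes (insertionOrder u) id))
          ≡⟨ sum-* (2 ^ m * m !) (λ q → D * m + β + D * proj₂ q) (outcomes (insertionOrder u) id) ⟩
        2 ^ m * m ! * sum (map (λ q → D * m + β + D * proj₂ q) (outcomes (insertionOrder u) id))
          ≡⟨ cong (2 ^ m * m ! *_) (outcomes-sum (insertionOrder u) id (D * m + β) D) ⟩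
        2 ^ m * m ! * ((D * m + β) * W + D * totalCost (insertionOrder u) id)
          ≤⟨ *-monoʳ-≤ (2 ^ m * m !) (+-monoʳ-≤ ((D * m + β) * W) hbound) ⟩
        2 ^ m * m ! * ((D * m + β) * W + h * W)
          ≡⟨ collect (2 ^ m * m !) (D * m + β) W h ⟩
        2 ^ m * m ! * W * (D * m + β + h)
          ≡⟨ cong (_* (D * m + β + h)) (outcome-count n m u (m+[n∸m]≡n (⌊n/2⌋≤n n)) u≡) ⟩
        n ! * (D * m + β + h) ∎
        where
        open ≤-Reasoning
        W = ways (insertionOrder u) id
        collect : ∀ x a W h → x * (a * W + h * W) ≡ x * W * (a + h)
        collect = solve-∀

      total-step : ∀ h → D * totalCost (insertionOrder u) id ≤ h * ways (insertionOrder u) id → u ≡ m ⊎ u ≡ suc m →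
                   D * sum (map inputCost (permutations xs)) ≤ n ! * (D * m + β + h)
      total-step h hbound u≡ = ≤-trans (≤-reflexive (total-runs zs eq)) (≤-trans (total-fibres zs eq) (fibres-total h hbound u≡))
        where
        zs : List RunOf
        zs = All.toList allRuns
        eq : map proj₁ zs ≡ permutations xs
        eq = map-proj₁-toList allRuns

-- The bound for every n

module Bounds (D a b c C : ℕ) (10b : 10 * b ≡ D) (10a : 10 * a ≡ c + 50)
  (linear : ∀ K → K * (6 * D) + (5 * D + 2) ≤ 16 * 2 ^ suc K + C)
  (log : ∀ k m p q → 2 ^ k ≤ 4 * m → 4 * m ≤ 3 * 2 ^ k → m ^ q ≤ 2 ^ p → LogBound a b k m p q) where

  open Recurrence D a b c C 10b 10a linear log

  AverageBound : ℕ → Set₁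
  AverageBound n = Σ[ β ∈ ℕ ] TotalBound D n β × LogarithmicBound n β

  TotalBound-step : ∀ n β → 2 ≤ n → TotalBound D ⌊ n /2⌋ β → ∀ h →
    D * totalCost (insertionOrder (n ∸ ⌊ n /2⌋)) id ≤ h * ways (insertionOrder (n ∸ ⌊ n /2⌋)) id →
    (n ∸ ⌊ n /2⌋ ≡ ⌊ n /2⌋ ⊎ n ∸ ⌊ n /2⌋ ≡ suc ⌊ n /2⌋) → TotalBound D n (D * ⌊ n /2⌋ + β + h)
  TotalBound-step n β 2≤n ih h hb u≡ key zero    xs refl n≤f distinct with () ← ≤-trans 2≤n n≤f
  TotalBound-step n β 2≤n ih h hb u≡ key (suc f) xs refl n≤f distinct =
    total-step key f xs distinct D β ih (s≤s⁻¹ (≤-trans (half<n 2≤n) n≤f)) 2≤n n≤f h hb u≡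
    where
    half<n : ∀ {n} → 2 ≤ n → ⌊ n /2⌋ < n
    half<n {suc n} _ = ⌊n/2⌋<n n

  upper-half : ∀ n → n ∸ ⌊ n /2⌋ ≡ ⌈ n /2⌉
  upper-half n = trans (cong (_∸ ⌊ n /2⌋) (sym (⌊n/2⌋+⌈n/2⌉≡n n))) (m+n∸m≡n ⌊ n /2⌋ ⌈ n /2⌉)

  upper-half-differs : ∀ n → n ∸ ⌊ n /2⌋ ≡ ⌊ n /2⌋ ⊎ n ∸ ⌊ n /2⌋ ≡ suc ⌊ n /2⌋
  upper-half-differs n rewrite upper-half n = halves-differ n

  smallTotal : ∀ n → n ≤ 1 → TotalBound D n 0
  smallTotal zero          _        key f []             _ _       _ = ≤-reflexive (trans (cong (λ x → D * (proj₁ x + 0)) (mergeInsertion-[] f (compareBy key))) (*-zeroʳ D))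
  smallTotal (suc zero)    _        key (suc f) (x ∷ []) _ _       _ = ≤-reflexive (trans (cong (λ x → D * (proj₁ x + 0)) (mergeInsertion-[x] f (compareBy key) x)) (*-zeroʳ D))
  smallTotal (suc (suc _)) (s≤s ())

  two-bound : LogarithmicBound 2 (D * 1 + 0 + 0)
  two-bound p q h = begin
    q * (D * 1 + 0 + 0) + q * (c * 2) ≡⟨ l₁ q D c ⟩
    D * q + q * (c * 2) ≤⟨ +-mono-≤ (*-monoʳ-≤ D (2^-cancel-≤ h)) (*-monoʳ-≤ q (*-monoˡ-≤ 2 (m≤n+m c (16 + C)))) ⟩
    D * p + q * (C₁ * 2) ≤⟨ +-monoˡ-≤ (q * (C₁ * 2)) (m≤m+n (D * p) (D * p)) ⟩
    D * p + D * p + q * (C₁ * 2) ≡⟨ cong (_+ q * (C₁ * 2)) (l₂ D p) ⟩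
    D * 2 * p + q * (C₁ * 2) ∎
    where
    open ≤-Reasoning
    l₁ : ∀ q D c → q * (D * 1 + 0 + 0) + q * (c * 2) ≡ D * q + q * (c * 2)
    l₁ = solve-∀
    l₂ : ∀ D p → D * p + D * p ≡ D * 2 * p
    l₂ = solve-∀

  average-bound : ∀ g n → n ≤ g → AverageBound n
  average-bound g       zero             _   = 0 , smallTotal 0 z≤n , small-bound 0 z≤n
  average-bound g       (suc zero)       _   = 0 , smallTotal 1 ≤-refl , small-bound 1 ≤-refl
  -- For n = 2 the only smaller element is b₁, already in the chain: nothing is inserted, and there
  -- is no `Level`.
  average-bound g       (suc (suc zero)) _   =
    D * 1 + 0 + 0 , TotalBound-step 2 0 ≤-refl (smallTotal 1 ≤-refl) 0 (≤-reflexive (*-zeroʳ D)) (inj₁ refl) , two-bound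
  average-bound (suc g) n@(suc (suc (suc v))) (s≤s n≤g)
    with β , total , logarithmic ← average-bound g ⌊ n /2⌋ (≤-trans (s≤s (⌊n/2⌋≤n (suc v))) n≤g) =
    D * ⌊ n /2⌋ + β + budget K r
    , TotalBound-step n β 2≤n total (budget K r) cost (upper-half-differs n)
    , step-bound n K r β 2≤n 1≤K within (trans (cong (⌊ n /2⌋ +_) (trans index (sym u≡))) (m+[n∸m]≡n (⌊n/2⌋≤n n)))
        (subst (⌊ n /2⌋ ≤_) (trans u≡ (sym index)) (lower (upper-half-differs n)))
        (subst (_≤ suc ⌊ n /2⌋) (trans u≡ (sym index)) (upper (upper-half-differs n)))
        logarithmic
    where
    open Level (findLevel ⌊ v /2⌋)
    2≤n : 2 ≤ n
    2≤n = s≤s (s≤s z≤n)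
    u≡ : n ∸ ⌊ n /2⌋ ≡ 2 + ⌊ v /2⌋
    u≡ = upper-half n
    cost : D * totalCost (insertionOrder (n ∸ ⌊ n /2⌋)) id ≤ budget K r * ways (insertionOrder (n ∸ ⌊ n /2⌋)) id
    cost rewrite u≡ = order-cost D K r within
    lower : n ∸ ⌊ n /2⌋ ≡ ⌊ n /2⌋ ⊎ n ∸ ⌊ n /2⌋ ≡ suc ⌊ n /2⌋ → ⌊ n /2⌋ ≤ n ∸ ⌊ n /2⌋
    lower (inj₁ eq) = ≤-reflexive (sym eq)
    lower (inj₂ eq) = ≤-trans (n≤1+n _) (≤-reflexive (sym eq))
    upper : n ∸ ⌊ n /2⌋ ≡ ⌊ n /2⌋ ⊎ n ∸ ⌊ n /2⌋ ≡ suc ⌊ n /2⌋ → n ∸ ⌊ n /2⌋ ≤ suc ⌊ n /2⌋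
    upper (inj₁ eq) = ≤-trans (≤-reflexive eq) (n≤1+n _)
    upper (inj₂ eq) = ≤-reflexive eq

totalComparisons : ℕ → ℕ
totalComparisons n = sum (map comparisons (permutations (upTo n)))

-- A bound of n log₂ n - (e / z) n + C (1 + ⌊log₂ n⌋) for the average number of
-- comparisons, where log₂ n ≤ p / q.
HasRate : ℕ → ℕ → ℕ → Set
HasRate e z C = ∀ n p q → n ^ q ≤ 2 ^ p →
  z * (q * totalComparisons n) + e * (n ! * (q * n)) ≤ z * (n ! * (n * p + q * (C * suc ⌊log₂ n ⌋)))

module _ (D a b c C e z : ℕ) .{{_ : NonZero D}} (10b : 10 * b ≡ D) (10a : 10 * a ≡ c + 50) (c≡ : e * D ≡ c * z)
  (linear : ∀ K → K * (6 * D) + (5 * D + 2) ≤ 16 * 2 ^ suc K + C)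
  (log : ∀ k m p q → 2 ^ k ≤ 4 * m → 4 * m ≤ 3 * 2 ^ k → m ^ q ≤ 2 ^ p → LogBound a b k m p q) where

  rate-from-estimate : ∃ λ C′ → HasRate e z C′
  rate-from-estimate = C₁ , λ n p q np → from n p q np (average-bound n n ≤-refl)
    where
    open Bounds D a b c C 10b 10a linear log
    open Recurrence D a b c C 10b 10a linear log using (C₁)
    from : ∀ n p q → n ^ q ≤ 2 ^ p → AverageBound n →
           z * (q * totalComparisons n) + e * (n ! * (q * n)) ≤ z * (n ! * (n * p + q * (C₁ * suc ⌊log₂ n ⌋)))
    from n p q np (β , total , logarithmic) = *-cancelˡ-≤ D (begin
      D * (z * (q * S) + e * (F * (q * n))) ≡⟨ l₁ D z q S e F n ⟩
      z * (q * (D * S)) + e * D * (F * (q * n)) ≡⟨ cong (λ x → z * (q * (D * S)) + x * (F * (q * n))) c≡ ⟩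
      z * (q * (D * S)) + c * z * (F * (q * n)) ≤⟨ +-monoˡ-≤ (c * z * (F * (q * n))) (*-monoʳ-≤ z (*-monoʳ-≤ q totalBound)) ⟩
      z * (q * (F * β)) + c * z * (F * (q * n)) ≡⟨ l₂ z q F β c n ⟩
      z * (F * (q * β + q * (c * n))) ≤⟨ *-monoʳ-≤ z (*-monoʳ-≤ F (logarithmic p q np)) ⟩
      -- The logarithmic term is enlarged by the factor D so that D can be cancelled.
      z * (F * (D * n * p + q * (C₁ * L))) ≤⟨ *-monoʳ-≤ z (*-monoʳ-≤ F (+-monoʳ-≤ (D * n * p) (m≤n*m (q * (C₁ * L)) D))) ⟩
      z * (F * (D * n * p + D * (q * (C₁ * L)))) ≡⟨ l₃ z F D n p (q * (C₁ * L)) ⟩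
      D * (z * (F * (n * p + q * (C₁ * L)))) ∎)
      where
      open ≤-Reasoning
      S = totalComparisons n
      F = n !
      L = suc ⌊log₂ n ⌋
      totalBound : D * S ≤ F * β
      totalBound = subst (λ s → D * s ≤ F * β)
        (cong sum (map-cong-local (All.map (λ {π} p → cong (λ l → proj₁ (mergeInsertion l compareℕ π)) (trans (sym (length-upTo n)) (sym (↭.↭-length p)))) (permutations-↭ (upTo n)))))
        (total id n (upTo n) (length-upTo n) ≤-refl (Unique.upTo⁺ n))
      l₁ : ∀ D z q S e F n → D * (z * (q * S) + e * (F * (q * n))) ≡ z * (q * (D * S)) + e * D * (F * (q * n))
      l₁ = solve-∀
      l₂ : ∀ z q F β c n → z * (q * (F * β)) + c * z * (F * (q * n)) ≡ z * (F * (q * β + q * (c * n)))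
      l₂ = solve-∀
      l₃ : ∀ z F D n p x → z * (F * (D * n * p + D * x)) ≡ D * (z * (F * (n * p + x)))
      l₃ = solve-∀

linear-estimate : ∀ A E C → A ≤ 32 * 2 ^ 18 → 18 * A + E ≤ C → ∀ K → K * A + E ≤ 16 * 2 ^ suc K + C
linear-estimate A E C A≤ ≤C K = begin
  K * A + E ≤⟨ +-monoˡ-≤ E (linear≤exponential A 32 18 K A≤) ⟩
  32 * 2 ^ K + 18 * A + E ≡⟨ +-assoc (32 * 2 ^ K) (18 * A) E ⟩
  32 * 2 ^ K + (18 * A + E) ≤⟨ +-mono-≤ (≤-reflexive (*-assoc 16 2 (2 ^ K))) ≤C ⟩
  16 * 2 ^ suc K + C ∎
  where open ≤-Reasoning

-- a / b = 1.39995 and c / D = 1.3999, with D = 10^6. The exponent 18 is the least with 6 D ≤ 32 *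
-- 2^18, and 113000002 = 18 * 6 D + 5 D + 2.
rate : ∃ λ C → HasRate 13999 10000 C
rate = rate-from-estimate 1000000 139995 100000 1399900 113000002 13999 10000 refl refl refl
  (linear-estimate (6 * 1000000) (5 * 1000000 + 2) 113000002 (≤ᵇ⇒≤ (6 * 1000000) (32 * 2 ^ 18) tt) (≤ᵇ⇒≤ (18 * (6 * 1000000) + (5 * 1000000 + 2)) 113000002 tt))
  log-bound

-- From natural to real numbers

open import Data.Integer using (+_)
open import Data.Rational.Unnormalised using (_/_)
open import Data.Rational.Unnormalised as ℚ using (ℚᵘ; *≤*; *≡*; 0ℚᵘ)
import Data.Rational.Unnormalised.Properties as ℚ
open import Data.Rational.Unnormalised.Solver using (module +-*-Solver)

/-+ : ∀ a b c d .{{_ : NonZero b}} .{{_ : NonZero d}} →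
      (+ a / b) ℚ.+ (+ c / d) ≡ _/_ (+ (a * d + c * b)) (b * d) {{m*n≢0 b d}}
/-+ a (suc b) c (suc d) = cong (λ x → x / (suc b * suc d)) (trans (cong₂ ℤ._+_ (sym (ℤ.pos-* a (suc d))) (sym (ℤ.pos-* c (suc b)))) (sym (ℤ.pos-+ (a * suc d) (c * suc b))))

/-* : ∀ a b c d .{{_ : NonZero b}} .{{_ : NonZero d}} →
      (+ a / b) ℚ.* (+ c / d) ≡ _/_ (+ (a * c)) (b * d) {{m*n≢0 b d}}
/-* a (suc b) c (suc d) = cong (λ x → x / (suc b * suc d)) (sym (ℤ.pos-* a c))

/-≤ : ∀ a b c d .{{_ : NonZero b}} .{{_ : NonZero d}} → a * d ≤ c * b → + a / b ℚ.≤ + c / d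
/-≤ a (suc b) c (suc d) h = *≤* (subst₂ ℤ._≤_ (ℤ.pos-* a (suc d)) (ℤ.pos-* c (suc b)) (ℤ.+≤+ h))

/-≃ : ∀ a b c d .{{_ : NonZero b}} .{{_ : NonZero d}} → a * d ≡ c * b → + a / b ℚ.≃ + c / d
/-≃ a (suc b) c (suc d) h = *≡* (trans (sym (ℤ.pos-* a (suc d))) (trans (cong +_ h) (ℤ.pos-* c (suc b))))

≤2^1+log₂ : ∀ x → x ≤ 2 ^ suc ⌊log₂ x ⌋
≤2^1+log₂ zero    = z≤n
≤2^1+log₂ (suc x) = <⇒≤ (proj₂ (log-bounds _ x ≤-refl))

module _ (e z C : ℕ) .{{_ : NonZero z}} (rate : HasRate e z C) where

  w : ℚᵘ
  w = + e / z

  module _ (n′ : ℕ) where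
    private
      n = suc n′
      N r M : ℚᵘ
      N = + n / 1
      r = + 1 / n
      M = averageComparisons n
      l : ℕ → ℚᵘ
      l = seq (log₂ n)
      E : ℚᵘ
      E = + (C * suc ⌊log₂ n ⌋) / 1

    -- `rate` is applied to q = j + 1 and p = ⌊log₂ (n^q)⌋ + 1, for which p / q is exactly l j + ε
    -- j.
    average-≤ : ∀ j → M ℚ.+ N ℚ.* w ℚ.≤ N ℚ.* (l j ℚ.+ ε j) ℚ.+ E
    average-≤ j = subst₂ ℚ._≤_ (sym left) (sym right)
      (/-≤ (S * (1 * z) + n * e * F) (F * (1 * z)) (n * (g * q + 1 * q) * 1 + b * (1 * (q * q))) (1 * (q * q) * 1)
        {{nzL}} (begin
          (S * (1 * z) + n * e * F) * (1 * (q * q) * 1) ≡⟨ l₁ S z n e F q ⟩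
          q * (z * (q * S) + e * (F * (q * n))) ≤⟨ *-monoʳ-≤ q (rate n (suc g) q (≤2^1+log₂ (n ^ q))) ⟩
          q * (z * (F * (n * suc g + q * b))) ≡⟨ l₂ q z F n g b ⟩
          (n * (g * q + 1 * q) * 1 + b * (1 * (q * q))) * (F * (1 * z)) ∎))
      where
      open ≤-Reasoning
      S = totalComparisons n
      F = n !
      q = suc j
      g = ⌊log₂ n ^ q ⌋
      b = C * suc ⌊log₂ n ⌋
      instance
        F≢0 : NonZero F
        F≢0 = _!≢0 n
        1z≢0 : NonZero (1 * z)
        1z≢0 = m*n≢0 1 z
      nzL : NonZero (F * (1 * z))
      nzL = m*n≢0 F (1 * z)
      left : M ℚ.+ N ℚ.* w ≡ _/_ (+ (S * (1 * z) + n * e * F)) (F * (1 * z)) {{nzL}}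
      left = trans (cong (M ℚ.+_) (/-* n 1 e z)) (/-+ S F (n * e) (1 * z))
      right : N ℚ.* (l j ℚ.+ ε j) ℚ.+ E ≡ + (n * (g * q + 1 * q) * 1 + b * (1 * (q * q))) / (1 * (q * q) * 1)
      right = trans (cong (λ x → N ℚ.* x ℚ.+ E) (/-+ g q 1 q)) (trans (cong (ℚ._+ E) (/-* n 1 (g * q + 1 * q) (q * q))) (/-+ (n * (g * q + 1 * q)) (1 * (q * q)) b 1))
      l₁ : ∀ S z n e F q → (S * (1 * z) + n * e * F) * (1 * (q * q) * 1) ≡ q * (z * (q * S) + e * (F * (q * n)))
      l₁ = solve-∀
      l₂ : ∀ q z F n g b → q * (z * (F * (n * suc g + q * b))) ≡ (n * (g * q + 1 * q) * 1 + b * (1 * (q * q))) * (F * (1 * z))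
      l₂ = solve-∀

    Nε≤1 : ∀ j → n ≤ suc j → N ℚ.* ε j ℚ.≤ + 1 / 1
    Nε≤1 j n≤ = subst (ℚ._≤ + 1 / 1) (sym (/-* n 1 1 (suc j))) (/-≤ (n * 1) (1 * suc j) 1 1
      (subst₂ _≤_ (sym (trans (*-identityʳ (n * 1)) (*-identityʳ n))) (sym (trans (*-identityˡ _) (*-identityˡ (suc j)))) n≤))

    -- v solves M = n l n - n v, where the n-th approximation of the logarithm suffices because n
    -- times its error is bounded. With the maximum c, one direction follows from c ≥ v; for the
    -- other, either c = v and only approximation errors remain, or c = w and `average-≤` applies.
    v c : ℚᵘ
    v = (N ℚ.* l n ℚ.- M) ℚ.* r
    c = w ℚ.⊔ v

    2ℚ : ℚᵘ
    2ℚ = + 1 / 1 ℚ.+ + 1 / 1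

    open ℚ.≤-Reasoning
    open +-*-Solver using (solve; _:+_; _:*_; _:-_; :-_; _:=_; con)

    M+Nv : M ℚ.+ N ℚ.* v ℚ.≃ N ℚ.* l n
    M+Nv = ℚ.≃-trans (solve 4 (λ M N x r → M :+ N :* ((x :- M) :* r) := M :+ (N :* r) :* (x :- M)) ℚ.≃-refl M N (N ℚ.* l n) r)
      (ℚ.≃-trans (ℚ.+-congʳ M (ℚ.≃-trans (ℚ.*-congʳ {N ℚ.* l n ℚ.- M} Nr) (ℚ.*-identityˡ (N ℚ.* l n ℚ.- M))))
                 (solve 2 (λ M x → M :+ (x :- M) := x) ℚ.≃-refl M (N ℚ.* l n)))
      where
      Nr : N ℚ.* r ℚ.≃ ℚ.1ℚᵘ
      Nr = ℚ.≃-trans (ℚ.≃-reflexive (/-* n 1 1 n)) (/-≃ (n * 1) (1 * n) 1 1 (lem n))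
        where
        lem : ∀ n → n * 1 * 1 ≡ 1 * (1 * n)
        lem = solve-∀

    close : ∀ i j → n ≤ suc i → n ≤ suc j → N ℚ.* l i ℚ.≤ N ℚ.* l j ℚ.+ 2ℚ
    close i j n≤i n≤j = begin
      N ℚ.* l i ≤⟨ ℚ.*-monoʳ-≤-nonNeg N (≤-from-regular (log₂ n) i j) ⟩
      N ℚ.* (l j ℚ.+ (ε i ℚ.+ ε j)) ≃⟨ solve 4 (λ N l x y → N :* (l :+ (x :+ y)) := N :* l :+ (N :* x :+ N :* y)) ℚ.≃-refl N (l j) (ε i) (ε j) ⟩
      N ℚ.* l j ℚ.+ (N ℚ.* ε i ℚ.+ N ℚ.* ε j) ≤⟨ ℚ.+-monoʳ-≤ (N ℚ.* l j) (ℚ.+-mono-≤ (Nε≤1 i n≤i) (Nε≤1 j n≤j)) ⟩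
      N ℚ.* l j ℚ.+ 2ℚ ∎

    0≤E : 0ℚᵘ ℚ.≤ E
    0≤E = /-≤ 0 1 (C * suc ⌊log₂ n ⌋) 1 z≤n

    lower : ∀ j → n ≤ suc j → N ℚ.* l j ℚ.≤ (M ℚ.+ N ℚ.* c) ℚ.+ 2ℚ
    lower j n≤ = begin
      N ℚ.* l j ≤⟨ close j n n≤ (n≤1+n n) ⟩
      N ℚ.* l n ℚ.+ 2ℚ ≃⟨ ℚ.+-congˡ 2ℚ M+Nv ⟨
      (M ℚ.+ N ℚ.* v) ℚ.+ 2ℚ ≤⟨ ℚ.+-monoˡ-≤ 2ℚ (ℚ.+-monoʳ-≤ M (ℚ.*-monoʳ-≤-nonNeg N (ℚ.p≤q⊔p w v))) ⟩
      (M ℚ.+ N ℚ.* c) ℚ.+ 2ℚ ∎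

    upper : ∀ j → n ≤ suc j → M ℚ.+ N ℚ.* c ℚ.≤ N ℚ.* l j ℚ.+ (2ℚ ℚ.+ E)
    upper j n≤ with ℚ.⊔-sel w v
    ... | inj₁ c≃w = begin
      M ℚ.+ N ℚ.* c ≃⟨ ℚ.+-congʳ M (ℚ.*-congˡ {N} c≃w) ⟩
      M ℚ.+ N ℚ.* w ≤⟨ average-≤ j ⟩
      N ℚ.* (l j ℚ.+ ε j) ℚ.+ E ≃⟨ solve 4 (λ N l x E → N :* (l :+ x) :+ E := N :* l :+ (N :* x :+ E)) ℚ.≃-refl N (l j) (ε j) E ⟩
      N ℚ.* l j ℚ.+ (N ℚ.* ε j ℚ.+ E) ≤⟨ ℚ.+-monoʳ-≤ (N ℚ.* l j) (ℚ.+-monoˡ-≤ E (ℚ.≤-trans (Nε≤1 j n≤) (ℚ.p≤q+p (+ 1 / 1) (+ 1 / 1)))) ⟩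
      N ℚ.* l j ℚ.+ (2ℚ ℚ.+ E) ∎
    ... | inj₂ c≃v = begin
      M ℚ.+ N ℚ.* c ≃⟨ ℚ.+-congʳ M (ℚ.*-congˡ {N} c≃v) ⟩
      M ℚ.+ N ℚ.* v ≃⟨ M+Nv ⟩
      N ℚ.* l n ≤⟨ close n j (n≤1+n n) n≤ ⟩
      N ℚ.* l j ℚ.+ 2ℚ ≃⟨ ℚ.+-identityʳ _ ⟨
      N ℚ.* l j ℚ.+ 2ℚ ℚ.+ 0ℚᵘ ≤⟨ ℚ.+-monoʳ-≤ (N ℚ.* l j ℚ.+ 2ℚ) 0≤E ⟩
      N ℚ.* l j ℚ.+ 2ℚ ℚ.+ E ≃⟨ ℚ.+-assoc (N ℚ.* l j) 2ℚ E ⟩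
      N ℚ.* l j ℚ.+ (2ℚ ℚ.+ E) ∎

    deviation : ∀ j → n ≤ suc j → ℚ.∣ M ℚ.+ ℚ.- (N ℚ.* l j ℚ.+ ℚ.- (N ℚ.* c)) ∣ ℚ.≤ 2ℚ ℚ.+ E
    deviation j n≤ = ∣∣-lub
      (begin
        M ℚ.+ ℚ.- (x ℚ.+ ℚ.- y) ≃⟨ solve 3 (λ M x y → M :+ :- (x :+ :- y) := (M :+ y) :- x) ℚ.≃-refl M x y ⟩
        (M ℚ.+ y) ℚ.- x ≤⟨ ℚ.+-monoˡ-≤ (ℚ.- x) (upper j n≤) ⟩
        (x ℚ.+ (2ℚ ℚ.+ E)) ℚ.- x ≃⟨ solve 2 (λ x b → (x :+ b) :- x := b) ℚ.≃-refl x (2ℚ ℚ.+ E) ⟩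
        2ℚ ℚ.+ E ∎)
      (begin
        ℚ.- (M ℚ.+ ℚ.- (x ℚ.+ ℚ.- y)) ≃⟨ solve 3 (λ M x y → :- (M :+ :- (x :+ :- y)) := x :- (M :+ y)) ℚ.≃-refl M x y ⟩
        x ℚ.- (M ℚ.+ y) ≤⟨ ℚ.+-monoˡ-≤ (ℚ.- (M ℚ.+ y)) (lower j n≤) ⟩
        ((M ℚ.+ y) ℚ.+ 2ℚ) ℚ.- (M ℚ.+ y) ≃⟨ solve 2 (λ x b → (x :+ b) :- x := b) ℚ.≃-refl (M ℚ.+ y) 2ℚ ⟩
        2ℚ ≃⟨ ℚ.+-identityʳ 2ℚ ⟨
        2ℚ ℚ.+ 0ℚᵘ ≤⟨ ℚ.+-monoʳ-≤ 2ℚ 0≤E ⟩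
        2ℚ ℚ.+ E ∎)
      where
      x = N ℚ.* l j
      y = N ℚ.* c

    -- From ⌊log₂ n⌋ ≥ 1 it follows that 2 + C (1 + ⌊log₂ n⌋) ≤ 2 (2 + C) ⌊log₂ n⌋.
    logarithmic : 1 ≤ n′ → ∀ k → 2ℚ ℚ.+ E ℚ.≤ seq (2 * (2 + C) · log₂ n) k
    logarithmic 1≤n′ k = subst₂ ℚ._≤_ (sym left) (sym (/-* C′ 1 g q))
      (/-≤ (2 * 1 + C * suc λ₀ * 1) 1 (C′ * g) (1 * q) (ℕ-bound))
      where
      C′ = 2 * (2 + C)
      q = suc (C′ * suc k)
      g = ⌊log₂ n ^ q ⌋
      λ₀ = ⌊log₂ n ⌋
      left : 2ℚ ℚ.+ E ≡ + (2 * 1 + C * suc λ₀ * 1) / 1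
      left = /-+ 2 1 (C * suc λ₀) 1
      1≤λ : 1 ≤ λ₀
      1≤λ = ⌊log₂⌋-mono-≤ (s≤s 1≤n′)
      ℕ-bound : (2 * 1 + C * suc λ₀ * 1) * (1 * q) ≤ C′ * g * 1
      ℕ-bound = ℕR.begin
        (2 * 1 + C * suc λ₀ * 1) * (1 * q) ℕR.≡⟨ l₁ C λ₀ q ⟩
        (2 + C * (1 + λ₀)) * q ℕR.≤⟨ *-monoˡ-≤ q (+-mono-≤ (*-monoʳ-≤ 2 1≤λ) (*-monoʳ-≤ C (+-monoˡ-≤ λ₀ 1≤λ))) ⟩
        (2 * λ₀ + C * (λ₀ + λ₀)) * q ℕR.≤⟨ *-monoˡ-≤ q (+-monoˡ-≤ (C * (λ₀ + λ₀)) (m≤m+n (2 * λ₀) (2 * λ₀))) ⟩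
        (2 * λ₀ + 2 * λ₀ + C * (λ₀ + λ₀)) * q ℕR.≡⟨ l₂ C λ₀ q ⟩
        C′ * (q * λ₀) ℕR.≤⟨ *-monoʳ-≤ C′ (m*log≤log^ q n′) ⟩
        C′ * g ℕR.≡⟨ *-identityʳ _ ⟨
        C′ * g * 1 ℕR.∎
        where
        module ℕR = ≤-Reasoning
        l₁ : ∀ C x q → (2 * 1 + C * suc x * 1) * (1 * q) ≡ (2 + C * (1 + x)) * q
        l₁ = solve-∀
        l₂ : ∀ C x q → (2 * x + 2 * x + C * (x + x)) * q ≡ 2 * (2 + C) * (q * x)
        l₂ = solve-∀

  coefficient : ℕ → ℝ
  coefficient zero     = fromℚ w
  coefficient (suc n′) = fromℚ (c n′)

  coefficient-≥ : ∀ n → fromℚ w ≤ʳ coefficient n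
  coefficient-≥ n k = ℚ.≤-trans (bound n) (ℚ.p≤p+q (seq (coefficient n) k) (ε k ℚ.+ ε k))
    where
    bound : ∀ n → w ℚ.≤ seq (coefficient n) k
    bound zero     = ℚ.≤-refl
    bound (suc n′) = ℚ.p≤p⊔q w (v n′)

  coefficient-O : (λ n → fromℚ (averageComparisons n) -ʳ (n · log₂ n -ʳ n · coefficient n)) ∈O log₂
  -- Two nested differences evaluate their arguments at `k′`, and the multiple by n reads the
  -- logarithm at n (k′ + 1), an index large enough for `deviation`. The threshold 2 excludes n = 1,
  -- where log₂ n = 0.
  coefficient-O = 2 * (2 + C) , 2 , λ where
    (suc n′) (s≤s 1≤n′) k → let k′ = suc (2 * suc (2 * k)) in
      ℚ.≤-trans (deviation n′ (suc n′ * suc k′) (m≤n⇒m≤1+n (m≤m*n (suc n′) (suc k′))))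
        (ℚ.≤-trans (logarithmic n′ 1≤n′ k) (ℚ.p≤p+q (seq (2 * (2 + C) · log₂ (suc n′)) k) (ε k ℚ.+ ε k)))

theorem-from-rate : ∀ e z .{{_ : NonZero z}} → (∃ λ C → HasRate e z C) →
  ∃ λ (c : ℕ → ℝ) →
    (∀ n → fromℚ (+ e / z) ≤ʳ c n) ×
    ((λ n → fromℚ (averageComparisons n) -ʳ (n · log₂ n -ʳ n · c n)) ∈O log₂)
theorem-from-rate e z (C , rate) = coefficient e z C rate , coefficient-≥ e z C rate , coefficient-O e z C rate

theorem6 : ∃ λ (c : ℕ → ℝ) →
    (∀ n → fromℚ (+ 13999 / 10000) ≤ʳ c n) ×
    ((λ n → fromℚ (averageComparisons n) -ʳ (n · log₂ n -ʳ n · c n)) ∈O log₂)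
theorem6 = theorem-from-rate 13999 10000 rate
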